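{- Let $\sigma(n)$ denote the sum of the positive divisors of $n$. Call a positive integer $n$ nondeficient if $\sigma(n)/n\ge 2$ and deficient if $\sigma(n)/n<2$, and call $n$ a primitive nondeficient number (pnd) if $n$ is nondeficient and every proper divisor of $n$ is deficient. Then the series $\sum_{n \text{ a pnd}} 1/n$ converges and its value (the Erdős constant) lies in the open interval $(0.34842,\ 0.37937)$. -}

module Defs where

open import Data.Nat using (ℕ; zero; suc; _*_; _<_; _≥_)
open import Data.Nat.Divisibility using (_∣_; _∣?_)
open import Data.List using (List; filter; applyUpTo; map)
open import Data.Nat.ListAction using (sum)
open import Data.Integer using (+_)
open import Data.Rational using (ℚ; _/_; 0ℚ)
import Data.Rational as Q
open import Data.Product using (_×_)
open import Relation.Binary.PropositionalEquality using (_≢_)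

σ : ℕ → ℕ
σ n = sum (filter (λ d → d ∣? n) (applyUpTo suc n))

Deficient : ℕ → Set
Deficient n = 0 < n × σ n < 2 * n

Nondeficient : ℕ → Set
Nondeficient n = 0 < n × σ n ≥ 2 * n

PND : ℕ → Set
PND n = Nondeficient n × (∀ d → d ∣ n → d ≢ n → Deficient d)

-- 1/n as a rational (n = 0 mapped to 0; irrelevant since pnds are positive)
inv : ℕ → ℚ
inv zero = 0ℚ
inv (suc m) = + 1 / suc m

sumInv : List ℕ → ℚ
sumInv xs = Data.List.foldr Q._+_ 0ℚ (map inv xs)

module Submission where

open import Defs
open import Data.Nat
open import Data.Nat.Properties
open import Data.Nat.Divisibility
open import Data.Nat.Primality
open import Data.Nat.Coprimality using (Coprime; coprime-divisor)
open import Data.Nat.DivMod using (_/_; _%_; m/n*n≤m; m*n/n≡m; /-monoʳ-≤; m≡m%n+[m/n]*n; m%n<n)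
open import Data.Nat.Primality.Factorisation using (factorise)
open import Data.Nat.Tactic.RingSolver using (solve-∀)
open import Data.Nat.ListAction using (sum; product)
open import Data.Nat.ListAction.Properties using (sum-++; sum-↭; ∈⇒∣product)
import Data.Integer as ℤ
import Data.Integer.Properties as ℤ
open import Data.Rational as ℚ using (ℚ)
import Data.Rational.Properties as ℚ
open import Data.Rational.Unnormalised as ℚᵘ using (ℚᵘ; mkℚᵘ; *≡*; *≤*; *<*; _≃_)
import Data.Rational.Unnormalised.Properties as ℚᵘ
open import Data.Bool using (Bool; true; false; if_then_else_; T; _∧_; _∨_)
open import Data.List using (List; []; _∷_; _++_; map; filter; applyUpTo; length)
open import Data.List.Properties using (map-++; ++-assoc; ∷-injective)
open import Data.List.Relation.Unary.All as All using (All; []; _∷_)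
import Data.List.Relation.Unary.All.Properties as All
open import Data.List.Relation.Unary.AllPairs using ([]; _∷_)
open import Data.List.Relation.Unary.Any using (here; there)
open import Data.List.Relation.Unary.Unique.Propositional using (Unique)
import Data.List.Relation.Unary.Unique.Propositional.Properties as Unique
open import Data.List.Membership.Propositional using (_∈_)
open import Data.List.Membership.Propositional.Properties
open import Data.List.Relation.Binary.Permutation.Propositional.Properties using (shift; ∈-resp-↭)
open import Data.Product using (Σ; ∃; _×_; _,_; proj₁; proj₂)
open import Data.Sum using (_⊎_; inj₁; inj₂; [_,_]′)
open import Data.Empty using (⊥; ⊥-elim)
open import Data.Unit using (tt)
open import Relation.Nullary using (¬_; yes; no; Dec)
open import Relation.Nullary.Decidable using (¬?; toWitness)
open import Relation.Binary.PropositionalEquality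

-- Write h(n) = σ(n)/n, which increases along divisibility. Both bounds come from one branching. Fix
-- m and y and consider the pnds n = m r where r has no prime factor below y; the next prime q
-- either divides r or it does not. Values are normalised by m, and all sums are kept as integers
-- over a common multiple of the numbers involved. For deficient m put s = σ(m) and d = 2m - s. With
-- a new prime p, the number m p is nondeficient exactly if p ≤ s/d; call s/d the threshold of m.
--
-- Lower bound. If M is the largest σ(p^e) over the prime powers p^e exactly dividing n, then n is a
-- pnd exactly if h(n) ≥ 2 and h(n)(1 - 1/M) < 2 (`Inv`, `pnd-from-top`). So a whole range of primes
-- p up to the threshold of m yields pnds m p at once (`pnd-prime`, `family`), and their
-- contribution is read off from a table of sums of 1/p. A finite search of this kind collects more
-- than 0.34842.
--
-- Upper bound. The same branching is expanded finitely, and the remaining branches are closed by an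
-- analytic estimate valid for y ≥ 64. If h(m)(1 + 2^i/(y - 1)) ≤ 2 with i ≥ 1, so that roughly 2^i
-- further primes are needed, and σ(m) ≤ 2^ℓ, then m times the sum of 1/n is at most 4^(-i) (α +
-- 2βℓ/y)/κ; level 0 has the analogous condition h(m)(1 + 1/y) ≤ 2 (`T-bound`). The sum of 1/(p - 2)
-- over primes p in [y, 2y] is at most μ/κ = 0.165. Using none of these primes raises the level by
-- one, using one of them lowers it by one, and 1/4 + 4 · 0.165 < 1 leaves room for the correction
-- terms.
--
-- At level 0 a prime p may push the threshold far beyond p. Then `R-bound` charges μ/κ for each
-- dyadic block up to the new threshold. About log2(y/(p - y - 1)) blocks are needed, and as p runs
-- over odd numbers these counts add up to less than y (`Σalt-halvings`). For p next to y only d ≥ 1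
-- is available, so the threshold is at most σ(m); this is why ℓ enters. For y < 64 a downward
-- recursion over primes extends a weaker estimate (`crude-sound`). The bound 0.165 is checked on a
-- table of primes for small y and follows from counting residues prime to 210 for large y.
--
-- Upper estimates concern only pnds up to a cutoff N, which makes the inductions finite, but the
-- constants do not depend on N. The theorem results by evaluating the two searches: the upper one
-- gives at most 0.3793, below 0.37937.

private variable
  c d m n p q k e x y z s f f′ g ℓ : ℕ
  qs : List ℕ

-- @@Sig

sum-⊆ : ∀ {xs ys} → Unique xs → (∀ {x} → x ∈ xs → x ∈ ys) → sum xs ≤ sum ys
sum-⊆ [] _ = z≤n
sum-⊆ {x ∷ xs} (x∉ ∷ u) ⊆ys with ∈-∃++ (⊆ys (here refl))
... | as , bs , refl = ≤-trans (+-monoʳ-≤ x (sum-⊆ u inner)) (≤-reflexive (sym (sum-↭ (shift x as bs))))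
  where
  inner : ∀ {z} → z ∈ xs → z ∈ as ++ bs
  inner z∈ with ∈-resp-↭ (shift x as bs) (⊆ys (there z∈))
  ... | here refl = ⊥-elim (All.lookup x∉ z∈ refl)
  ... | there q = q

sum-map-* : ∀ k xs → sum (map (k *_) xs) ≡ k * sum xs
sum-map-* k [] = sym (*-zeroʳ k)
sum-map-* k (x ∷ xs) = trans (cong (k * x +_) (sum-map-* k xs)) (sym (*-distribˡ-+ k x _))

divisors : ℕ → List ℕ
divisors n = filter (_∣? n) (applyUpTo suc n)

divisors-unique : ∀ n → Unique (divisors n)
divisors-unique n = Unique.filter⁺ (_∣? n) (Unique.applyUpTo⁺₁ suc n λ i<j _ eq → <⇒≢ i<j (suc-injective eq))

∈-divisors⁻ : d ∈ divisors n → d ∣ n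
∈-divisors⁻ {n = n} q = proj₂ (∈-filter⁻ (_∣? n) {xs = applyUpTo suc n} q)

∈-divisors⁺ : 0 < n → d ∣ n → d ∈ divisors n
∈-divisors⁺ {n} {zero} 0<n 0∣n = ⊥-elim (<⇒≢ 0<n (sym (0∣⇒≡0 0∣n)))
∈-divisors⁺ {n} {suc d} 0<n d∣n = ∈-filter⁺ (_∣? n) (∈-applyUpTo⁺ suc (∣⇒≤ {{>-nonZero 0<n}} d∣n)) d∣n

σ-mono : 0 < d → 0 < k → k * σ d ≤ σ (k * d)
σ-mono {d} {k} 0<d 0<k = ≤-trans (≤-reflexive (sym (sum-map-* k (divisors d))))
  (sum-⊆ (Unique.map⁺ (*-cancelˡ-≡ _ _ k {{>-nonZero 0<k}}) (divisors-unique d)) incl)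
  where
  incl : ∀ {x} → x ∈ map (k *_) (divisors d) → x ∈ divisors (k * d)
  incl q with ∈-map⁻ (k *_) q
  ... | y , y∈ , refl = ∈-divisors⁺ (*-mono-≤ 0<k 0<d) (*-monoʳ-∣ k (∈-divisors⁻ y∈))

-- Abundancy grows along divisibility because multiplication by n/d sends the divisors of d to
-- distinct divisors of n; the inequality is cross-multiplied to stay in ℕ.
σ-ratio-mono : 0 < n → d ∣ n → σ d * n ≤ σ n * d
σ-ratio-mono {n} {d} 0<n (divides q eq) = begin
  σ d * n        ≡⟨ cong (σ d *_) eq ⟩
  σ d * (q * d)  ≡⟨ *-assoc (σ d) q d ⟨
  σ d * q * d    ≡⟨ cong (_* d) (*-comm (σ d) q) ⟩
  q * σ d * d    ≤⟨ *-monoˡ-≤ d (σ-mono {d} {q} (0<d {q = q} 0<n eq) (0<q {q = q} {d} 0<n eq)) ⟩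
  σ (q * d) * d  ≡⟨ cong (λ z → σ z * d) eq ⟨
  σ n * d        ∎
  where
  open ≤-Reasoning
  0<q : ∀ {n q d} → 0 < n → n ≡ q * d → 0 < q
  0<q {q = zero} 0<n refl = 0<n
  0<q {q = suc q} _ _ = z<s
  0<d : ∀ {n q d} → 0 < n → n ≡ q * d → 0 < d
  0<d {q = q} {zero} 0<n refl = ⊥-elim (<⇒≢ 0<n (sym (*-zeroʳ q)))
  0<d {d = suc d} _ _ = z<s

prime>0 : Prime p → 0 < p
prime>0 pr = >-nonZero⁻¹ _ {{prime⇒nonZero pr}}

prime>1 : Prime p → 1 < p
prime>1 pr = nonTrivial⇒n>1 _ {{prime⇒nonTrivial pr}}

∤⇒coprime : Prime p → ¬ p ∣ d → Coprime d p
∤⇒coprime pr p∤d {i} (i∣d , i∣p) with prime⇒irreducible pr i∣p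
... | inj₁ i≡1 = i≡1
... | inj₂ refl = ⊥-elim (p∤d i∣d)

∤∧∣*^⇒∣ : Prime p → ¬ p ∣ d → ∀ e → d ∣ m * p ^ e → d ∣ m
∤∧∣*^⇒∣ {p} {d} {m} pr p∤d zero h = subst (d ∣_) (*-identityʳ m) h
∤∧∣*^⇒∣ {p} {d} {m} pr p∤d (suc e) h =
  ∤∧∣*^⇒∣ pr p∤d e (coprime-divisor (∤⇒coprime pr p∤d) (subst (d ∣_) (x∙yz≈y∙xz m p (p ^ e)) h))
  where open import Algebra.Properties.CommutativeSemigroup *-commutativeSemigroup using (x∙yz≈y∙xz)

-- Divisors of m p^(e+1) are p times those of m p^e, together with those of m.
σ-step : Prime p → ¬ p ∣ m → 0 < m → ∀ e → σ (m * p ^ suc e) ≡ p * σ (m * p ^ e) + σ m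
σ-step {p} {m} pr p∤m 0<m e = ≤-antisym
    (≤-trans (sum-⊆ (divisors-unique N) to) (≤-reflexive sum≡))
    (≤-trans (≤-reflexive (sym sum≡)) (sum-⊆ uniq from))
  where
  open import Algebra.Properties.CommutativeSemigroup *-commutativeSemigroup using (x∙yz≈y∙xz)
  n₀ = m * p ^ e
  N = m * p ^ suc e
  N≡ : N ≡ p * n₀
  N≡ = x∙yz≈y∙xz m p (p ^ e)
  0<n : 0 < n₀
  0<n = *-mono-≤ 0<m (m^n>0 p {{prime⇒nonZero pr}} e)
  0<N : 0 < N
  0<N = subst (0 <_) (sym N≡) (*-mono-≤ (prime>0 pr) 0<n)
  L = map (p *_) (divisors n₀) ++ divisors m
  sum≡ : sum L ≡ p * σ n₀ + σ m
  sum≡ = trans (sum-++ (map (p *_) (divisors n₀)) (divisors m)) (cong (_+ σ m) (sum-map-* p (divisors n₀)))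
  to : ∀ {x} → x ∈ divisors N → x ∈ L
  to {x} x∈ with p ∣? x
  ... | yes (divides q refl) = ∈-++⁺ˡ (subst (_∈ map (p *_) (divisors n₀)) (*-comm p q)
          (∈-map⁺ (p *_) (∈-divisors⁺ 0<n (*-cancelˡ-∣ p {{prime⇒nonZero pr}}
             (subst₂ _∣_ (*-comm q p) N≡ (∈-divisors⁻ {n = N} x∈))))))
  ... | no p∤x = ∈-++⁺ʳ (map (p *_) (divisors n₀)) (∈-divisors⁺ {n = m} 0<m (∤∧∣*^⇒∣ {m = m} pr p∤x (suc e) (∈-divisors⁻ {n = N} x∈)))
  from : ∀ {x} → x ∈ L → x ∈ divisors N
  from x∈ with ∈-++⁻ (map (p *_) (divisors n₀)) x∈
  ... | inj₂ x∈m = ∈-divisors⁺ 0<N (∣-trans (∈-divisors⁻ {n = m} x∈m) (m∣m*n (p ^ suc e)))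
  ... | inj₁ x∈p with ∈-map⁻ (p *_) x∈p
  ...   | y , y∈ , refl = ∈-divisors⁺ 0<N (subst (p * y ∣_) (sym N≡) (*-monoʳ-∣ p (∈-divisors⁻ {n = n₀} y∈)))
  uniq : Unique L
  uniq = Unique.++⁺ (Unique.map⁺ (*-cancelˡ-≡ _ _ p {{prime⇒nonZero pr}}) (divisors-unique n₀)) (divisors-unique m) disj
    where
    disj : ∀ {x} → ¬ (x ∈ map (p *_) (divisors n₀) × x ∈ divisors m)
    disj (a , b) with ∈-map⁻ (p *_) a
    ... | y , _ , refl = p∤m (∣-trans (m∣m*n y) (∈-divisors⁻ {n = m} b))

-- sp p e = σ (p ^ e)
sp : ℕ → ℕ → ℕ
sp p zero = 1
sp p (suc e) = sp p e * p + 1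

σ-mult : Prime p → ¬ p ∣ m → 0 < m → ∀ e → σ (m * p ^ e) ≡ σ m * sp p e
σ-mult {p} {m} pr p∤m 0<m zero = trans (cong σ (*-identityʳ m)) (sym (*-identityʳ (σ m)))
σ-mult {p} {m} pr p∤m 0<m (suc e) = begin
  σ (m * p ^ suc e)             ≡⟨ σ-step pr p∤m 0<m e ⟩
  p * σ (m * p ^ e) + σ m       ≡⟨ cong (λ z → p * z + σ m) (σ-mult pr p∤m 0<m e) ⟩
  p * (σ m * sp p e) + σ m      ≡⟨ lem p (σ m) (sp p e) ⟩
  σ m * (sp p e * p + 1)        ∎
  where
  open ≡-Reasoning
  lem : ∀ p s t → p * (s * t) + s ≡ s * (t * p + 1)
  lem = solve-∀

prime-divisor : 1 < n → ∃ λ p → Prime p × p ∣ n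
prime-divisor {n} 1<n with factorise n {{>-nonZero (<-trans z<s 1<n)}}
... | record { factors = [] ; isFactorisation = eq } = ⊥-elim (<⇒≢ 1<n (sym eq))
... | record { factors = p ∷ ps ; isFactorisation = eq ; factorsPrime = pr ∷ _ } = p , pr , divides (product ps) (trans eq (*-comm p _))

*-pos⁻ʳ : ∀ a {b} → 0 < a * b → 0 < b
*-pos⁻ʳ a {zero} h = ⊥-elim (<⇒≢ h (sym (*-zeroʳ a)))
*-pos⁻ʳ a {suc b} h = z<s

*-pos⁻ˡ : ∀ a {b} → 0 < a * b → 0 < a
*-pos⁻ˡ (suc a) h = z<s

deficient-∣ : 0 < k → d ∣ k → σ k < 2 * k → Deficient d
deficient-∣ {k} {d} 0<k (divides q eq) def = 0<d , *-cancelʳ-< k (σ d) (2 * d) (begin-strict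
  σ d * k      ≤⟨ σ-ratio-mono 0<k (divides q eq) ⟩
  σ k * d      <⟨ *-monoˡ-< d {{>-nonZero 0<d}} def ⟩
  2 * k * d    ≡⟨ *-assoc 2 k d ⟩
  2 * (k * d)  ≡⟨ cong (2 *_) (*-comm k d) ⟩
  2 * (d * k)  ≡⟨ *-assoc 2 d k ⟨
  2 * d * k    ∎)
  where
  open ≤-Reasoning
  0<d = *-pos⁻ʳ q (subst (0 <_) eq 0<k)

-- Only the maximal proper divisors n/r need checking: every proper divisor divides one of them, and
-- deficiency passes to divisors.
pnd-criterion : 0 < n → 2 * n ≤ σ n → (∀ {r k} → Prime r → n ≡ r * k → σ k < 2 * k) → PND n
pnd-criterion {n} 0<n nd max-deficient = (0<n , nd) , proper
  where
  proper : ∀ d → d ∣ n → d ≢ n → Deficient d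
  proper d (divides zero eq) d≢n = ⊥-elim (<⇒≢ 0<n (sym eq))
  proper d (divides (suc zero) eq) d≢n = ⊥-elim (d≢n (sym (trans eq (+-identityʳ d))))
  proper d (divides q@(suc (suc _)) eq) d≢n with prime-divisor {q} (s<s z<s)
  ... | r , pr , divides t q≡ = deficient-∣ (*-pos⁻ʳ r (subst (0 <_) n≡ 0<n)) (divides t refl) (max-deficient pr n≡)
    where
    n≡ : n ≡ r * (t * d)
    n≡ = trans eq (trans (cong (_* d) (trans q≡ (*-comm t r))) (*-assoc r t d))

-- @@LB

private variable
  M : ℕ

div : ℕ → ℕ → ℕ
div a zero = 0
div a (suc b) = a / suc b

div*≤ : ∀ a b → div a b * b ≤ a
div*≤ a zero = z≤n
div*≤ a (suc b) = m/n*n≤m a (suc b)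

div-∣ : ∀ {a b} → 0 < b → b ∣ a → b * div a b ≡ a
div-∣ {a} {suc b} _ (divides t refl) = trans (cong (suc b *_) (m*n/n≡m t (suc b))) (*-comm (suc b) t)

≤div⇒*≤ : ∀ {a b c} → c ≤ div a b → c * b ≤ a
≤div⇒*≤ {a} {b} h = ≤-trans (*-monoˡ-≤ b h) (div*≤ a b)

div<⇒<* : ∀ {s d k} → 0 < d → div s d < k → s < k * d
div<⇒<* {s} {suc d} {k} _ lt = begin-strict
  s                                        ≡⟨ m≡m%n+[m/n]*n s (suc d) ⟩
  s % suc d + s / suc d * suc d            <⟨ +-monoˡ-< _ (m%n<n s (suc d)) ⟩
  suc (s / suc d) * suc d                  ≤⟨ *-monoˡ-≤ (suc d) lt ⟩
  k * suc d                                ∎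
  where open ≤-Reasoning

-- For a common multiple `P` of the entries this is exactly `P` times the sum of their reciprocals,
-- so rational numbers are avoided until the end.
recips : ℕ → List ℕ → ℕ
recips P xs = sum (map (div P) xs)

recips-++ : ∀ P xs ys → recips P (xs ++ ys) ≡ recips P xs + recips P ys
recips-++ P xs ys = trans (cong sum (map-++ (div P) xs ys)) (sum-++ (map (div P) xs) _)

-- n = m r with every prime factor of r at least y
record Ext (m y n : ℕ) : Set where
  constructor ext
  field
    cofactor : ℕ
    eq : n ≡ m * cofactor
    rough : y Rough cofactor

rough-mono : ∀ {r} → y ≤ z → z Rough r → y Rough r
rough-mono y≤z rz (hasNonTrivialDivisor d<y d∣r) = rz (hasNonTrivialDivisor (<-≤-trans d<y y≤z) d∣r)

Ext-mono : ∀ {n} → y ≤ z → Ext m z n → Ext m y n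
Ext-mono y≤z (ext r eq rr) = ext r eq (rough-mono y≤z rr)

Ext-prime : ∀ {n} → Prime p → Ext (m * p) p n → Ext m p n
Ext-prime {p} {m} pr (ext r refl rr) = ext (p * r) (*-assoc m p r) go
  where
  open import Data.Nat.Coprimality using (coprime-divisor)
  go : p Rough (p * r)
  go (hasNonTrivialDivisor {d} d<p d∣pr) = rr (hasNonTrivialDivisor d<p (coprime-divisor cop d∣pr))
    where
    cop : ∀ {i} → i ∣ d × i ∣ p → i ≡ 1
    cop {i} (i∣d , i∣p) with prime⇒irreducible pr i∣p
    ... | inj₁ i≡1 = i≡1
    ... | inj₂ refl = ⊥-elim (<⇒≱ d<p (∣⇒≤ {{nonTrivial⇒nonZero d}} i∣d))

Ext-disjoint : ∀ {n} → 0 < m → 1 < q → ¬ (Ext (m * q) q n × Ext m (suc q) n)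
Ext-disjoint {m} {q} 0<m 1<q (ext r eq _ , ext r′ eq′ rough) =
  rough (hasNonTrivialDivisor {{n>1⇒nonTrivial 1<q}} (n<1+n q)
    (divides r (trans (*-cancelˡ-≡ r′ (q * r) m {{>-nonZero 0<m}} (trans (sym eq′) (trans eq (*-assoc m q r)))) (*-comm q r))))

-- The divisor sum is carried as an index so that the searches update it multiplicatively and never
-- evaluate `σ`.
record Smooth (m s y : ℕ) : Set where
  constructor smooth-node
  field
    pos : 0 < m
    sig : σ m ≡ s
    smooth : ∀ {r} → Prime r → r ∣ m → r < y

smooth⇒∤ : Smooth m s y → Prime q → y ≤ q → ¬ q ∣ m
smooth⇒∤ sm pr y≤q q∣m = <⇒≱ (Smooth.smooth sm pr q∣m) y≤q

σ-pow : Smooth m s y → Prime q → y ≤ q → ∀ e → σ (m * q ^ e) ≡ s * sp q e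
σ-pow {q = q} sm pr y≤q e = trans (σ-mult pr (smooth⇒∤ sm pr y≤q) (Smooth.pos sm) e) (cong (_* sp q e) (Smooth.sig sm))

prime∣^ : ∀ {r} e → Prime r → Prime q → r ∣ q ^ e → r ≡ q
prime∣^ zero rp qp h = ⊥-elim (<⇒≢ (prime>1 rp) (sym (∣1⇒≡1 h)))
prime∣^ {q} (suc e) rp qp h with euclidsLemma q (q ^ e) rp h
... | inj₂ h′ = prime∣^ e rp qp h′
... | inj₁ r∣q with prime⇒irreducible qp r∣q
...   | inj₁ refl = ⊥-elim (¬prime[1] rp)
...   | inj₂ r≡q = r≡q

prime∣pow : ∀ {r} e → Prime r → Prime q → r ∣ m * q ^ e → r ≡ q ⊎ r ∣ m
prime∣pow {q} {m} e rp qp h with euclidsLemma m (q ^ e) rp h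
... | inj₁ r∣m = inj₂ r∣m
... | inj₂ r∣ = inj₁ (prime∣^ e rp qp r∣)

*-pos : ∀ {a b} → 0 < a → 0 < b → 0 < a * b
*-pos = *-mono-≤

pow-pos : Prime q → ∀ e → 0 < q ^ e
pow-pos {q} pr e = m^n>0 q {{prime⇒nonZero pr}} e

smooth-pow : Smooth m s y → Prime q → y ≤ q → ∀ e → Smooth (m * q ^ e) (s * sp q e) (suc q)
smooth-pow {m} {s} {y} {q} sm qp y≤q e = smooth-node (*-pos (Smooth.pos sm) (pow-pos qp e)) (σ-pow sm qp y≤q e) below
  where
  below : ∀ {r} → Prime r → r ∣ m * q ^ e → r < suc q
  below rp h with prime∣pow e rp qp h
  ... | inj₁ refl = n<1+n q
  ... | inj₂ r∣m = <-≤-trans (Smooth.smooth sm rp r∣m) (≤-trans y≤q (n≤1+n q))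

smooth-later : y ≤ z → Smooth m s y → Smooth m s z
smooth-later y≤z (smooth-node p g f) = smooth-node p g λ rp h → <-≤-trans (f rp h) y≤z

module Lower (K : ℕ) where

  -- The number x/(K m) is a lower bound for the sum of 1/n over some finite set of pnds in the
  -- branch. Asking for the bound at every common multiple `P` lets lists be concatenated.
  record LB (m y x : ℕ) : Set where
    constructor lb
    field
      list : List ℕ
      pnds : All PND list
      unique : Unique list
      exts : All (Ext m y) list
      bound : ∀ P → All (_∣ P) list → x * P ≤ K * (m * recips P list)

  lb-zero : LB m y 0
  lb-zero = lb [] [] [] [] λ _ _ → z≤n

  lb-mono : x ≤ z → LB m y z → LB m y x
  lb-mono x≤z (lb xs a b c h) = lb xs a b c λ P ap → ≤-trans (*-monoˡ-≤ P x≤z) (h P ap)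

  lb-later : y ≤ z → LB m z x → LB m y x
  lb-later y≤z (lb xs a b c h) = lb xs a b (All.map (Ext-mono y≤z) c) h

  -- The two branches are disjoint by divisibility of the cofactor by q. The value at m q is
  -- normalised by m q, hence the division by q, rounded down on the safe side.
  lb-split : Prime q → 0 < m → LB (m * q) q x → LB m (suc q) z → LB m q (div x q + z)
  lb-split {q} {m} {x} {z} pr 0<m (lb xs a b c h) (lb ys a′ b′ c′ h′) =
    lb (xs ++ ys) (All.++⁺ a a′) (Unique.++⁺ b b′ disj) (All.++⁺ (All.map (Ext-prime pr) c) (All.map (Ext-mono (n≤1+n q)) c′)) bound
    where
    disj : ∀ {n} → ¬ (n ∈ xs × n ∈ ys)
    disj (n∈xs , n∈ys) = Ext-disjoint 0<m (prime>1 pr) (All.lookup c n∈xs , All.lookup c′ n∈ys)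
    open ≤-Reasoning
    instance _ = prime⇒nonZero pr
    part : ∀ P → All (_∣ P) xs → div x q * P ≤ K * (m * recips P xs)
    part P ap = *-cancelˡ-≤ q (begin
      q * (div x q * P)             ≡⟨ lem₁ q (div x q) P ⟩
      div x q * q * P               ≤⟨ *-monoˡ-≤ P (div*≤ x q) ⟩
      x * P                         ≤⟨ h P ap ⟩
      K * (m * q * recips P xs)     ≡⟨ lem₂ K m q (recips P xs) ⟩
      q * (K * (m * recips P xs))   ∎)
      where
      lem₁ : ∀ q a P → q * (a * P) ≡ a * q * P
      lem₁ = solve-∀
      lem₂ : ∀ K m q R → K * (m * q * R) ≡ q * (K * (m * R))
      lem₂ = solve-∀
    bound : ∀ P → All (_∣ P) (xs ++ ys) → (div x q + z) * P ≤ K * (m * recips P (xs ++ ys))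
    bound P ap = begin
      (div x q + z) * P                                   ≡⟨ *-distribʳ-+ P (div x q) z ⟩
      div x q * P + z * P                                 ≤⟨ +-mono-≤ (part P (All.++⁻ˡ xs ap)) (h′ P (All.++⁻ʳ xs ap)) ⟩
      K * (m * recips P xs) + K * (m * recips P ys)       ≡⟨ lem K m (recips P xs) (recips P ys) ⟩
      K * (m * (recips P xs + recips P ys))               ≡⟨ cong (λ t → K * (m * t)) (recips-++ P xs ys) ⟨
      K * (m * recips P (xs ++ ys))                       ∎
      where
      lem : ∀ K m a b → K * (m * a) + K * (m * b) ≡ K * (m * (a + b))
      lem = solve-∀

  lb-self : PND n → LB n y K
  lb-self {n} pnd = lb (n ∷ []) (pnd ∷ []) ([] ∷ []) (ext 1 (sym (*-identityʳ n)) (rough-1 _) ∷ []) bound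
    where
    bound : ∀ P → All (_∣ P) (n ∷ []) → K * P ≤ K * (n * recips P (n ∷ []))
    bound P (n∣P ∷ []) = *-monoʳ-≤ K (≤-reflexive (sym (trans (cong (n *_) (+-identityʳ (div P n))) (div-∣ (proj₁ (proj₁ pnd)) n∣P))))

  -- Primes qs, increasing and at least y
  data Primes≥ : ℕ → List ℕ → Set where
    []  : Primes≥ y []
    _∷_ : ∀ {q qs} → Prime q × y ≤ q → Primes≥ (suc q) qs → Primes≥ y (q ∷ qs)

  primes-weaken : ∀ {qs} → y ≤ z → Primes≥ z qs → Primes≥ y qs
  primes-weaken y≤z [] = []
  primes-weaken y≤z ((pr , z≤q) ∷ ps) = (pr , ≤-trans y≤z z≤q) ∷ ps

  primes-suffix : ∀ as {bs} → Primes≥ y (as ++ bs) → Primes≥ y bs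
  primes-suffix [] ps = ps
  primes-suffix (a ∷ as) ((_ , y≤a) ∷ ps) = primes-weaken (≤-trans y≤a (n≤1+n a)) (primes-suffix as ps)

  mass : List ℕ → ℕ
  mass qs = sum (map (div K) qs)

  mass-++ : ∀ xs ys → mass (xs ++ ys) ≡ mass xs + mass ys
  mass-++ xs ys = trans (cong sum (map-++ (div K) xs ys)) (sum-++ (map (div K) xs) _)

  -- `top` says h(m/r) ≤ h(m)(1 - 1/M). Since removing one factor r from r^e exactly dividing m
  -- multiplies h by 1 - 1/σ(r^e), this means that M bounds all these σ(r^e).
  record Inv (m s M y : ℕ) : Set where
    field
      base : Smooth m s y
      def : s < 2 * m
      M>0 : 0 < M
      top : ∀ {r k} → Prime r → m ≡ r * k → σ k * r * M + s ≤ s * M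
    open Smooth base public

  -- For r = q the ratio of abundancies is computed exactly from σ(q^e) = σ(q^(e-1)) q + 1. For r
  -- dividing m the factor σ(q^e) cancels, and the old bound survives an increase of M.
  top-pow : Inv m s M y → Prime q → y ≤ q → ∀ {M′} e → M ≤ M′ → sp q e ≤ M′ →
            ∀ {r k} → Prime r → m * q ^ e ≡ r * k → σ k * r * M′ + s * sp q e ≤ s * sp q e * M′
  top-pow {m} {s} {M} {y} {q} inv qp y≤q {M′} e M≤M′ sp≤M′ {r} {k} rp eq
    with prime∣pow e rp qp (divides k (trans eq (*-comm r k)))
  top-pow {m} {s} {M} {y} {q} inv qp y≤q {M′} zero M≤M′ sp≤M′ {r} {k} rp eq | inj₁ refl =
    ⊥-elim (smooth⇒∤ (Inv.base inv) qp y≤q (divides k (trans (sym (*-identityʳ m)) (trans eq (*-comm r k)))))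
  top-pow {m} {s} {M} {y} {q} inv qp y≤q {M′} (suc e) M≤M′ sp≤M′ {r} {k} rp eq | inj₁ refl = begin
    σ k * q * M′ + s * (t * q + 1)         ≡⟨ cong (λ z → z * q * M′ + s * (t * q + 1)) σk ⟩
    s * t * q * M′ + s * (t * q + 1)       ≤⟨ +-monoʳ-≤ (s * t * q * M′) (*-monoʳ-≤ s sp≤M′) ⟩
    s * t * q * M′ + s * M′                ≡⟨ lem s t q M′ ⟩
    s * (t * q + 1) * M′                   ∎
    where
    open ≤-Reasoning
    open import Algebra.Properties.CommutativeSemigroup *-commutativeSemigroup using (x∙yz≈y∙xz)
    t = sp q e
    k≡ : k ≡ m * q ^ e
    k≡ = *-cancelˡ-≡ k (m * q ^ e) q {{prime⇒nonZero qp}} (trans (sym eq) (x∙yz≈y∙xz m q (q ^ e)))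
    σk : σ k ≡ s * t
    σk = trans (cong σ k≡) (σ-pow (Inv.base inv) qp y≤q e)
    lem : ∀ s t q M → s * t * q * M + s * M ≡ s * (t * q + 1) * M
    lem = solve-∀
  top-pow {m} {s} {M} {y} {q} inv qp y≤q {M′} e M≤M′ sp≤M′ {r} {k} rp eq | inj₂ r∣m@(divides k₀ m≡) = begin
    σ k * r * M′ + s * t           ≡⟨ cong (λ z → z * r * M′ + s * t) σk ⟩
    σ k₀ * t * r * M′ + s * t      ≡⟨ lem₁ (σ k₀) t r M′ s ⟩
    (σ k₀ * r * M′ + s) * t        ≤⟨ *-monoˡ-≤ t step ⟩
    s * M′ * t                     ≡⟨ lem₂ s M′ t ⟩
    s * t * M′                     ∎
    where
    open ≤-Reasoning
    t = sp q e
    m≡′ : m ≡ r * k₀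
    m≡′ = trans m≡ (*-comm k₀ r)
    k≡ : k ≡ k₀ * q ^ e
    k≡ = *-cancelˡ-≡ k _ r {{prime⇒nonZero rp}} (trans (sym eq) (trans (cong (_* q ^ e) m≡′) (*-assoc r k₀ (q ^ e))))
    q∤k₀ : ¬ q ∣ k₀
    q∤k₀ h = smooth⇒∤ (Inv.base inv) qp y≤q (subst (q ∣_) (sym m≡′) (∣n⇒∣m*n r h))
    σk : σ k ≡ σ k₀ * t
    σk = trans (cong σ k≡) (σ-mult qp q∤k₀ (*-pos⁻ʳ r (subst (0 <_) m≡′ (Inv.pos inv))) e)
    lem₁ : ∀ a t r M s → a * t * r * M + s * t ≡ (a * r * M + s) * t
    lem₁ = solve-∀
    lem₂ : ∀ s M t → s * M * t ≡ s * t * M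
    lem₂ = solve-∀
    base : σ k₀ * r * M + s ≤ s * M
    base = Inv.top inv rp m≡′
    c≤s : σ k₀ * r ≤ s
    c≤s = *-cancelʳ-≤ _ _ M {{>-nonZero (Inv.M>0 inv)}} (≤-trans (m≤m+n _ s) base)
    step : σ k₀ * r * M′ + s ≤ s * M′
    step with m≤n⇒∃[o]m+o≡n M≤M′
    ... | o , refl = begin
      c₀ * (M + o) + s        ≡⟨ lem₃ c₀ M o s ⟩
      c₀ * M + s + c₀ * o      ≤⟨ +-mono-≤ base (*-monoˡ-≤ o c≤s) ⟩
      s * M + s * o          ≡⟨ *-distribˡ-+ s M o ⟨
      s * (M + o)            ∎
      where
      c₀ = σ k₀ * r
      lem₃ : ∀ c₀ M o s → c₀ * (M + o) + s ≡ c₀ * M + s + c₀ * o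
      lem₃ = solve-∀

  inv-pow : Inv m s M y → Prime q → y ≤ q → ∀ {M′} e → M ≤ M′ → sp q e ≤ M′ →
            s * sp q e < 2 * (m * q ^ e) → Inv (m * q ^ e) (s * sp q e) M′ (suc q)
  inv-pow {m} {s} {M} {y} {q} inv qp y≤q e M≤M′ sp≤M′ def = record
    { base = smooth-pow (Inv.base inv) qp y≤q e
    ; def = def
    ; M>0 = ≤-trans (Inv.M>0 inv) M≤M′
    ; top = top-pow inv qp y≤q e M≤M′ sp≤M′ }

  -- The inequality on `s` and `M` says h(n)(1 - 1/M) < 2, so by `top` every n/r with r prime is
  -- deficient.
  pnd-from-top : 0 < n → 0 < M → σ n ≡ s → 2 * n ≤ s → s * M < 2 * n * M + s →
                 (∀ {r k} → Prime r → n ≡ r * k → σ k * r * M + s ≤ s * M) → PND n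
  pnd-from-top {n} {M} {s} 0<n 0<M refl nd cond top = pnd-criterion 0<n nd λ {r} {k} rp eq →
    *-cancelʳ-< (r * M) (σ k) (2 * k) (+-cancelʳ-< s _ _ (begin-strict
      σ k * (r * M) + s    ≡⟨ cong (_+ s) (*-assoc (σ k) r M) ⟨
      σ k * r * M + s      ≤⟨ top rp eq ⟩
      s * M                <⟨ cond ⟩
      2 * n * M + s        ≡⟨ cong (λ z → 2 * z * M + s) eq ⟩
      2 * (r * k) * M + s  ≡⟨ lem r k M s ⟩
      2 * k * (r * M) + s  ∎))
    where
    open ≤-Reasoning
    lem : ∀ r k M s → 2 * (r * k) * M + s ≡ 2 * k * (r * M) + s
    lem = solve-∀

  pnd-pow : Inv m s M y → Prime q → y ≤ q → ∀ {M′} e → M ≤ M′ → sp q e ≤ M′ →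
            2 * (m * q ^ e) ≤ s * sp q e → s * sp q e * M′ < 2 * (m * q ^ e) * M′ + s * sp q e → PND (m * q ^ e)
  pnd-pow inv qp y≤q e M≤M′ sp≤M′ nd cond =
    pnd-from-top (*-pos (Inv.pos inv) (pow-pos qp e)) (≤-trans (Inv.M>0 inv) M≤M′) (σ-pow (Inv.base inv) qp y≤q e) nd cond
      (top-pow inv qp y≤q e M≤M′ sp≤M′)

  -- With d = 2m - s, nondeficiency of m p is p d ≤ s. If M ≤ p + 1, the most harmful removal is
  -- that of p, which leaves the deficient m; otherwise the second alternative is the inequality h(m
  -- p)(1 - 1/M) < 2 written out.
  pnd-prime : Inv m s M y → Prime p → y ≤ p → d + s ≡ 2 * m → p * d ≤ s →
              M ≤ suc p ⊎ s * M < p * (d * M + s) + s → PND (m * p)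
  pnd-prime {m} {s} {M} {y} {p} {d} inv pp y≤p d+s p*d≤s cond = subst PND m*p (go cond)
    where
    open ≤-Reasoning
    m*p : m * p ^ 1 ≡ m * p
    m*p = cong (m *_) (*-identityʳ p)
    sp1 : sp p 1 ≡ suc p
    sp1 = lem p where
      lem : ∀ p → 1 * p + 1 ≡ suc p
      lem = solve-∀
    2mp : 2 * (m * p ^ 1) ≡ p * (d + s)
    2mp = trans (cong (2 *_) m*p) (trans (sym (*-assoc 2 m p)) (trans (*-comm (2 * m) p) (cong (p *_) (sym d+s))))
    nd : 2 * (m * p ^ 1) ≤ s * sp p 1
    nd = begin
      2 * (m * p ^ 1)  ≡⟨ 2mp ⟩
      p * (d + s)      ≡⟨ *-distribˡ-+ p d s ⟩
      p * d + p * s    ≤⟨ +-monoˡ-≤ (p * s) p*d≤s ⟩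
      s + p * s        ≡⟨ *-comm (suc p) s ⟩
      s * suc p        ≡⟨ cong (s *_) sp1 ⟨
      s * sp p 1       ∎
    0<d : 0 < d
    0<d = +-cancelʳ-< s 0 d (subst (s <_) (sym d+s) (Inv.def inv))
    0<p = prime>0 pp
    big : M ≤ suc p → PND (m * p ^ 1)
    big M≤ = pnd-pow inv pp y≤p 1 M≤ (≤-reflexive sp1) nd (begin-strict
      s * sp p 1 * suc p                            ≡⟨ cong (λ z → s * z * suc p) sp1 ⟩
      s * suc p * suc p                             <⟨ m<m+n (s * suc p * suc p) (*-pos 0<d (*-pos 0<p (z<s {p}))) ⟩
      s * suc p * suc p + d * (p * suc p)           ≡⟨ lem s p d ⟩
      p * (d + s) * suc p + s * suc p               ≡⟨ cong₂ (λ a b → a * suc p + s * b) 2mp sp1 ⟨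
      2 * (m * p ^ 1) * suc p + s * sp p 1          ∎)
      where
      lem : ∀ s p d → s * suc p * suc p + d * (p * suc p) ≡ p * (d + s) * suc p + s * suc p
      lem = solve-∀
    go : M ≤ suc p ⊎ s * M < p * (d * M + s) + s → PND (m * p ^ 1)
    go (inj₁ M≤) = big M≤
    go (inj₂ c) with ≤-total M (suc p)
    ... | inj₁ M≤ = big M≤
    ... | inj₂ ≤M = pnd-pow inv pp y≤p 1 ≤-refl (≤-trans (≤-reflexive sp1) ≤M) nd (begin-strict
      s * sp p 1 * M                          ≡⟨ cong (λ z → s * z * M) sp1 ⟩
      s * suc p * M                           ≡⟨ lem₁ s p M ⟩
      s * p * M + s * M                       <⟨ +-monoʳ-< (s * p * M) c ⟩
      s * p * M + (p * (d * M + s) + s)       ≡⟨ lem₂ s p M d ⟩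
      p * (d + s) * M + s * suc p             ≡⟨ cong₂ (λ a b → a * M + s * b) 2mp sp1 ⟨
      2 * (m * p ^ 1) * M + s * sp p 1        ∎)
      where
      lem₁ : ∀ s p M → s * suc p * M ≡ s * p * M + s * M
      lem₁ = solve-∀
      lem₂ : ∀ s p M d → s * p * M + (p * (d * M + s) + s) ≡ p * (d + s) * M + s * suc p
      lem₂ = solve-∀

-- @@Prog

max : ℕ → ℕ → ℕ
max a b = if a <ᵇ b then b else a

-- `acc` is the scaled sum of 1/p over the primes up to `v`, and `t` lists the primes after `v`. The
-- sum over a range of primes is then a difference of two such values.
data Leaf : Set where
  leaf : (acc v : ℕ) (t : List ℕ) → Leaf

data Tree : Set where
  tip : Leaf → Tree
  node : ℕ → Tree → Tree → Tree

data Built : Set where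
  built : Tree → Leaf → Built

look : Tree → ℕ → Leaf
look′ : Bool → Tree → Tree → ℕ → Leaf
look (tip l) x = l
look (node v l r) x = look′ (x <ᵇ v) l r x
look′ true l r x = look l x
look′ false l r x = look r x

-- A tip holds a window from `k` to `k′` and a value `g` that serves every m whose threshold lies in
-- that window.
data GTree : Set where
  gtip : ℕ → ℕ → ℕ → GTree
  gnode : ℕ → GTree → GTree → GTree

data GBuilt : Set where
  gbuilt : GTree → ℕ → GBuilt

glook : GTree → ℕ → GTree
glook′ : Bool → GTree → GTree → ℕ → GTree
glook (gtip a b c) x = gtip a b c
glook (gnode v l r) x = glook′ (x <ᵇ v) l r x
glook′ true l r x = glook l x
glook′ false l r x = glook r x

-- Windows have length 1 at first and relative width about 1/64 later, so little is lost by treating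
-- all thresholds of a window alike.
nextk : ℕ → ℕ
nextk k = max (suc k) (k * 65 / 64)

-- Heuristics steering the search for primitive nondeficient numbers; they play no role for correctness.
budget : ℕ
budget = 10000000000

reach : ℕ → ℕ
reach t = if t <ᵇ 140 then (if t <ᵇ 55 then (if t <ᵇ 25 then 0 else if t <ᵇ 40 then 10 else 11) else if t <ᵇ 90 then 12 else 13)
        else if t <ᵇ 8000 then (if t <ᵇ 400 then 15 else if t <ᵇ 1000 then 18 else 20)
        else if t <ᵇ 6000000 then (if t <ᵇ 70000 then 25 else 30) else if t <ᵇ 1000000000 then 40 else 80

limit : ℕ → ℕ → ℕ → ℕ
limit m s d = div (s * reach (div budget m)) (10 * d)

tabulated giveUp noSquare : ℕ → Bool
tabulated m = budget <ᵇ m * 20000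
giveUp m = budget <ᵇ m * 300
noSquare m = budget <ᵇ m * 20

module Search (K : ℕ) where

  advance : Leaf → Leaf
  advance (leaf a v []) = leaf a v []
  advance (leaf a v (p ∷ ps)) = leaf (a + div K p) p ps

  build : ℕ → Leaf → Built
  build₁ : ℕ → Built → Built
  build₂ : Tree → Leaf → Built → Built
  build zero l = built (tip l) (advance l)
  build (suc n) l = build₁ n (build n l)
  build₁ n (built t l) = build₂ t l (build n l)
  build₂ t (leaf _ v _) (built t′ l′) = built (node v t t′) l′

  -- Collects pnds m q p with q < p, q beyond the threshold H of m. The threshold of m q is H(q +
  -- 1)/(q - H), which is at least k(q + 1)/(q - k) when k ≤ H. This exceeds q only for q ≤ 2k,
  -- hence the stopping rule.
  grow : Tree → ℕ → ℕ → List ℕ → ℕ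
  grow₁ : Bool → Tree → ℕ → ℕ → ℕ → List ℕ → ℕ
  growFam : ℕ → Leaf → ℕ → ℕ
  grow T R k [] = 0
  grow T R k (q ∷ qs) = grow₁ (2 * k <ᵇ q) T (R + div K q) k q qs
  grow₁ true T R k q qs = 0
  grow₁ false T R k q qs = div (growFam R (look T (div (k * suc q) (q ∸ k))) (div (k * suc q) (q ∸ k))) q + grow T R k qs
  growFam R (leaf acc v _) H = if v ≤ᵇ H then acc ∸ R else 0

  growAt : Tree → ℕ → ℕ → Leaf → ℕ
  growAt T k k′ (leaf acc v []) = 0
  growAt T k k′ (leaf acc v (q ∷ t)) = if (k <ᵇ k′) ∧ (k′ ≤ᵇ q) then grow T acc k (q ∷ t) else 0

  gbuild : ℕ → Tree → ℕ → GBuilt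
  gbuild₀ : Tree → ℕ → ℕ → GBuilt
  gbuild₁ : ℕ → Tree → GBuilt → GBuilt
  gbuild₂ : GTree → ℕ → GBuilt → GBuilt
  gbuild zero T k = gbuild₀ T k (nextk k)
  gbuild (suc n) T k = gbuild₁ n T (gbuild n T k)
  gbuild₀ T k k′ = gbuilt (gtip k k′ (growAt T k k′ (look T (k′ ∸ 1)))) k′
  gbuild₁ n T (gbuilt t k) = gbuild₂ t k (gbuild n T k)
  gbuild₂ t k (gbuilt t′ k′) = gbuilt (gnode k t t′) k′

  module _ (T : Tree) (G : GTree) where

    -- A node m with `R` the mass of the primes already passed. With H = s/d rounded down, `fam`
    -- takes the pnds m p for primes p up to H in one subtraction, and `rest` treats larger primes
    -- either by a window or by descending into children.
    go : ℕ → ℕ → ℕ → ℕ → ℕ → List ℕ → ℕ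
    go₁ : ℕ → ℕ → ℕ → ℕ → ℕ → ℕ → List ℕ → ℕ → ℕ
    go₂ : ℕ → ℕ → ℕ → ℕ → ℕ → ℕ → List ℕ → ℕ → ℕ → Leaf → ℕ
    go₃ : Bool → ℕ → ℕ → ℕ → ℕ → ℕ → ℕ → List ℕ → ℕ → ℕ → ℕ → List ℕ → ℕ
    fam : Bool → ℕ → ℕ → ℕ → ℕ → ℕ → ℕ → ℕ → ℕ
    fam₁ : Leaf → ℕ → ℕ → ℕ → ℕ → ℕ → ℕ → ℕ
    rest : Bool → ℕ → ℕ → ℕ → ℕ → ℕ → ℕ → ℕ → ℕ → List ℕ → ℕ
    restG : GTree → ℕ → ℕ → ℕ → ℕ → ℕ → ℕ → ℕ → ℕ → List ℕ → ℕ
    restG₁ : Bool → ℕ → ℕ → ℕ → ℕ → ℕ → ℕ → ℕ → List ℕ → ℕ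
    restG₂ : Bool → ℕ → ℕ → ℕ → ℕ → ℕ → ℕ → List ℕ → ℕ
    kids : ℕ → ℕ → ℕ → ℕ → ℕ → ℕ → List ℕ → ℕ
    kids₁ : Bool → ℕ → ℕ → ℕ → ℕ → ℕ → ℕ → ℕ → List ℕ → ℕ
    pow : ℕ → ℕ → ℕ → ℕ → ℕ → ℕ → ℕ → ℕ → List ℕ → ℕ
    pow₁ : ℕ → ℕ → ℕ → ℕ → ℕ → ℕ → ℕ → ℕ → List ℕ → ℕ → ℕ

    go zero m s M R qs = 0
    go (suc f) m s M R [] = 0
    go (suc f) m s M R (y ∷ qs) = go₁ f m s M R y qs (2 * m ∸ s)
    go₁ f m s M R y qs zero = 0
    go₁ f m s M R y qs (suc d) = go₂ f m s M R y qs (suc d) (div s (suc d)) (look T (div s (suc d)))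
    go₂ f m s M R y qs d H (leaf acc v t) = go₃ ((y ≤ᵇ v) ∧ (v ≤ᵇ H)) f m s M R y qs d H acc t
    go₃ true f m s M R y qs d H acc t =
      fam ((M ≤ᵇ suc y) ∨ (s * M <ᵇ y * (d * M + s) + s)) m s M R y d acc
      + rest ((29 <ᵇ H) ∧ tabulated m) f m s M y d H acc t
    go₃ false f m s M R y qs d H acc t = rest ((29 <ᵇ H) ∧ tabulated m) f m s M y d H R (y ∷ qs)
    fam true m s M R y d acc = acc ∸ R
    -- Solving s M < p (d M + s) + s for p gives p > s (M - 1)/(d M + s); the family starts at the
    -- first prime beyond this quotient, where the condition is tested again.
    fam false m s M R y d acc = fam₁ (look T (div (s * (M ∸ 1)) (d * M + s))) m s M y d acc
    fam₁ (leaf a v []) m s M y d acc = 0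
    fam₁ (leaf a v (p ∷ _)) m s M y d acc = if (y ≤ᵇ p) ∧ (s * M <ᵇ p * (d * M + s) + s) then acc ∸ a else 0
    rest true f m s M y d H R qs = restG (glook G H) f m s M y d H R qs
    rest false f m s M y d H R qs = kids f m s M (limit m s d) R qs
    restG (gnode _ _ _) f m s M y d H R qs = 0
    restG (gtip k k′ g) f m s M y d H R qs = restG₁ (((k ≤ᵇ H) ∧ (H <ᵇ k′)) ∧ ((y ≤ᵇ k′) ∧ (M ≤ᵇ suc k′))) g f m s M d R qs
    restG₁ true g f m s M d R qs = g
    restG₁ false g f m s M d R qs = restG₂ (giveUp m) f m s M d R qs
    restG₂ true f m s M d R qs = 0
    restG₂ false f m s M d R qs = kids f m s M (limit m s d) R qs
    kids f m s M Q R [] = 0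
    kids f m s M Q R (q ∷ qs) = kids₁ (Q <ᵇ q) f m s M Q R q qs
    kids₁ true f m s M Q R q qs = 0
    kids₁ false zero m s M Q R q qs = 0
    kids₁ false (suc f) m s M Q R q qs =
      div (pow f s (m * q) (s * suc q) (max M (suc q)) (suc q) (R + div K q) q qs) q
      + kids f m s M Q (R + div K q) qs
    pow zero s mm ss M sp R q qs = 0
    pow (suc f) s mm ss M sp R q qs = pow₁ f s mm ss M sp R q qs (2 * mm ∸ ss)
    pow₁ f s mm ss M sp R q qs zero = if ss * M <ᵇ 2 * mm * M + ss then K else 0
    pow₁ f s mm ss M sp R q qs (suc d) =
      (if noSquare (mm * q) then 0 else div (pow f s (mm * q) (ss * q + s) (max M (sp * q + 1)) (sp * q + 1) R q qs) q)
      + go f mm ss M R qs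

  searchWith : ℕ → List ℕ → Tree → GBuilt → ℕ
  searchWith f ps T (gbuilt G _) = go T G f 1 1 1 0 ps

  search₁ : ℕ → List ℕ → Built → ℕ
  search₁ f ps (built T _) = searchWith f ps T (gbuild 9 T 30)

  search : ℕ → List ℕ → ℕ
  search f ps = search₁ f ps (build 14 (leaf 0 1 ps))

-- @@Up

recips-filter : ∀ {Q : ℕ → Set} (Q? : ∀ n → Dec (Q n)) P xs →
  recips P xs ≡ recips P (filter Q? xs) + recips P (filter (λ n → ¬? (Q? n)) xs)
recips-filter Q? P [] = refl
recips-filter Q? P (x ∷ xs) with Q? x
... | yes _ = trans (cong (div P x +_) (recips-filter Q? P xs)) (sym (+-assoc (div P x) _ _))
... | no _ = trans (cong (div P x +_) (recips-filter Q? P xs)) (swap (div P x) (recips P (filter Q? xs)) _)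
  where
  abstract
    swap : ∀ a b c → a + (b + c) ≡ b + (a + c)
    swap = solve-∀

n<q^n : Prime q → ∀ n → n < q ^ n
n<q^n qp zero = z<s
n<q^n {q} qp (suc n) = begin-strict
  suc n              ≤⟨ n<q^n qp n ⟩
  q ^ n              <⟨ m<m*n (q ^ n) q {{>-nonZero (pow-pos qp n)}} (prime>1 qp) ⟩
  q ^ n * q          ≡⟨ *-comm (q ^ n) q ⟩
  q ^ suc n          ∎
  where open ≤-Reasoning

pnd-cofactor-1 : ∀ {r} → PND n → 2 * m ≤ σ m → n ≡ m * r → n ≡ m
pnd-cofactor-1 {n} {m} {r} pnd nd eq with n ≟ m
... | yes n≡m = n≡m
... | no n≢m = ⊥-elim (<⇒≱ (proj₂ (proj₂ pnd m (divides r (trans eq (*-comm m r))) (λ m≡n → n≢m (sym m≡n)))) nd)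

module Upper (N : ℕ) where

  -- The sum of 1/n over the pnds of the branch is at most f/c. The cutoff `N` makes inductions on y
  -- and on exponents terminate; the values f obtained below are independent of it.
  record Bd (c m y f : ℕ) : Set where
    constructor bd
    field
      bound : ∀ {P xs} → All PND xs → Unique xs → All (Ext m y) xs → All (_≤ N) xs → All (_∣ P) xs →
              c * recips P xs ≤ f * P
  open Bd

  bd-mono : f ≤ f′ → Bd c m y f → Bd c m y f′
  bd-mono f≤f′ b = bd λ {P} a u x n d → ≤-trans (bound b a u x n d) (*-monoˡ-≤ P f≤f′)

  bd-coarsen : ∀ {c′} → c′ ≤ c → Bd c m y f → Bd c′ m y f
  bd-coarsen c′≤c b = bd λ {P} {xs} a u x n d → ≤-trans (*-monoˡ-≤ (recips P xs) c′≤c) (bound b a u x n d)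

  bd-scale : ∀ k → Bd c m y f → Bd (k * c) m y (k * f)
  bd-scale {c} {f = f} k b = bd λ {P} {xs} a u x n d → begin
    k * c * recips P xs     ≡⟨ *-assoc k c _ ⟩
    k * (c * recips P xs)   ≤⟨ *-monoʳ-≤ k (bound b a u x n d) ⟩
    k * (f * P)             ≡⟨ *-assoc k f P ⟨
    k * f * P               ∎
    where open ≤-Reasoning

  bd-cancel : ∀ k → 0 < k → Bd (k * c) m y (k * f) → Bd c m y f
  bd-cancel {c} {f = f} k 0<k b = bd λ {P} {xs} a u x n d → *-cancelˡ-≤ k {{>-nonZero 0<k}} (begin
    k * (c * recips P xs)   ≡⟨ *-assoc k c _ ⟨
    k * c * recips P xs     ≤⟨ bound b a u x n d ⟩
    k * f * P               ≡⟨ *-assoc k f P ⟩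
    k * (f * P)             ∎)
    where open ≤-Reasoning

  bd-cast : ∀ {c′} → c ≡ c′ → f ≡ f′ → Bd c m y f → Bd c′ m y f′
  bd-cast refl refl b = b

  bd-none : (∀ {n} → PND n → n ≤ N → ¬ Ext m y n) → Bd c m y f
  bd-none {c = c} none = bd λ where
    [] _ _ _ _ → ≤-trans (≤-reflexive (*-zeroʳ c)) z≤n
    (a ∷ _) _ (x ∷ _) (n≤N ∷ _) _ → ⊥-elim (none a n≤N x)

  bd-later : (∀ {n} → PND n → n ≤ N → Ext m y n → Ext m z n) → Bd c m z f → Bd c m y f
  bd-later later b = bd λ a u x n≤N d → bound b a u (go a n≤N x) n≤N d
    where
    go : ∀ {xs} → All PND xs → All (_≤ N) xs → All (Ext _ _) xs → All (Ext _ _) xs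
    go [] [] [] = []
    go (a ∷ as) (b ∷ bs) (x ∷ xs) = later a b x ∷ go as bs xs

  Ext-∤ : ¬ m * q ∣ n → Ext m q n → Ext m (suc q) n
  Ext-∤ {m} {q} m*q∤n (ext r refl rough) = ext r refl (∤⇒rough-suc (λ q∣r → m*q∤n (*-monoʳ-∣ m q∣r)) rough)

  bd-skip : ¬ Prime y → 1 < y → Bd c m (suc y) f → Bd c m y f
  bd-skip {y} {m = m} y∤ 1<y = bd-later λ _ _ (ext r eq rough) →
    ext r eq (∤⇒rough-suc (λ y∣r → y∤ (rough∧∣⇒prime {{n>1⇒nonTrivial 1<y}} rough y∣r)) rough)

  bd-split : 0 < m → 0 < q → Bd c (m * q) q f → Bd c m (suc q) g → Bd c m q (f + g)
  bd-split {m} {q} {c} {f} {g} 0<m 0<q b₁ b₂ = bd λ {P} {xs} a u x n d → begin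
    c * recips P xs
      ≡⟨ cong (c *_) (recips-filter Q? P xs) ⟩
    c * (recips P (filter Q? xs) + recips P (filter ¬Q? xs))
      ≡⟨ *-distribˡ-+ c _ _ ⟩
    c * recips P (filter Q? xs) + c * recips P (filter ¬Q? xs)
      ≤⟨ +-mono-≤
           (bound b₁ (All.filter⁺ Q? a) (Unique.filter⁺ Q? u) (yes-part x) (All.filter⁺ Q? n) (All.filter⁺ Q? d))
           (bound b₂ (All.filter⁺ ¬Q? a) (Unique.filter⁺ ¬Q? u) (no-part x) (All.filter⁺ ¬Q? n) (All.filter⁺ ¬Q? d)) ⟩
    f * P + g * P
      ≡⟨ *-distribʳ-+ P f g ⟨
    (f + g) * P  ∎
    where
    open ≤-Reasoning
    Q? = λ n → m * q ∣? n
    ¬Q? = λ n → ¬? (Q? n)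
    ext-yes : ∀ {n} → Ext m q n → m * q ∣ n → Ext (m * q) q n
    ext-yes (ext r refl rough) (divides k eq) = ext k (trans eq (*-comm k (m * q)))
      (rough∧∣⇒rough rough (divides q (*-cancelˡ-≡ r (q * k) m {{>-nonZero 0<m}} (trans eq (trans (*-comm k (m * q)) (*-assoc m q k))))))
    yes-part : ∀ {xs} → All (Ext m q) xs → All (Ext (m * q) q) (filter Q? xs)
    yes-part {xs} x = All.zipWith (λ (e , h) → ext-yes e h) (All.filter⁺ Q? x , All.all-filter Q? xs)
    no-part : ∀ {xs} → All (Ext m q) xs → All (Ext m (suc q)) (filter ¬Q? xs)
    no-part {xs} x = All.zipWith (λ (e , h) → Ext-∤ h e) (All.filter⁺ ¬Q? x , All.all-filter ¬Q? xs)

  bd-large : N < m → Bd c m y f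
  bd-large {m} N<m = bd-none λ where
    pnd n≤N (ext zero refl _) → <⇒≢ (proj₁ (proj₁ pnd)) (sym (*-zeroʳ m))
    pnd n≤N (ext (suc r) refl _) → <⇒≱ N<m (≤-trans (m≤m*n m (suc r)) n≤N)

  bd-deficient : σ m < 2 * m → N < y → Bd c m y f
  bd-deficient {m} {y} def N<y = bd-none λ where
    pnd n≤N (ext zero refl _) → <⇒≢ (proj₁ (proj₁ pnd)) (sym (*-zeroʳ m))
    pnd n≤N (ext 1 refl _) → <⇒≱ (subst (λ z → σ z < 2 * z) (sym (*-identityʳ m)) def) (proj₂ (proj₁ pnd))
    pnd n≤N (ext r@(suc (suc _)) refl rough) → <⇒≱ N<y (≤-trans (rough⇒≤ rough)
      (≤-trans (m≤n*m r m {{>-nonZero (*-pos⁻ˡ m (proj₁ (proj₁ pnd)))}}) n≤N))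

  -- A pnd that is a multiple of a nondeficient m equals m, so the branch contributes at most 1/m.
  bd-nondeficient : 2 * m ≤ σ m → Bd (c * m) m y c
  bd-nondeficient {m} {c} nd = bd λ where
    [] _ _ _ _ → ≤-trans (≤-reflexive (*-zeroʳ (c * m))) z≤n
    {P} {n ∷ []} (a ∷ []) _ (ext r eq _ ∷ []) _ (n∣P ∷ []) → ≤-reflexive (trans (*-assoc c m _) (cong (c *_)
      (trans (cong (m *_) (+-identityʳ (div P n))) (trans (cong (_* div P n) (sym (pnd-cofactor-1 {m = m} a nd eq))) (div-∣ (proj₁ (proj₁ a)) n∣P)))))
    {P} {n ∷ n′ ∷ _} (a ∷ a′ ∷ _) ((n≢n′ ∷ _) ∷ _) (ext _ eq _ ∷ ext _ eq′ _ ∷ _) _ _ →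
      ⊥-elim (n≢n′ (trans (pnd-cofactor-1 {m = m} a nd eq) (sym (pnd-cofactor-1 {m = m} a′ nd eq′))))

  bd-blocked : ∀ {m₁} → m₁ ∣ m → m₁ < m → 2 * m₁ ≤ σ m₁ → Bd c m y f
  bd-blocked {m} {m₁ = m₁} m₁∣m m₁<m nd = bd-none λ where
    pnd n≤N (ext zero refl _) → <⇒≢ (proj₁ (proj₁ pnd)) (sym (*-zeroʳ m))
    pnd n≤N (ext (suc r) refl _) → <⇒≱ (proj₂ (proj₂ pnd m₁ (∣-trans m₁∣m (m∣m*n (suc r)))
      (<⇒≢ (<-≤-trans m₁<m (m≤m*n m (suc r)))))) nd

  -- Writing q = p - 1, the sum of e/p^e over e ≥ 1 is p/q² ≤ 1/(p - 2).
  bd-powers-exact : Prime p → 0 < m → (∀ e → 0 < e → Bd (c * (m * p ^ e)) (m * p ^ e) (suc p) (e * f)) →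
                    Bd (c * ((p ∸ 1) * (p ∸ 1)) * m) (m * p) p (p * f)
  bd-powers-exact {p} {m} {c} {f} pp 0<m child = finish (p ∸ 1) (m∸n+n≡m (<⇒≤ (prime>1 pp)))
    where
    open ≤-Reasoning
    0<p = prime>0 pp
    finish : ∀ q → q + 1 ≡ p → Bd (c * (q * q) * m) (m * p) p (p * f)
    finish q q+1 =
      bd-cast refl (cong (_* f) (trans (cong (_+ 1) (*-identityˡ q)) q+1))
        (bd-cancel p 0<p (bd-cast (lem₃ c q m p) (*-assoc p (1 * q + 1) f)
          (subst₂ (λ a b → Bd (c * (q * q) * a) b p (p * (1 * q + 1) * f)) m*p m*p (all N 1 z<s (+-comm N 1)))))
      where
      m*p : m * p ^ 1 ≡ m * p
      m*p = cong (m *_) (*-identityʳ p)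
      abstract
        lem₁ : ∀ c q m t p → c * (q * q) * (m * (p * t)) ≡ p * (c * (q * q) * (m * t))
        lem₁ = solve-∀
      abstract
        lem₂ : ∀ e q f → ((1 + e) * q + 1) * f + q * q * (e * f) ≡ (q + 1) * (e * q + 1) * f
        lem₂ = solve-∀
      abstract
        lem₂′ : ∀ c q m → q * q * (c * m) ≡ c * (q * q) * m
        lem₂′ = solve-∀
      abstract
        lem₃ : ∀ c q m p → c * (q * q) * (m * p) ≡ p * (c * (q * q) * m)
        lem₃ = solve-∀
      abstract
        lem₅ : ∀ m p t → m * (p * t) ≡ m * t * p
        lem₅ = solve-∀
      -- The tail of i/p^i over i ≥ e sums to p (e q + 1)/(q² p^e). The induction runs downwards
      -- from the exponent N + 1, where p^e already exceeds the cutoff.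
      all : ∀ k e → 0 < e → k + e ≡ suc N → Bd (c * (q * q) * (m * p ^ e)) (m * p ^ e) p (p * (e * q + 1) * f)
      all zero e _ refl = bd-large (≤-trans (n≤1+n (suc N)) (≤-trans (n<q^n pp (suc N)) (m≤n*m (p ^ suc N) m {{>-nonZero 0<m}})))
      all (suc k) e 0<e eq = bd-cast refl eqn (bd-split (*-pos 0<m (pow-pos pp e)) 0<p more (bd-cast (lem₂′ c q (m * p ^ e)) refl (bd-scale (q * q) (child e 0<e))))
        where
        more : Bd (c * (q * q) * (m * p ^ e)) (m * p ^ e * p) p ((suc e * q + 1) * f)
        more = bd-cancel p 0<p (bd-cast (lem₁ c q m (p ^ e) p) (*-assoc p (suc e * q + 1) f)
          (subst (λ M → Bd (c * (q * q) * (m * p ^ suc e)) M p (p * (suc e * q + 1) * f)) (lem₅ m p (p ^ e)) (all k (suc e) z<s (trans (+-suc k e) eq))))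
        eqn : (suc e * q + 1) * f + q * q * (e * f) ≡ p * (e * q + 1) * f
        eqn = trans (lem₂ e q f) (cong (λ z → z * (e * q + 1) * f) q+1)


  bd-powers : Prime p → 3 ≤ p → 0 < m → (∀ e → 0 < e → Bd (c * (m * p ^ e)) (m * p ^ e) (suc p) (e * f)) →
              Bd (c * (p ∸ 2) * m) (m * p) p f
  bd-powers {p} {m} {c} {f} pp 3≤p 0<m child =
    bd-cancel p (prime>0 pp) (bd-coarsen (coarse (p ∸ 2) (p ∸ 1) (m∸n+n≡m (<⇒≤ (prime>1 pp))) (eq-w 3≤p)) (bd-powers-exact {c = c} pp 0<m child))
    where
    open ≤-Reasoning
    eq-w : ∀ {p} → 3 ≤ p → p ∸ 2 + 1 ≡ p ∸ 1
    eq-w {suc (suc p)} _ = +-comm p 1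
    eq-w {1} (s≤s ())
    abstract
      lem₆ : ∀ c w m → (w + 1 + 1) * (c * w * m) + c * m ≡ c * ((w + 1) * (w + 1)) * m
      lem₆ = solve-∀
    coarse : ∀ w q → q + 1 ≡ p → w + 1 ≡ q → p * (c * w * m) ≤ c * (q * q) * m
    coarse w q q+1 w+1 = begin
      p * (c * w * m)                       ≤⟨ m≤m+n _ (c * m) ⟩
      p * (c * w * m) + c * m               ≡⟨ cong (λ z → z * (c * w * m) + c * m) (trans (cong (_+ 1) w+1) q+1) ⟨
      (w + 1 + 1) * (c * w * m) + c * m     ≡⟨ lem₆ c w m ⟩
      c * ((w + 1) * (w + 1)) * m           ≡⟨ cong (λ z → c * (z * z) * m) w+1 ⟩
      c * (q * q) * m                       ∎

  bd-ceil : ∀ K → 0 < c → Bd c m y f → Bd K m y (suc (div (K * f) c))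
  bd-ceil {c} {f = f} K 0<c b = bd-cancel c 0<c (bd-mono (≤-trans (<⇒≤ (div<⇒<* {K * f} {c} 0<c ≤-refl)) (≤-reflexive (*-comm _ c)))
    (bd-cast (*-comm K c) refl (bd-scale K b)))

-- @@Pot

div-anti : ∀ D → 0 < y → y ≤ z → div D z ≤ div D y
div-anti {suc y} {suc z} D _ y≤z = /-monoʳ-≤ D y≤z

even-or-suc : ∀ n → 2 ∣ n ⊎ 2 ∣ suc n
even-or-suc zero = inj₁ (divides 0 refl)
even-or-suc (suc n) with even-or-suc n
... | inj₁ (divides k eq) = inj₂ (divides (suc k) (cong (λ z → suc (suc z)) eq))
... | inj₂ h = inj₁ h

even⇒¬prime : 2 < n → 2 ∣ n → ¬ Prime n
even⇒¬prime 2<n 2∣n pr with prime⇒irreducible pr 2∣n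
... | inj₁ ()
... | inj₂ refl = <-irrefl refl 2<n

sp≤ : ∀ p e → sp p e ≤ suc p ^ e
sp≤ p zero = ≤-refl
sp≤ p (suc e) = begin
  sp p e * p + 1                       ≤⟨ +-mono-≤ (*-monoˡ-≤ p (sp≤ p e)) (m^n>0 (suc p) e) ⟩
  suc p ^ e * p + suc p ^ e            ≡⟨ lem (suc p ^ e) p ⟩
  suc p * suc p ^ e                    ∎
  where
  open ≤-Reasoning
  abstract
    lem : ∀ a p → a * p + a ≡ suc p * a
    lem = solve-∀

sp-geometric : ∀ q e → sp (suc q) e * q + 1 ≡ suc q * suc q ^ e
sp-geometric q zero = lem q
  where
  abstract
    lem : ∀ q → 1 * q + 1 ≡ suc q * 1
    lem = solve-∀
sp-geometric q (suc e) = trans (lem (sp (suc q) e) q) (cong (suc q *_) (sp-geometric q e))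
  where
  abstract
    lem : ∀ t q → (t * suc q + 1) * q + 1 ≡ suc q * (t * q + 1)
    lem = solve-∀

-- Such a `g` exceeds the binary logarithm of p + 1 for every p in [y, 2y], yet g/y ≤ 1/8 keeps its
-- effect on the potential small.
log-room : ∀ y → 64 ≤ y → ∃ λ g → suc y * 2 ≤ 2 ^ g × 8 * g ≤ y × 8 ≤ g
log-room y 64≤y = go y y ≤-refl 64≤y
  where
  go : ∀ n y → y ≤ n → 64 ≤ y → ∃ λ g → suc y * 2 ≤ 2 ^ g × 8 * g ≤ y × 8 ≤ g
  go zero y y≤0 64≤y = ⊥-elim (<⇒≱ (s≤s z≤n) (≤-trans 64≤y y≤0))
  go (suc n) y y≤n 64≤y with y <? 128
  ... | yes y<128 = 8 , *-monoˡ-≤ 2 y<128 , 64≤y , ≤-refl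
  ... | no y≮128 with go n ⌊ y /2⌋ (s≤s⁻¹ (<-≤-trans (⌊n/2⌋<n′ y (≤-trans (s≤s z≤n) 64≤y)) y≤n)) (≤-trans (⌊n/2⌋-mono (≮⇒≥ y≮128)) ≤-refl)
    where
    ⌊n/2⌋<n′ : ∀ n → 0 < n → ⌊ n /2⌋ < n
    ⌊n/2⌋<n′ (suc n) _ = ⌊n/2⌋<n n
  ...   | g , 2y≤ , 8g≤ , 8≤g = suc g , ≤-trans top (*-monoʳ-≤ 2 2y≤) , low , ≤-trans 8≤g (n≤1+n g)
    where
    open ≤-Reasoning
    h = ⌊ y /2⌋
    y≤ : y ≤ suc (h + h)
    y≤ = begin
      y                      ≡⟨ ⌊n/2⌋+⌈n/2⌉≡n y ⟨
      h + ⌈ y /2⌉            ≤⟨ +-monoʳ-≤ h (⌊n/2⌋-mono (n≤1+n (suc y))) ⟩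
      h + suc h              ≡⟨ +-suc h h ⟩
      suc (h + h)            ∎
    top : suc y * 2 ≤ 2 * (suc h * 2)
    top = begin
      suc y * 2              ≤⟨ *-monoˡ-≤ 2 (s≤s y≤) ⟩
      suc (suc (h + h)) * 2  ≡⟨ lem h ⟩
      2 * (suc h * 2)        ∎
      where
      abstract
        lem : ∀ h → suc (suc (h + h)) * 2 ≡ 2 * (suc h * 2)
        lem = solve-∀
    low : 8 * suc g ≤ y
    low = begin
      8 * suc g     ≡⟨ *-suc 8 g ⟩
      8 + 8 * g     ≤⟨ +-mono-≤ (≤-trans (≤-trans (≤ᵇ⇒≤ 8 64 _) (⌊n/2⌋-mono (≮⇒≥ y≮128))) ≤-refl) 8g≤ ⟩
      h + h         ≤⟨ +-monoʳ-≤ h (⌊n/2⌋≤⌈n/2⌉ y) ⟩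
      h + ⌈ y /2⌉   ≡⟨ ⌊n/2⌋+⌈n/2⌉≡n y ⟩
      y             ∎

-- halvings n t j is the number of times t has to be halved (rounding up) until it is at most j.
halvings : ℕ → ℕ → ℕ → ℕ
halvings zero t j = 0
halvings (suc n) t j = if j <ᵇ t then suc (halvings n ⌈ t /2⌉ j) else 0

n≤⌈n/2⌉*2 : ∀ n → n ≤ ⌈ n /2⌉ * 2
n≤⌈n/2⌉*2 n = begin
  n                        ≡⟨ ⌊n/2⌋+⌈n/2⌉≡n n ⟨
  ⌊ n /2⌋ + ⌈ n /2⌉        ≤⟨ +-monoˡ-≤ ⌈ n /2⌉ (⌊n/2⌋≤⌈n/2⌉ n) ⟩
  ⌈ n /2⌉ + ⌈ n /2⌉        ≡⟨ cong (⌈ n /2⌉ +_) (+-identityʳ _) ⟨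
  2 * ⌈ n /2⌉              ≡⟨ *-comm 2 ⌈ n /2⌉ ⟩
  ⌈ n /2⌉ * 2              ∎
  where open ≤-Reasoning

halvings-suffice : ∀ n t j → t ≤ suc n → 0 < j → t ≤ j * 2 ^ halvings n t j
halvings-suffice zero t j t≤1 0<j = ≤-trans t≤1 (≤-trans 0<j (≤-reflexive (sym (*-identityʳ j))))
halvings-suffice (suc n) t j t≤ 0<j with j <ᵇ t in eq
... | false = ≤-trans (≮⇒≥ (λ j<t → subst T eq (<⇒<ᵇ j<t))) (≤-reflexive (sym (*-identityʳ j)))
... | true = begin
  t                               ≤⟨ n≤⌈n/2⌉*2 t ⟩
  ⌈ t /2⌉ * 2                     ≤⟨ *-monoˡ-≤ 2 (halvings-suffice n ⌈ t /2⌉ j half 0<j) ⟩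
  j * 2 ^ h * 2                   ≡⟨ *-assoc j (2 ^ h) 2 ⟩
  j * (2 ^ h * 2)                 ≡⟨ cong (j *_) (*-comm (2 ^ h) 2) ⟩
  j * 2 ^ suc h                   ∎
  where
  open ≤-Reasoning
  h = halvings n ⌈ t /2⌉ j
  half : ⌈ t /2⌉ ≤ suc n
  half = ≤-trans (⌈n/2⌉-mono t≤) (s≤s (⌈n/2⌉≤n n))

-- Sum of h j over every other j among k consecutive values.
Σalt : Bool → (ℕ → ℕ) → ℕ → ℕ → ℕ
Σalt b h j zero = 0
Σalt true h j (suc k) = h j + Σalt false h (suc j) k
Σalt false h j (suc k) = Σalt true h (suc j) k

below : ℕ → ℕ → ℕ
below t i = if i <ᵇ t then 1 else 0

below-yes : ∀ {i t} → i < t → below t i ≡ 1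
below-yes {i} {t} i<t with i <ᵇ t | <⇒<ᵇ i<t
... | true | _ = refl

below-no : ∀ {i t} → t ≤ i → below t i ≡ 0
below-no {i} {t} t≤i with i <ᵇ t in eq
... | false = refl
... | true = ⊥-elim (<⇒≱ (<ᵇ⇒< i t (subst T (sym eq) _)) t≤i)

∸-suc : ∀ {t j} → j < t → t ∸ j ≡ suc (t ∸ suc j)
∸-suc {t} {j} j<t = trans (cong (_∸ j) (sym (m+[n∸m]≡n j<t))) (trans (cong (_∸ j) (sym (+-suc j _))) (m+n∸m≡n j _))

Σalt-count : ∀ t j k → 2 * Σalt true (below t) j k ≤ 1 + (t ∸ j) × 2 * Σalt false (below t) j k ≤ t ∸ j
Σalt-count t j zero = z≤n , z≤n
Σalt-count t j (suc k) with Σalt-count t (suc j) k | j <? t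
... | ih₁ , ih₂ | yes j<t rewrite below-yes j<t | ∸-suc j<t =
  ≤-trans (≤-reflexive (*-distribˡ-+ 2 1 (Σalt false (below t) (suc j) k))) (s≤s (s≤s ih₂)) , ih₁
... | ih₁ , ih₂ | no j≮t rewrite below-no (≮⇒≥ j≮t) | m≤n⇒m∸n≡0 (≮⇒≥ j≮t) | m≤n⇒m∸n≡0 (≤-trans (≮⇒≥ j≮t) (n≤1+n j)) =
  ≤-trans ih₂ z≤n , tiny (Σalt true (below t) (suc j) k) ih₁
  where
  tiny : ∀ c → 2 * c ≤ 1 → 2 * c ≤ 0
  tiny zero _ = z≤n
  tiny (suc c) h = ⊥-elim (<⇒≱ (s≤s (s≤s z≤n)) (≤-trans (≤-reflexive (sym (*-suc 2 c))) h))

Σalt-mono : ∀ {h h′} b j k → (∀ i → h i ≤ h′ i) → Σalt b h j k ≤ Σalt b h′ j k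
Σalt-mono b j zero le = z≤n
Σalt-mono true j (suc k) le = +-mono-≤ (le j) (Σalt-mono false (suc j) k le)
Σalt-mono false j (suc k) le = Σalt-mono true (suc j) k le

Σalt-+ : ∀ {h h′} b j k → Σalt b (λ i → h i + h′ i) j k ≡ Σalt b h j k + Σalt b h′ j k
Σalt-+ b j zero = refl
Σalt-+ {h} {h′} true j (suc k) = trans (cong (h j + h′ j +_) (Σalt-+ {h} {h′} false (suc j) k)) (lem (h j) (h′ j) _ _)
  where
  abstract
    lem : ∀ a b c d → a + b + (c + d) ≡ a + c + (b + d)
    lem = solve-∀
Σalt-+ {h} {h′} false j (suc k) = Σalt-+ {h} {h′} true (suc j) k

Σalt-0 : ∀ b j k → Σalt b (λ _ → 0) j k ≡ 0
Σalt-0 b j zero = refl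
Σalt-0 true j (suc k) = Σalt-0 false (suc j) k
Σalt-0 false j (suc k) = Σalt-0 true (suc j) k

-- The sum telescopes because each halving step t ↦ ⌈t/2⌉ removes as much as it counts.
Σalt-halvings : ∀ b n t k → 0 < t → suc (Σalt b (halvings n t) 1 k) ≤ t
Σalt-halvings b zero t k 0<t = ≤-trans (s≤s (≤-reflexive (Σalt-0 b 1 k))) 0<t
Σalt-halvings b (suc n) t k 0<t = begin
  suc (Σalt b (halvings (suc n) t) 1 k)
    ≤⟨ s≤s (Σalt-mono b 1 k split) ⟩
  suc (Σalt b (λ i → below t i + halvings n ⌈ t /2⌉ i) 1 k)
    ≡⟨ cong suc (Σalt-+ b 1 k) ⟩
  suc (Σalt b (below t) 1 k + Σalt b (halvings n ⌈ t /2⌉) 1 k)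
    ≡⟨ +-suc (Σalt b (below t) 1 k) _ ⟨
  Σalt b (below t) 1 k + suc (Σalt b (halvings n ⌈ t /2⌉) 1 k)
    ≤⟨ +-mono-≤ (count b) (Σalt-halvings b n ⌈ t /2⌉ k (⌈n/2⌉-mono 0<t)) ⟩
  ⌊ t /2⌋ + ⌈ t /2⌉
    ≡⟨ ⌊n/2⌋+⌈n/2⌉≡n t ⟩
  t ∎
  where
  open ≤-Reasoning
  split : ∀ i → halvings (suc n) t i ≤ below t i + halvings n ⌈ t /2⌉ i
  split i with i <ᵇ t
  ... | true = ≤-refl
  ... | false = z≤n
  halve : ∀ c t → 2 * c ≤ t → c ≤ ⌊ t /2⌋
  halve c t le = ≤-trans (≤-reflexive (sym (trans (cong ⌊_/2⌋ (cong (c +_) (+-identityʳ c))) (sym (n≡⌊n+n/2⌋ c))))) (⌊n/2⌋-mono le)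
  1+t∸1 : ∀ {t} → 0 < t → 1 + (t ∸ 1) ≡ t
  1+t∸1 {suc t} _ = refl
  count : ∀ b → Σalt b (below t) 1 k ≤ ⌊ t /2⌋
  count true = halve _ t (≤-trans (proj₁ (Σalt-count t 1 k)) (≤-reflexive (1+t∸1 0<t)))
  count false = halve _ t (≤-trans (proj₂ (Σalt-count t 1 k)) (m∸n≤m t 1))

pow-log : ∀ g e → p < 2 ^ g → s ≤ 2 ^ ℓ → s * sp p e ≤ 2 ^ (ℓ + e * g)
pow-log {p} {s} {ℓ} g e p<2^g s≤ = begin
  s * sp p e              ≤⟨ *-mono-≤ s≤ (≤-trans (sp≤ p e) (^-monoˡ-≤ e p<2^g)) ⟩
  2 ^ ℓ * (2 ^ g) ^ e     ≡⟨ cong (2 ^ ℓ *_) (trans (^-*-assoc 2 g e) (cong (2 ^_) (*-comm g e))) ⟩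
  2 ^ ℓ * 2 ^ (e * g)     ≡⟨ ^-distribˡ-+-* 2 ℓ (e * g) ⟨
  2 ^ (ℓ + e * g)         ∎
  where open ≤-Reasoning

deficient-from : 0 < m → 0 < c → s * (c + x) ≤ 2 * m * x → s < 2 * m
deficient-from {m} {c} {s} {x} 0<m 0<c le = ≰⇒> λ 2m≤s → <⇒≱ (begin-strict
  2 * m * x             ≤⟨ *-monoˡ-≤ x 2m≤s ⟩
  s * x                 <⟨ m<n+m (s * x) (*-pos (<-≤-trans (*-pos (z<s {1}) 0<m) 2m≤s) 0<c) ⟩
  s * c + s * x         ≡⟨ *-distribˡ-+ s c x ⟨
  s * (c + x)           ∎) le
  where open ≤-Reasoning

-- With h = s/m the bounds compare 2/h with 1 + c/q; multiplying h by at most p/(p - 1) with p = q + 1 costs one unit of c.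
child-bound : ∀ {t X} q a → 0 < q → t * q + 1 ≡ suc q * X → s * (a + suc q) ≤ 2 * m * q → s * t * (a + suc q) ≤ 2 * (m * X) * suc q
child-bound {s} {m} {t} {X} q a 0<q tq le = *-cancelʳ-≤ _ _ q {{>-nonZero 0<q}} (begin
  s * t * (a + suc q) * q              ≡⟨ lem₁ s t (a + suc q) q ⟩
  t * q * (s * (a + suc q))            ≤⟨ *-monoˡ-≤ _ (≤-trans (m≤m+n (t * q) 1) (≤-reflexive tq)) ⟩
  suc q * X * (s * (a + suc q))        ≤⟨ *-monoʳ-≤ (suc q * X) le ⟩
  suc q * X * (2 * m * q)              ≡⟨ lem₂ q X m ⟩
  2 * (m * X) * suc q * q              ∎)
  where
  open ≤-Reasoning
  abstract
    lem₁ : ∀ s t b q → s * t * b * q ≡ t * q * (s * b)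
    lem₁ = solve-∀
    lem₂ : ∀ q X m → suc q * X * (2 * m * q) ≡ 2 * (m * X) * suc q * q
    lem₂ = solve-∀

-- The sharp version at level 0 for p = y + j + 1: (1 + 1/y)(1 - 1/p) = 1 + j/(p y). The surplus
-- j/(p y) later bounds the new threshold.
child-bound-near : ∀ {t X} y j → 0 < y → t * (y + j) + 1 ≡ suc (y + j) * X → s * suc y ≤ 2 * m * y →
                   s * t * (j + suc (y + j) * y) ≤ 2 * (m * X) * (suc (y + j) * y)
child-bound-near {s} {m} {t} {X} y j 0<y tq le = *-cancelʳ-≤ _ _ q₀ {{>-nonZero (≤-trans 0<y (m≤m+n y j))}} (begin
  s * t * (j + suc q₀ * y) * q₀          ≡⟨ lem₁ s t y j ⟩
  t * q₀ * (q₀ * (s * suc y))            ≤⟨ *-mono-≤ (≤-trans (m≤m+n (t * q₀) 1) (≤-reflexive tq)) (*-monoʳ-≤ q₀ le) ⟩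
  suc q₀ * X * (q₀ * (2 * m * y))        ≡⟨ lem₂ q₀ X m y ⟩
  2 * (m * X) * (suc q₀ * y) * q₀        ∎)
  where
  open ≤-Reasoning
  q₀ = y + j
  abstract
    lem₁ : ∀ s t y j → s * t * (j + suc (y + j) * y) * (y + j) ≡ t * (y + j) * ((y + j) * (s * suc y))
    lem₁ = solve-∀
    lem₂ : ∀ q X m y → suc q * X * (q * (2 * m * y)) ≡ 2 * (m * X) * (suc q * y) * q
    lem₂ = solve-∀

module Cell (N D : ℕ) (D-exact : ∀ k → 0 < k → k ≤ N → k * div D k ≡ D) where
  open Upper N

  -- Summing e/p^e over the exponents costs at most 1/(p - 2). Since `D` is a multiple of all
  -- positive integers up to N, the scaled weight is an exact quotient.
  weight : ℕ → ℕ
  weight p with prime? p | p ≤? N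
  ... | yes _ | yes _ = div D (p ∸ 2)
  ... | _ | _ = 0

  weight≤ : ∀ p → weight p ≤ div D (p ∸ 2)
  weight≤ p with prime? p | p ≤? N
  ... | yes _ | yes _ = ≤-refl
  ... | yes _ | no _ = z≤n
  ... | no _ | _ = z≤n

  weight-¬prime : ¬ Prime p → weight p ≡ 0
  weight-¬prime {p} ¬pr with prime? p | p ≤? N
  ... | yes pr | _ = ⊥-elim (¬pr pr)
  ... | no _ | _ = refl

  Σw : (ℕ → ℕ) → ℕ → ℕ → ℕ
  Σw f y zero = 0
  Σw f y (suc k) = f y * weight y + Σw f (suc y) k

  mass : ℕ → ℕ → ℕ
  mass = Σw (λ _ → 1)

  Σw-linear : ∀ a b (f : ℕ → ℕ) y k → Σw (λ p → a + b * f p) y k ≡ a * mass y k + b * Σw f y k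
  Σw-linear a b f y zero = sym (cong₂ _+_ (*-zeroʳ a) (*-zeroʳ b))
  Σw-linear a b f y (suc k) = trans (cong ((a + b * f y) * weight y +_) (Σw-linear a b f (suc y) k)) (lem a b (f y) (weight y) (mass (suc y) k) _)
    where
    abstract
      lem : ∀ a b h w M S → (a + b * h) * w + (a * M + b * S) ≡ a * (1 * w + M) + b * (h * w + S)
      lem = solve-∀

  Σw-++ : ∀ f y a b → Σw f y (a + b) ≡ Σw f y a + Σw f (y + a) b
  Σw-++ f y zero b = cong (λ z → Σw f z b) (sym (+-identityʳ y))
  Σw-++ f y (suc a) b = trans (cong (f y * weight y +_) (trans (Σw-++ f (suc y) a b) (cong (λ z → Σw f (suc y) a + Σw f z b) (sym (+-suc y a)))))
    (sym (+-assoc (f y * weight y) _ _))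

  cell-step : ∀ c h → 3 ≤ y → 0 < m →
    (∀ e → Prime y → y ≤ N → 0 < e → Bd (c * (m * y ^ e)) (m * y ^ e) (suc y) (e * h)) →
    Bd (D * (c * m)) m (suc y) g → Bd (D * (c * m)) m y (h * weight y + g)
  cell-step {y} {m} {g} c h 3≤y 0<m child later with prime? y | y ≤? N
  ... | no ¬pr | _ = bd-skip ¬pr (≤-trans (s≤s (s≤s z≤n)) 3≤y) (bd-mono (m≤n+m g (h * 0)) later)
  ... | yes pr | no y≰N = bd-mono (m≤n+m g (h * 0)) (bd-split {f = 0} 0<m (prime>0 pr) (bd-large (<-≤-trans (≰⇒> y≰N) (m≤n*m y m {{>-nonZero 0<m}}))) later)
  ... | yes pr | yes y≤N = bd-cast refl (cong (_+ g) (*-comm w h)) (bd-split 0<m (prime>0 pr) now later)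
    where
    w = div D (y ∸ 2)
    now : Bd (D * (c * m)) (m * y) y (w * h)
    now = bd-cast (trans (lem₁ w c (y ∸ 2) m) (cong (_* (c * m)) (D-exact (y ∸ 2) (m<n⇒0<n∸m 3≤y) (≤-trans (m∸n≤m y 2) y≤N)))) refl
      (bd-scale w (bd-powers {c = c} pr 3≤y 0<m λ e 0<e → child e pr y≤N 0<e))
      where
      abstract
        lem₁ : ∀ w c v m → w * (c * v * m) ≡ v * w * (c * m)
        lem₁ = solve-∀

  -- Splits the branch by the first prime p of [y, y + k) that is used, with its exponent e. Child
  -- bounds of size e f(p) sum to f(p)/(p - 2); the branch using no such prime contributes g.
  cell : ∀ c (f : ℕ → ℕ) k → 3 ≤ y → 0 < m →
    (∀ p e → Prime p → y ≤ p → p < y + k → p ≤ N → 0 < e → Bd (c * (m * p ^ e)) (m * p ^ e) (suc p) (e * f p)) →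
    Bd (c * m) m (y + k) g → Bd (D * (c * m)) m y (D * g + Σw f y k)
  cell {y} {m} {g} c f zero 3≤y 0<m child b =
    bd-cast refl (sym (+-identityʳ (D * g))) (bd-scale D (subst (λ z → Bd (c * m) m z g) (+-identityʳ y) b))
  cell {y} {m} {g} c f (suc k) 3≤y 0<m child b = bd-cast refl (lem (f y * weight y) (D * g) (Σw f (suc y) k))
    (cell-step c (f y) 3≤y 0<m (λ e pr → child y e pr ≤-refl (m<m+n y z<s))
      (cell c f k (≤-trans 3≤y (n≤1+n y)) 0<m
        (λ p e pp y<p p< → child p e pp (<⇒≤ y<p) (subst (p <_) (sym (+-suc y k)) p<))
        (subst (λ z → Bd (c * m) m z g) (+-suc y k) b)))
    where
    abstract
      lem : ∀ h G S → h + (G + S) ≡ G + (h + S)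
      lem = solve-∀

-- @@Pot2

linear₁ : ∀ κ α β μ {D X Y Z} → κ * α + 16 * μ * α + 4 * μ * β ≤ 4 * κ * α → κ * β + 32 * μ * β ≤ 8 * κ * β →
  2 * Y ≤ X → 8 * Z ≤ D →
  κ * (α * D + 2 * β * Y) + 16 * μ * (α * D + 2 * β * (X + Z)) ≤ 4 * κ * (α * D + 2 * β * X)
linear₁ κ α β μ {D} {X} {Y} {Z} h₁ h₂ hY hZ = begin
  κ * (α * D + 2 * β * Y) + 16 * μ * (α * D + 2 * β * (X + Z))
    ≡⟨ lem₁ κ α β μ D X Y Z ⟩
  (κ * α + 16 * μ * α) * D + 4 * μ * β * (8 * Z) + (κ * β * (2 * Y) + 32 * μ * β * X)
    ≤⟨ +-mono-≤ (+-monoʳ-≤ ((κ * α + 16 * μ * α) * D) (*-monoʳ-≤ (4 * μ * β) hZ)) (+-monoˡ-≤ (32 * μ * β * X) (*-monoʳ-≤ (κ * β) hY)) ⟩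
  (κ * α + 16 * μ * α) * D + 4 * μ * β * D + (κ * β * X + 32 * μ * β * X)
    ≡⟨ cong₂ _+_ (*-distribʳ-+ D (κ * α + 16 * μ * α) (4 * μ * β)) (*-distribʳ-+ X (κ * β) (32 * μ * β)) ⟨
  (κ * α + 16 * μ * α + 4 * μ * β) * D + (κ * β + 32 * μ * β) * X
    ≤⟨ +-mono-≤ (*-monoˡ-≤ D h₁) (*-monoˡ-≤ X h₂) ⟩
  4 * κ * α * D + 8 * κ * β * X
    ≡⟨ lem₂ κ α β D X ⟩
  4 * κ * (α * D + 2 * β * X) ∎
  where
  open ≤-Reasoning
  abstract
    lem₁ : ∀ κ α β μ D X Y Z → κ * (α * D + 2 * β * Y) + 16 * μ * (α * D + 2 * β * (X + Z)) ≡
      (κ * α + 16 * μ * α) * D + 4 * μ * β * (8 * Z) + (κ * β * (2 * Y) + 32 * μ * β * X)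
    lem₁ = solve-∀
    lem₂ : ∀ κ α β D X → 4 * κ * α * D + 8 * κ * β * X ≡ 4 * κ * (α * D + 2 * β * X)
    lem₂ = solve-∀

-- Closes the induction at level 0, as `linear₁` does at positive levels: once Y ≤ X/2 and Z ≤ D/8
-- are inserted, comparing coefficients of D and X leaves two numerical conditions on the constants.
-- The factors 31 and 32 come from replacing 1/(y - 2) by 1/y.
linear₀ : ∀ κ α β μ {D X Y Z} →
  31 * κ * α + 124 * μ * α + 124 * μ * κ + (31 * μ * β + 16 * μ * κ) ≤ 124 * κ * α →
  31 * κ * β + (248 * μ * β + 128 * μ * κ) ≤ 248 * κ * β →
  2 * Y ≤ X → 8 * Z ≤ D →
  31 * κ * (α * D + 2 * β * Y) + 124 * μ * (α * D + 2 * β * (X + Z)) + 4 * μ * κ * (32 * (X + Z) + 31 * D) ≤ 124 * κ * (α * D + 2 * β * X)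
linear₀ κ α β μ {D} {X} {Y} {Z} h₁ h₂ hY hZ = begin
  31 * κ * (α * D + 2 * β * Y) + 124 * μ * (α * D + 2 * β * (X + Z)) + 4 * μ * κ * (32 * (X + Z) + 31 * D)
    ≡⟨ lem₁ κ α β μ D X Y Z ⟩
  a₁ * D + b₁ * (8 * Z) + (c₁ * (2 * Y) + e₁ * X)
    ≤⟨ +-mono-≤ (+-monoʳ-≤ (a₁ * D) (*-monoʳ-≤ b₁ hZ)) (+-monoˡ-≤ (e₁ * X) (*-monoʳ-≤ c₁ hY)) ⟩
  a₁ * D + b₁ * D + (c₁ * X + e₁ * X)
    ≡⟨ cong₂ _+_ (*-distribʳ-+ D a₁ b₁) (*-distribʳ-+ X c₁ e₁) ⟨
  (a₁ + b₁) * D + (c₁ + e₁) * X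
    ≤⟨ +-mono-≤ (*-monoˡ-≤ D h₁) (*-monoˡ-≤ X h₂) ⟩
  124 * κ * α * D + 248 * κ * β * X
    ≡⟨ lem₂ κ α β D X ⟩
  124 * κ * (α * D + 2 * β * X) ∎
  where
  open ≤-Reasoning
  a₁ = 31 * κ * α + 124 * μ * α + 124 * μ * κ
  b₁ = 31 * μ * β + 16 * μ * κ
  c₁ = 31 * κ * β
  e₁ = 248 * μ * β + 128 * μ * κ
  abstract
    lem₁ : ∀ κ α β μ D X Y Z → 31 * κ * (α * D + 2 * β * Y) + 124 * μ * (α * D + 2 * β * (X + Z)) + 4 * μ * κ * (32 * (X + Z) + 31 * D) ≡
      (31 * κ * α + 124 * μ * α + 124 * μ * κ) * D + (31 * μ * β + 16 * μ * κ) * (8 * Z)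
      + (31 * κ * β * (2 * Y) + (248 * μ * β + 128 * μ * κ) * X)
    lem₁ = solve-∀
    lem₂ : ∀ κ α β D X → 124 * κ * α * D + 248 * κ * β * X ≡ 124 * κ * (α * D + 2 * β * X)
    lem₂ = solve-∀

nondeficient-multiple : 0 < n → m ∣ n → 2 * m ≤ σ m → 2 * n ≤ σ n
nondeficient-multiple {n} {m} 0<n m∣n nd = ≮⇒≥ λ def → <⇒≱ (proj₂ (deficient-∣ 0<n m∣n def)) nd

-- μ/κ bounds the sum of 1/(p - 2) over a dyadic block of primes; α and β are the coefficients of
-- the potential `U`, which after division by D reads α + 2βℓ/y.
module Potential (N D : ℕ) (D-exact : ∀ k → 0 < k → k ≤ N → k * div D k ≡ D) (0<D : 0 < D)
  (κ α β μ : ℕ) (0<κ : 0 < κ) (κ≤8μ : κ ≤ μ * 8)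
  (cond₁ : κ * α + 16 * μ * α + 4 * μ * β ≤ 4 * κ * α)
  (cond₁′ : κ * β + 32 * μ * β ≤ 8 * κ * β)
  (cond₀ : 31 * κ * α + 124 * μ * α + 124 * μ * κ + (31 * μ * β + 16 * μ * κ) ≤ 124 * κ * α)
  (cond₀′ : 31 * κ * β + (248 * μ * β + 128 * μ * κ) ≤ 248 * κ * β)
  (mass-bound : ∀ y → 64 ≤ y → κ * Cell.mass N D D-exact y (suc y) ≤ μ * D) where

  open Upper N
  open Cell N D D-exact

  u : ℕ → ℕ
  u y = div D y

  U : ℕ → ℕ → ℕ
  U y ℓ = α * D + 2 * β * (ℓ * u y)

  -- A factor p^e adds e g to the logarithm. Enlarging ℓ + e g to e(ℓ + g) makes the bound linear in
  -- e, the shape that can be summed over exponents.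
  U-child : 0 < y → y ≤ z → 0 < e → U z (ℓ + e * g) ≤ e * U y (ℓ + g)
  U-child {y} {z} {e} {ℓ} {g} 0<y y≤z 0<e = begin
    α * D + 2 * β * ((ℓ + e * g) * u z)           ≤⟨ +-mono-≤ (m≤n*m (α * D) e {{>-nonZero 0<e}})
                                                       (*-monoʳ-≤ (2 * β) (*-mono-≤ (+-monoˡ-≤ (e * g) (m≤n*m ℓ e {{>-nonZero 0<e}})) (div-anti D 0<y y≤z))) ⟩
    e * (α * D) + 2 * β * ((e * ℓ + e * g) * u y) ≡⟨ lem e (α * D) β ℓ g (u y) ⟩
    e * (α * D + 2 * β * ((ℓ + g) * u y))         ∎
    where
    open ≤-Reasoning
    abstract
      lem : ∀ e a β ℓ g u → e * a + 2 * β * ((e * ℓ + e * g) * u) ≡ e * (a + 2 * β * ((ℓ + g) * u))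
      lem = solve-∀

  U-later : 0 < y → y ≤ z → U z ℓ ≤ U y ℓ
  U-later {ℓ = ℓ} 0<y y≤z = +-monoʳ-≤ (α * D) (*-monoʳ-≤ (2 * β) (*-monoʳ-≤ ℓ (div-anti D 0<y y≤z)))

  2u≤u : 0 < y → y ≤ N → 2 * u (y + suc y) ≤ u y
  2u≤u {y} 0<y y≤N = *-cancelʳ-≤ _ _ y {{>-nonZero 0<y}} (begin
    2 * u (y + suc y) * y  ≡⟨ lem (u (y + suc y)) y ⟩
    u (y + suc y) * (y + y)    ≤⟨ *-monoʳ-≤ (u (y + suc y)) (+-monoʳ-≤ y (n≤1+n y)) ⟩
    u (y + suc y) * (y + suc y)  ≤⟨ div*≤ D (y + suc y) ⟩
    D                ≡⟨ D-exact y 0<y y≤N ⟨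
    y * u y          ≡⟨ *-comm y (u y) ⟩
    u y * y          ∎)
    where
    open ≤-Reasoning
    abstract
      lem : ∀ a y → 2 * a * y ≡ a * (y + y)
      lem = solve-∀

  gu≤D : 0 < y → y ≤ N → 8 * g ≤ y → 8 * (g * u y) ≤ D
  gu≤D {y} {g} 0<y y≤N 8g≤y = begin
    8 * (g * u y)    ≡⟨ *-assoc 8 g (u y) ⟨
    8 * g * u y      ≤⟨ *-monoˡ-≤ (u y) 8g≤y ⟩
    y * u y          ≡⟨ D-exact y 0<y y≤N ⟩
    D                ∎
    where open ≤-Reasoning

  -- Level 0 says h(m)(1 + 1/y) ≤ 2, so the threshold is at most y. A level i ≥ 1 says h(m)(1 +
  -- 2^i/(y - 1)) ≤ 2; one prime power from y on multiplies h by less than 1 + 1/(y - 1), so roughly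
  -- 2^i of them are needed.
  Cond : ℕ → ℕ → ℕ → ℕ → Set
  Cond zero m s y = s * suc y ≤ 2 * m * y
  Cond (suc i) m s y = s * (2 ^ suc i + (y ∸ 1)) ≤ 2 * m * (y ∸ 1)

  cond-deficient : ∀ i → 0 < m → Cond i m s y → s < 2 * m
  cond-deficient {m} {s} {y} zero 0<m h = deficient-from {c = 1} 0<m z<s h
  cond-deficient {m} {s} {y} (suc i) 0<m h = deficient-from {c = 2 ^ suc i} 0<m (m^n>0 2 (suc i)) h

  cond-raise : ∀ c {x q} → s ≤ 2 * m → x ≤ q → s * (c + x) ≤ 2 * m * x → s * (c + q) ≤ 2 * m * q
  cond-raise {s} {m} c {x} {q} s≤ x≤q h with m≤n⇒∃[o]m+o≡n x≤q
  ... | o , refl = begin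
    s * (c + (x + o))       ≡⟨ lem s c x o ⟩
    s * (c + x) + s * o     ≤⟨ +-mono-≤ h (*-monoˡ-≤ o s≤) ⟩
    2 * m * x + 2 * m * o   ≡⟨ *-distribˡ-+ (2 * m) x o ⟨
    2 * m * (x + o)         ∎
    where
    open ≤-Reasoning
    abstract
      lem : ∀ s c x o → s * (c + (x + o)) ≡ s * (c + x) + s * o
      lem = solve-∀

  -- Doubling the lower limit for the primes halves the effect of each, so twice as many are needed.
  cond-double : ∀ i → 0 < m → 64 ≤ y → Cond i m s y → Cond (suc i) m s (y + suc y)
  cond-double {m} {y} {s} zero 0<m 64≤y h = subst (λ w → s * (2 + w) ≤ 2 * m * w) (sym 2y) (begin
    s * (2 + (y + y))    ≡⟨ lem₁ s y ⟩
    2 * (s * suc y)      ≤⟨ *-monoʳ-≤ 2 h ⟩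
    2 * (2 * m * y)      ≡⟨ lem₂ m y ⟩
    2 * m * (y + y)      ∎)
    where
    open ≤-Reasoning
    2y : y + suc y ∸ 1 ≡ y + y
    2y = cong (_∸ 1) (+-suc y y)
    abstract
      lem₁ : ∀ s y → s * (2 + (y + y)) ≡ 2 * (s * suc y)
      lem₁ = solve-∀
      lem₂ : ∀ m y → 2 * (2 * m * y) ≡ 2 * m * (y + y)
      lem₂ = solve-∀
  cond-double {m} {suc x} {s} (suc i) 0<m 64≤y h = cond-raise {m = m} (2 * b) (<⇒≤ (cond-deficient {m} {s} {suc x} (suc i) 0<m h))
    (≤-trans (+-monoʳ-≤ x (n≤1+n x)) (+-monoʳ-≤ x (n≤1+n (suc x)))) (begin
    s * (2 * b + (x + x))   ≡⟨ lem₁ s b x ⟩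
    2 * (s * (b + x))       ≤⟨ *-monoʳ-≤ 2 h ⟩
    2 * (2 * m * x)         ≡⟨ lem₂ m x ⟩
    2 * m * (x + x)         ∎)
    where
    open ≤-Reasoning
    b = 2 ^ suc i
    abstract
      lem₁ : ∀ s b x → s * (2 * b + (x + x)) ≡ 2 * (s * (b + x))
      lem₁ = solve-∀
      lem₂ : ∀ m x → 2 * (2 * m * x) ≡ 2 * m * (x + x)
      lem₂ = solve-∀

  -- One prime power uses up one unit of the 2^(i+1) available, and 2^(i+1) - 1 ≥ 2^i.
  cond-child : ∀ i {e} → 0 < m → 64 ≤ y → y ≤ p → Cond (suc i) m s y → Cond i (m * p ^ e) (s * sp p e) (suc p)
  cond-child {m} {suc x} {suc q} {s} i {e} 0<m 64≤y (s≤s x≤q) h = final i raised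
    where
    open ≤-Reasoning
    s′ = s * sp (suc q) e
    X = suc q ^ e
    0<q : 0 < q
    0<q = ≤-trans (s≤s z≤n) (≤-trans (s≤s⁻¹ 64≤y) x≤q)
    raised : s * (2 ^ suc i + q) ≤ 2 * m * q
    raised = cond-raise {m = m} (2 ^ suc i) (<⇒≤ (cond-deficient {m} {s} {suc x} (suc i) 0<m h)) x≤q h
    one-less : ∀ i → suc (2 ^ i) ≤ 2 ^ suc i
    one-less i = subst (suc (2 ^ i) ≤_) (cong (2 ^ i +_) (sym (+-identityʳ (2 ^ i)))) (+-monoˡ-≤ (2 ^ i) (m^n>0 2 i))
    below′ : ∀ i → s * (2 ^ suc i + q) ≤ 2 * m * q → s′ * (2 ^ i + suc q) ≤ 2 * (m * X) * suc q
    below′ i r = child-bound {s = s} {m = m} {t = sp (suc q) e} {X = X} q (2 ^ i) 0<q (sp-geometric q e)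
      (≤-trans (*-monoʳ-≤ s (≤-trans (≤-reflexive (+-suc (2 ^ i) q)) (+-monoˡ-≤ q (one-less i)))) r)
    final : ∀ i → s * (2 ^ suc i + q) ≤ 2 * m * q → Cond i (m * X) s′ (suc (suc q))
    final zero r = ≤-trans (≤-reflexive (lem₁ s′ q)) (≤-trans (+-mono-≤ (below′ 0 r) (<⇒≤ def′)) (≤-reflexive (lem₂ (m * X) q)))
      where
      def′ : s′ < 2 * (m * X)
      def′ = deficient-from {c = 1} {x = suc q} (*-pos 0<m (m^n>0 (suc q) e)) z<s (below′ 0 r)
      abstract
        lem₁ : ∀ s q → s * suc (suc (suc q)) ≡ s * (1 + suc q) + s
        lem₁ = solve-∀
        lem₂ : ∀ V q → 2 * V * suc q + 2 * V ≡ 2 * V * suc (suc q)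
        lem₂ = solve-∀
    final (suc i) r = below′ (suc i) r

  Σw-const : ∀ a y k → Σw (λ _ → a) y k ≡ a * mass y k
  Σw-const a y zero = sym (*-zeroʳ a)
  Σw-const a y (suc k) = trans (cong (a * weight y +_) (Σw-const a (suc y) k)) (lem a (weight y) (mass (suc y) k))
    where
    abstract
      lem : ∀ a w V → a * w + a * V ≡ a * (1 * w + V)
      lem = solve-∀

  -- The second component of the value at p bounds the number of dyadic blocks on which p times later primes can become nondeficient.
  blocks : ℕ → ℕ → ℕ → ℕ
  blocks y h p with p ≤? suc y
  ... | yes _ = h
  ... | no _ = halvings y y (p ∸ suc y)

  blocks-near : ∀ y h → p ≤ suc y → blocks y h p ≡ h
  blocks-near {p} y h p≤ with p ≤? suc y
  ... | yes _ = refl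
  ... | no p≰ = ⊥-elim (p≰ p≤)

  blocks-far : ∀ y h j → 0 < j → blocks y h (suc y + j) ≡ halvings y y j
  blocks-far y h j 0<j with suc y + j ≤? suc y
  ... | yes le = ⊥-elim (<⇒≱ (m<m+n (suc y) 0<j) le)
  ... | no _ = cong (halvings y y) (m+n∸m≡n y j)

  -- 1/(y - 2) ≤ (32/31)/y is equivalent to y ≥ 64.
  31w≤32u : 64 ≤ y → y ≤ N → 31 * div D (y ∸ 2) ≤ 32 * u y
  31w≤32u {y} 64≤y y≤N = finish (y ∸ 2) (m+[n∸m]≡n (≤-trans (s≤s (s≤s z≤n)) 64≤y)) (∸-monoˡ-≤ 2 64≤y)
    where
    open ≤-Reasoning
    abstract
      lem : ∀ q v → 31 * ((2 + q) * v) ≡ 62 * v + 31 * (q * v)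
      lem = solve-∀
      lem′ : ∀ q v → q * v + 31 * (q * v) ≡ 32 * v * q
      lem′ = solve-∀
    finish : ∀ q → 2 + q ≡ y → 62 ≤ q → 31 * div D q ≤ 32 * u y
    finish q eq 62≤q = *-cancelʳ-≤ _ _ q {{>-nonZero (≤-trans (s≤s z≤n) 62≤q)}} (begin
      31 * div D q * q           ≡⟨ *-assoc 31 (div D q) q ⟩
      31 * (div D q * q)         ≤⟨ *-monoʳ-≤ 31 (div*≤ D q) ⟩
      31 * D                     ≡⟨ cong (31 *_) (D-exact y (≤-trans (s≤s z≤n) 64≤y) y≤N) ⟨
      31 * (y * u y)             ≡⟨ cong (λ z → 31 * (z * u y)) eq ⟨
      31 * ((2 + q) * u y)       ≡⟨ lem q (u y) ⟩
      62 * u y + 31 * (q * u y)  ≤⟨ +-monoˡ-≤ (31 * (q * u y)) (*-monoˡ-≤ (u y) 62≤q) ⟩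
      q * u y + 31 * (q * u y)   ≡⟨ lem′ q (u y) ⟩
      32 * u y * q               ∎)

  -- Of y and y + 1 one is even, so at most one of them is prime.
  near-weights : 64 ≤ y → weight y + weight (suc y) ≤ div D (y ∸ 2)
  near-weights {y} 64≤y with even-or-suc y
  ... | inj₁ 2∣y = subst (λ w → w + weight (suc y) ≤ div D (y ∸ 2)) (sym (weight-¬prime (even⇒¬prime (≤-trans (s≤s (s≤s (s≤s z≤n))) 64≤y) 2∣y)))
          (≤-trans (weight≤ (suc y)) (div-anti D (m<n⇒0<n∸m (≤-trans (s≤s (s≤s (s≤s z≤n))) 64≤y)) (∸-monoˡ-≤ 2 (n≤1+n y))))
  ... | inj₂ 2∣y′ = subst (λ w → weight y + w ≤ div D (y ∸ 2)) (sym (weight-¬prime (even⇒¬prime (≤-trans (s≤s (s≤s (s≤s z≤n))) (≤-trans 64≤y (n≤1+n y))) 2∣y′)))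
          (≤-trans (≤-reflexive (+-identityʳ (weight y))) (weight≤ y))

  Parity : Bool → ℕ → Set
  Parity true p = 2 ∣ suc p
  Parity false p = 2 ∣ p

  -- Only odd p = y + 1 + j can be prime, so only every other j counts; the flag `b` tracks the
  -- parity. All weights here are at most D/y since p - 2 ≥ y.
  far-weights : ∀ b h j k → 64 ≤ y → 0 < j → Parity b (suc y + j) → Σw (blocks y h) (suc y + j) k ≤ u y * Σalt b (halvings y y) j k
  far-weights b h j zero 64≤y 0<j par = z≤n
  far-weights {y} false h j (suc k) 64≤y 0<j par = subst (_≤ u y * Σalt true (halvings y y) (suc j) k)
    (sym (trans (cong (λ w → blocks y h p₀ * w + Σw (blocks y h) (suc p₀) k) (weight-¬prime (even⇒¬prime p>2 par))) (cong (_+ Σw (blocks y h) (suc p₀) k) (*-zeroʳ (blocks y h p₀)))))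
    (subst (λ q → Σw (blocks y h) q k ≤ u y * Σalt true (halvings y y) (suc j) k) (+-suc (suc y) j)
      (far-weights true h (suc j) k 64≤y z<s (subst (Parity true) (sym (+-suc (suc y) j)) (∣m∣n⇒∣m+n (divides 1 refl) par))))
    where
    p₀ = suc y + j
    p>2 : 2 < p₀
    p>2 = ≤-trans (s≤s (s≤s (s≤s z≤n))) (≤-trans 64≤y (≤-trans (n≤1+n y) (m≤m+n (suc y) j)))
  far-weights {y} true h j (suc k) 64≤y 0<j par = begin
    blocks y h p₀ * weight p₀ + Σw (blocks y h) (suc p₀) k
      ≤⟨ +-mono-≤ (*-mono-≤ (≤-reflexive (blocks-far y h j 0<j)) (≤-trans (weight≤ p₀) (div-anti D (≤-trans (s≤s z≤n) 64≤y) y≤p-2))) later ⟩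
    halvings y y j * u y + u y * Σalt false (halvings y y) (suc j) k
      ≡⟨ cong (_+ u y * Σalt false (halvings y y) (suc j) k) (*-comm (halvings y y j) (u y)) ⟩
    u y * halvings y y j + u y * Σalt false (halvings y y) (suc j) k
      ≡⟨ *-distribˡ-+ (u y) (halvings y y j) _ ⟨
    u y * (halvings y y j + Σalt false (halvings y y) (suc j) k) ∎
    where
    open ≤-Reasoning
    p₀ = suc y + j
    y≤p-2 : y ≤ p₀ ∸ 2
    y≤p-2 = ≤-trans (≤-reflexive (sym (m+n∸n≡m y 2))) (∸-monoˡ-≤ 2 (≤-trans (≤-reflexive (trans (+-suc y 1) (sym (+-suc y 1)))) (≤-trans (≤-reflexive (+-suc y 1)) (+-monoʳ-≤ (suc y) 0<j))))
    later = subst (λ q → Σw (blocks y h) q k ≤ u y * Σalt false (halvings y y) (suc j) k) (+-suc (suc y) j)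
      (far-weights false h (suc j) k 64≤y z<s (subst (2 ∣_) (sym (+-suc (suc y) j)) par))

  -- The one possible prime among y and y + 1 pays h blocks at weight about 1/y. The remaining block
  -- counts sum to less than y by `Σalt-halvings`, so at weight D/y they cost at most D.
  blocks-total : ∀ h → 64 ≤ y → y ≤ N → 31 * Σw (blocks y h) y (suc y) ≤ 32 * (h * u y) + 31 * D
  blocks-total {y@(suc x)} h 64≤y y≤N = begin
    31 * (blocks y h y * weight y + (blocks y h (suc y) * weight (suc y) + Σw (blocks y h) (suc (suc y)) x))
      ≡⟨ cong₂ (λ a b → 31 * (a * weight y + (b * weight (suc y) + Σw (blocks y h) (suc (suc y)) x))) (blocks-near y h (n≤1+n y)) (blocks-near y h ≤-refl) ⟩
    31 * (h * weight y + (h * weight (suc y) + Σw (blocks y h) (suc (suc y)) x))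
      ≡⟨ lem h (weight y) (weight (suc y)) _ ⟩
    h * (31 * (weight y + weight (suc y))) + 31 * Σw (blocks y h) (suc (suc y)) x
      ≤⟨ +-mono-≤ (*-monoʳ-≤ h (≤-trans (*-monoʳ-≤ 31 (near-weights 64≤y)) (31w≤32u 64≤y y≤N))) (*-monoʳ-≤ 31 far) ⟩
    h * (32 * u y) + 31 * D
      ≡⟨ cong (_+ 31 * D) (lem′ h (u y)) ⟩
    32 * (h * u y) + 31 * D ∎
    where
    open ≤-Reasoning
    abstract
      lem : ∀ h a b S → 31 * (h * a + (h * b + S)) ≡ h * (31 * (a + b)) + 31 * S
      lem = solve-∀
      lem′ : ∀ h u → h * (32 * u) ≡ 32 * (h * u)
      lem′ = solve-∀
    flagged : ∀ b → Parity b (suc y + 1) → Σw (blocks y h) (suc (suc y)) x ≤ D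
    flagged b par = begin
      Σw (blocks y h) (suc (suc y)) x            ≡⟨ cong (λ q → Σw (blocks y h) q x) (+-comm 1 (suc y)) ⟩
      Σw (blocks y h) (suc y + 1) x              ≤⟨ far-weights b h 1 x 64≤y z<s par ⟩
      u y * Σalt b (halvings y y) 1 x            ≤⟨ *-monoʳ-≤ (u y) (≤-trans (n≤1+n _) (Σalt-halvings b y y x z<s)) ⟩
      u y * y                                    ≡⟨ *-comm (u y) y ⟩
      y * u y                                    ≡⟨ D-exact y z<s y≤N ⟩
      D                                          ∎
    far : Σw (blocks y h) (suc (suc y)) x ≤ D
    far with even-or-suc (suc y + 1)
    ... | inj₁ e = flagged false e
    ... | inj₂ e = flagged true e

  -- Repeating y to 2y + 1 covers everything up to 2^a y in a blocks, each of mass at most μ/κ. The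
  -- extra unit gained when a > 0 absorbs the endpoint in `R-bound`.
  block-mass : ∀ a → 64 ≤ y → ∃ λ z → 2 ^ a * y ≤ z × (0 < a → suc (2 ^ a * y) ≤ z) × y ≤ z × κ * mass y (z ∸ y) ≤ μ * D * a
  block-mass {y} zero 64≤y = y , ≤-reflexive (+-identityʳ y) , (λ ()) , ≤-refl ,
    ≤-trans (≤-reflexive (trans (cong (λ k → κ * mass y k) (n∸n≡0 y)) (*-zeroʳ κ))) z≤n
  block-mass {y} (suc a) 64≤y with block-mass {y} a 64≤y
  ... | z , 2^a≤z , _ , y≤z , ih = z + suc z , ≤-trans (n≤1+n _) big , (λ _ → big) , ≤-trans y≤z (m≤m+n z (suc z)) , (begin
    κ * mass y (z + suc z ∸ y)                       ≡⟨ cong (λ k → κ * mass y k) (+-∸-comm (suc z) y≤z) ⟩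
    κ * mass y (z ∸ y + suc z)                       ≡⟨ cong (κ *_) (trans (Σw-++ (λ _ → 1) y (z ∸ y) (suc z)) (cong (λ w → mass y (z ∸ y) + mass w (suc z)) (m+[n∸m]≡n y≤z))) ⟩
    κ * (mass y (z ∸ y) + mass z (suc z))            ≡⟨ *-distribˡ-+ κ _ _ ⟩
    κ * mass y (z ∸ y) + κ * mass z (suc z)          ≤⟨ +-mono-≤ ih (mass-bound z (≤-trans 64≤y y≤z)) ⟩
    μ * D * a + μ * D                                ≡⟨ +-comm (μ * D * a) (μ * D) ⟩
    μ * D + μ * D * a                                ≡⟨ *-suc (μ * D) a ⟨
    μ * D * suc a                                    ∎)
    where
    open ≤-Reasoning
    big : suc (2 ^ suc a * y) ≤ z + suc z
    big = begin
      suc (2 ^ suc a * y)             ≡⟨ cong suc (trans (*-assoc 2 (2 ^ a) y) (cong (2 ^ a * y +_) (+-identityʳ _))) ⟩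
      suc (2 ^ a * y + 2 ^ a * y)     ≤⟨ s≤s (+-mono-≤ 2^a≤z 2^a≤z) ⟩
      suc (z + z)                     ≡⟨ +-suc z z ⟨
      z + suc z                       ∎

  mass-mono : ∀ y {k l} → k ≤ l → mass y k ≤ mass y l
  mass-mono y z≤n = z≤n
  mass-mono y (s≤s k≤l) = +-monoʳ-≤ (1 * weight y) (mass-mono (suc y) k≤l)

  first-exceeding : ∀ a → 0 < d → y * d < s → s ≤ d * (y * 2 ^ a) → ∃ λ h → y ≤ h × h * d ≤ s × s ≤ d * suc h × h ≤ 2 ^ a * y
  first-exceeding {suc d} {y} {s} a _ yd<s s≤ = h , *-cancelʳ-≤′ (<-≤-trans yd<s s≤h+) , div*≤ s (suc d) , ≤-trans (<⇒≤ s<) (≤-reflexive (*-comm (suc h) (suc d))) ,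
      *-cancelʳ-≤ h _ (suc d) (≤-trans (div*≤ s (suc d)) (≤-trans s≤ (≤-reflexive (lem (suc d) y (2 ^ a)))))
    where
    h = div s (suc d)
    s< : s < suc h * suc d
    s< = div<⇒<* {s} {suc d} z<s ≤-refl
    s≤h+ : s ≤ suc h * suc d
    s≤h+ = <⇒≤ s<
    *-cancelʳ-≤′ : y * suc d < suc h * suc d → y ≤ h
    *-cancelʳ-≤′ lt = s≤s⁻¹ (*-cancelʳ-< (suc d) y (suc h) lt)
    abstract
      lem : ∀ d y t → d * (y * t) ≡ t * y * d
      lem = solve-∀

  -- Induction on the distance of y from the cutoff. Split over the primes of [y, 2y]: using none
  -- moves to 2y + 1 and level i + 1, gaining a factor 1/4. At positive level, using one moves to
  -- level i - 1, losing a factor 4 against mass μ/κ. At level 0 it leads to `R-bound`.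
  T-bound : ∀ n ℓ → N < y + n → ∀ i → Smooth m s y → s ≤ 2 ^ ℓ → 64 ≤ y → Cond i m s y → Bd (κ * D * 4 ^ i * m) m y (U y ℓ)
  -- The hypothesis says that the threshold s/d is at most 2^a y. Primes below the threshold give
  -- only nondeficient m p, costing their mass over a dyadic blocks; beyond it the level 0 condition
  -- holds and `T-bound` takes over.
  R-bound : ∀ n ℓ → N < y + n → ∀ a → Smooth m s y → s < 2 * m → s ≤ 2 ^ ℓ → 64 ≤ y → s ≤ (2 * m ∸ s) * (y * 2 ^ a) →
            Bd (κ * D * m) m y (U y ℓ + μ * D * a)

  R-bound {y} {m} {s} n ℓ N< a sm def s≤ 64≤y room with s ≤? y * (2 * m ∸ s)
  ... | yes small = bd-mono (m≤m+n (U y ℓ) (μ * D * a)) (bd-cast (cong (_* m) (*-identityʳ (κ * D))) refl (T-bound n ℓ N< 0 sm s≤ 64≤y cond))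
    where
    cond : s * suc y ≤ 2 * m * y
    cond = ≤-trans (≤-reflexive (*-suc s y)) (≤-trans (+-monoˡ-≤ (s * y) small)
      (≤-reflexive (trans (cong (_+ s * y) (*-comm y (2 * m ∸ s))) (trans (sym (*-distribʳ-+ y (2 * m ∸ s) s)) (cong (_* y) (m∸n+n≡m (<⇒≤ def)))))))
  ... | no large with first-exceeding a (m<n⇒0<n∸m def) (≰⇒> large) room | block-mass {y} a 64≤y
  ...   | h , y≤h , hd≤s , s≤dh , h≤ | z , _ , z> , y≤z , mass≤ = bd-cancel D 0<D (bd-mono total
            (cell (κ * D) (λ _ → κ * D) (suc h ∸ y) (≤-trans (s≤s (s≤s (s≤s z≤n))) 64≤y) (Smooth.pos sm) crossing
              (subst (λ w → Bd (κ * D * m) m w (U y ℓ)) (sym (m+[n∸m]≡n (≤-trans y≤h (n≤1+n h))))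
                (bd-mono (U-later {ℓ = ℓ} 0<y (≤-trans y≤h (n≤1+n h)))
                  (bd-cast (cong (_* m) (*-identityʳ (κ * D))) refl (T-bound n ℓ (<-≤-trans N< (+-monoˡ-≤ n (≤-trans y≤h (n≤1+n h)))) 0 (smooth-later (≤-trans y≤h (n≤1+n h)) sm) s≤ (≤-trans 64≤y (≤-trans y≤h (n≤1+n h))) cond))))))
    where
    open ≤-Reasoning
    d₀ = 2 * m ∸ s
    0<y = ≤-trans (s≤s z≤n) 64≤y
    d+s : d₀ + s ≡ 2 * m
    d+s = m∸n+n≡m (<⇒≤ def)
    cond : s * suc (suc h) ≤ 2 * m * suc h
    cond = begin
      s * suc (suc h)          ≡⟨ *-suc s (suc h) ⟩
      s + s * suc h            ≤⟨ +-monoˡ-≤ (s * suc h) s≤dh ⟩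
      d₀ * suc h + s * suc h    ≡⟨ *-distribʳ-+ (suc h) d₀ s ⟨
      (d₀ + s) * suc h          ≡⟨ cong (_* suc h) d+s ⟩
      2 * m * suc h            ∎
    0<a : 0 < a
    0<a = positive a room
      where
      positive : ∀ a → s ≤ d₀ * (y * 2 ^ a) → 0 < a
      positive (suc _) _ = z<s
      positive zero room₀ = ⊥-elim (<⇒≱ (≰⇒> large) (≤-trans room₀ (≤-reflexive (trans (cong (d₀ *_) (*-identityʳ y)) (*-comm d₀ y)))))
    suc-h≤z : suc h ≤ z
    suc-h≤z = ≤-trans (s≤s h≤) (z> 0<a)
    -- Here p ≤ h makes m p nondeficient, so m p^e is the only number in this branch that could be a
    -- pnd.
    crossing : ∀ p e → Prime p → y ≤ p → p < y + (suc h ∸ y) → p ≤ N → 0 < e → Bd (κ * D * (m * p ^ e)) (m * p ^ e) (suc p) (e * (κ * D))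
    crossing p (suc e) pp y≤p p< _ _ = bd-mono (m≤n*m (κ * D) (suc e)) (bd-nondeficient nd)
      where
      p≤h : p ≤ h
      p≤h = s≤s⁻¹ (subst (p <_) (m+[n∸m]≡n (≤-trans y≤h (n≤1+n h))) p<)
      mp : 2 * (m * p) ≤ σ (m * p)
      mp = begin
        2 * (m * p)              ≡⟨ *-assoc 2 m p ⟨
        2 * m * p                ≡⟨ cong (_* p) d+s ⟨
        (d₀ + s) * p              ≡⟨ *-distribʳ-+ p d₀ s ⟩
        d₀ * p + s * p            ≤⟨ +-monoˡ-≤ (s * p) (≤-trans (≤-reflexive (*-comm d₀ p)) (≤-trans (*-monoˡ-≤ d₀ p≤h) hd≤s)) ⟩
        s + s * p                ≡⟨ lem s p ⟩
        s * sp p 1               ≡⟨ σ-pow sm pp y≤p 1 ⟨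
        σ (m * p ^ 1)            ≡⟨ cong (λ w → σ (m * w)) (*-identityʳ p) ⟩
        σ (m * p)                ∎
        where
        abstract
          lem : ∀ s p → s + s * p ≡ s * (1 * p + 1)
          lem = solve-∀
      0<V = *-pos (Smooth.pos sm) (pow-pos pp (suc e))
      nd : 2 * (m * p ^ suc e) ≤ σ (m * p ^ suc e)
      nd = nondeficient-multiple 0<V (divides (p ^ e) (lem m p (p ^ e))) mp
        where
        abstract
          lem : ∀ m p t → m * (p * t) ≡ t * (m * p)
          lem = solve-∀
    total : D * U y ℓ + Σw (λ _ → κ * D) y (suc h ∸ y) ≤ D * (U y ℓ + μ * D * a)
    total = begin
      D * U y ℓ + Σw (λ _ → κ * D) y (suc h ∸ y)
        ≡⟨ cong (D * U y ℓ +_) (Σw-const (κ * D) y (suc h ∸ y)) ⟩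
      D * U y ℓ + κ * D * mass y (suc h ∸ y)
        ≤⟨ +-monoʳ-≤ (D * U y ℓ) (*-monoʳ-≤ (κ * D) (mass-mono y (∸-monoˡ-≤ y suc-h≤z))) ⟩
      D * U y ℓ + κ * D * mass y (z ∸ y)
        ≡⟨ cong (D * U y ℓ +_) (lem κ D (mass y (z ∸ y))) ⟩
      D * U y ℓ + D * (κ * mass y (z ∸ y))
        ≤⟨ +-monoʳ-≤ (D * U y ℓ) (*-monoʳ-≤ D mass≤) ⟩
      D * U y ℓ + D * (μ * D * a)
        ≡⟨ *-distribˡ-+ D (U y ℓ) _ ⟨
      D * (U y ℓ + μ * D * a) ∎
      where
      abstract
        lem : ∀ κ D V → κ * D * V ≡ D * (κ * V)
        lem = solve-∀

  T-bound {y} {m} {s} zero ℓ N< i sm s≤ 64≤y cond =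
    bd-deficient (subst (_< 2 * m) (sym (Smooth.sig sm)) (cond-deficient {m} {s} {y} i (Smooth.pos sm) cond)) (subst (N <_) (+-identityʳ y) N<)
  T-bound {y} {m} {s} (suc n) ℓ N< i sm s≤ 64≤y cond with N <? y
  ... | yes N<y = bd-deficient (subst (_< 2 * m) (sym (Smooth.sig sm)) (cond-deficient {m} {s} {y} i (Smooth.pos sm) cond)) N<y
  ... | no N≮y with log-room y 64≤y
  ...   | g , 2y≤ , 8g≤y , 8≤g = by-level i cond
    where
    open ≤-Reasoning
    y≤N = ≮⇒≥ N≮y
    0<y = ≤-trans (s≤s z≤n) 64≤y
    3≤y : 3 ≤ y
    3≤y = ≤-trans (s≤s (s≤s (s≤s z≤n))) 64≤y
    N<z : N < y + suc y + n
    N<z = <-≤-trans N< (≤-trans (≤-reflexive (+-suc y n)) (+-monoˡ-≤ n (m<m+n y z<s)))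
    N<p : ∀ {p} → y ≤ p → N < suc p + n
    N<p y≤p = <-≤-trans N< (≤-trans (≤-reflexive (+-suc y n)) (s≤s (+-monoˡ-≤ n y≤p)))
    64≤z : 64 ≤ y + suc y
    64≤z = ≤-trans 64≤y (m≤m+n y (suc y))
    p<2^g : ∀ {p} → p < y + suc y → p < 2 ^ g
    p<2^g {p} p< = <-≤-trans p< (≤-trans (≤-trans (n≤1+n _) (≤-reflexive (lem y))) 2y≤)
      where
      abstract
        lem : ∀ y → suc (y + suc y) ≡ suc y * 2
        lem = solve-∀
    X = ℓ * u y
    Y = ℓ * u (y + suc y)
    Z = g * u y
    2Y≤X : 2 * Y ≤ X
    2Y≤X = ≤-trans (≤-reflexive (lem ℓ (u (y + suc y)))) (*-monoʳ-≤ ℓ (2u≤u 0<y y≤N))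
      where
      abstract
        lem : ∀ l a → 2 * (l * a) ≡ l * (2 * a)
        lem = solve-∀
    8Z≤D : 8 * Z ≤ D
    8Z≤D = gu≤D {g = g} 0<y y≤N 8g≤y
    U′ = U y (ℓ + g)
    by-level : ∀ i → Cond i m s y → Bd (κ * D * 4 ^ i * m) m y (U y ℓ)
    by-level (suc i) cond = bd-cancel (4 * D) (*-pos {4} z<s 0<D) (bd-mono total (bd-cast (lem₁ D (κ * D) (4 ^ suc i) m) refl
      (cell (κ * D * 4 ^ suc (suc i)) (λ _ → 16 * U′) (suc y) 3≤y (Smooth.pos sm) picks
        (T-bound n ℓ N<z (suc (suc i)) (smooth-later (m≤m+n y (suc y)) sm) s≤ 64≤z (cond-double {m} {y} {s} (suc i) (Smooth.pos sm) 64≤y cond)))))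
      where
      abstract
        lem₁ : ∀ D c t m → D * (c * (4 * t) * m) ≡ 4 * D * (c * t * m)
        lem₁ = solve-∀
      picks : ∀ p e → Prime p → y ≤ p → p < y + suc y → p ≤ N → 0 < e →
              Bd (κ * D * 4 ^ suc (suc i) * (m * p ^ e)) (m * p ^ e) (suc p) (e * (16 * U′))
      picks p e pp y≤p p< p≤N 0<e = bd-cast (lem₂ (κ * D) (4 ^ i) (m * p ^ e)) (lem₃ e U′) (bd-scale 16 (bd-mono (U-child {ℓ = ℓ} {g = g} 0<y (≤-trans y≤p (n≤1+n p)) 0<e)
        (T-bound n (ℓ + e * g) (N<p y≤p) i (smooth-pow sm pp y≤p e) (pow-log {ℓ = ℓ} g e (p<2^g p<) s≤) (≤-trans 64≤y (≤-trans y≤p (n≤1+n p))) (cond-child {m} {y} {p} {s} i {e} (Smooth.pos sm) 64≤y y≤p cond))))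
        where
        abstract
          lem₂ : ∀ c t V → 16 * (c * t * V) ≡ c * (4 * (4 * t)) * V
          lem₂ = solve-∀
          lem₃ : ∀ e U → 16 * (e * U) ≡ e * (16 * U)
          lem₃ = solve-∀
      total : D * U (y + suc y) ℓ + Σw (λ _ → 16 * U′) y (suc y) ≤ 4 * D * U y ℓ
      total = *-cancelˡ-≤ κ {{>-nonZero 0<κ}} (begin
        κ * (D * Uz + Σw (λ _ → 16 * U′) y (suc y))  ≡⟨ cong (λ w → κ * (D * Uz + w)) (Σw-const (16 * U′) y (suc y)) ⟩
        κ * (D * Uz + 16 * U′ * V)                   ≡⟨ lem₂ κ D Uz U′ V ⟩
        κ * D * Uz + 16 * U′ * (κ * V)               ≤⟨ +-monoʳ-≤ (κ * D * Uz) (*-monoʳ-≤ (16 * U′) (mass-bound y 64≤y)) ⟩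
        κ * D * Uz + 16 * U′ * (μ * D)               ≡⟨ lem₃ κ D Uz U′ μ ⟩
        D * (κ * Uz + 16 * μ * U′)                   ≤⟨ *-monoʳ-≤ D (≤-trans (≤-reflexive (cong (λ w → κ * Uz + 16 * μ * (α * D + 2 * β * w)) (*-distribʳ-+ (u y) ℓ g)))
                                                          (linear₁ κ α β μ {D} {X} {Y} {Z} cond₁ cond₁′ 2Y≤X 8Z≤D)) ⟩
        D * (4 * κ * U y ℓ)                          ≡⟨ lem₄ κ D (U y ℓ) ⟩
        κ * (4 * D * U y ℓ)                          ∎)
        where
        Uz = U (y + suc y) ℓ
        V = mass y (suc y)
        abstract
          lem₂ : ∀ κ D Uz U V → κ * (D * Uz + 16 * U * V) ≡ κ * D * Uz + 16 * U * (κ * V)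
          lem₂ = solve-∀
          lem₃ : ∀ κ D Uz U μ → κ * D * Uz + 16 * U * (μ * D) ≡ D * (κ * Uz + 16 * μ * U)
          lem₃ = solve-∀
          lem₄ : ∀ κ D U → D * (4 * κ * U) ≡ κ * (4 * D * U)
          lem₄ = solve-∀
    by-level zero cond = bd-cancel (4 * D) (*-pos {4} z<s 0<D) (bd-mono total (bd-cast (lem₁ D (κ * D) m) refl
      (cell (κ * D * 4) (λ p → 4 * U′ + 4 * (μ * D) * B p) (suc y) 3≤y (Smooth.pos sm)
        (λ p e pp y≤p p< _ 0<e → bd-cast (lem₂ (κ * D) (m * p ^ e)) (lem₃ e U′ (μ * D) (B p)) (bd-scale 4 (pick p e pp y≤p p< 0<e)))
        (T-bound n ℓ N<z 1 (smooth-later (m≤m+n y (suc y)) sm) s≤ 64≤z (cond-double {m} {y} {s} 0 (Smooth.pos sm) 64≤y cond)))))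
      where
      B : ℕ → ℕ
      B = blocks y (ℓ + g)
      abstract
        lem₁ : ∀ D c m → D * (c * 4 * m) ≡ 4 * D * (c * 1 * m)
        lem₁ = solve-∀
        lem₂ : ∀ c V → 4 * (c * V) ≡ c * 4 * V
        lem₂ = solve-∀
        lem₃ : ∀ e U c b → 4 * (e * (U + c * b)) ≡ e * (4 * U + 4 * c * b)
        lem₃ = solve-∀
      pick : ∀ p e → Prime p → y ≤ p → p < y + suc y → 0 < e → Bd (κ * D * (m * p ^ e)) (m * p ^ e) (suc p) (e * (U′ + μ * D * B p))
      pick p e pp y≤p p< 0<e with p ≤? suc y
      -- For p ≤ y + 1 the level condition leaves no surplus. If m p^e is still deficient, its
      -- deficiency is at least 1, so its threshold is at most its divisor sum and `h` blocks
      -- suffice.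
      ... | yes near = nearby (s * sp p e <? 2 * (m * p ^ e))
        where
        h = ℓ + e * g
        s′≤ : s * sp p e ≤ 2 ^ h
        s′≤ = pow-log {ℓ = ℓ} g e (p<2^g p<) s≤
        nearby : Dec (s * sp p e < 2 * (m * p ^ e)) → Bd (κ * D * (m * p ^ e)) (m * p ^ e) (suc p) (e * (U′ + μ * D * (ℓ + g)))
        nearby (no nd) = bd-mono (begin
          κ * D                            ≤⟨ *-monoˡ-≤ D κ≤8μ ⟩
          μ * 8 * D                        ≡⟨ trans (*-assoc μ 8 D) (trans (cong (μ *_) (*-comm 8 D)) (sym (*-assoc μ D 8))) ⟩
          μ * D * 8                        ≤⟨ *-monoʳ-≤ (μ * D) (≤-trans 8≤g (m≤n+m g ℓ)) ⟩
          μ * D * (ℓ + g)                  ≤⟨ m≤n+m _ U′ ⟩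
          U′ + μ * D * (ℓ + g)             ≤⟨ m≤n*m _ e {{>-nonZero 0<e}} ⟩
          e * (U′ + μ * D * (ℓ + g))       ∎)
          (bd-nondeficient (≤-trans (≮⇒≥ nd) (≤-reflexive (sym (σ-pow sm pp y≤p e)))))
        nearby (yes def) = bd-mono (begin
          U (suc p) h + μ * D * (ℓ + e * g)             ≤⟨ +-mono-≤ (U-child {ℓ = ℓ} {g = g} 0<y (≤-trans y≤p (n≤1+n p)) 0<e) (*-monoʳ-≤ (μ * D) (+-monoˡ-≤ (e * g) (m≤n*m ℓ e {{>-nonZero 0<e}}))) ⟩
          e * U′ + μ * D * (e * ℓ + e * g)              ≡⟨ lem₄ e U′ (μ * D) ℓ g ⟩
          e * (U′ + μ * D * (ℓ + g))                    ∎)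
          (R-bound n (ℓ + e * g) (N<p y≤p) h (smooth-pow sm pp y≤p e) def s′≤ (≤-trans 64≤y (≤-trans y≤p (n≤1+n p)))
            (≤-trans s′≤ (≤-trans (m≤n*m (2 ^ h) (suc p)) (m≤n*m _ (2 * (m * p ^ e) ∸ s * sp p e) {{>-nonZero (m<n⇒0<n∸m def)}}))))
          where
          abstract
            lem₄ : ∀ e U c ℓ g → e * U + c * (e * ℓ + e * g) ≡ e * (U + c * (ℓ + g))
            lem₄ = solve-∀
      ... | no far = distant (p ∸ suc y) (m+[n∸m]≡n (<⇒≤ (≰⇒> far))) (m<n⇒0<n∸m (≰⇒> far))
        where
        s′ = s * sp p e
        V = m * p ^ e
        distant : ∀ j → suc y + j ≡ p → 0 < j → Bd (κ * D * V) V (suc p) (e * (U′ + μ * D * halvings y y j))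
        distant j refl 0<j = bd-mono (begin
          U (suc p) (ℓ + e * g) + μ * D * a       ≤⟨ +-mono-≤ (U-child {ℓ = ℓ} {g = g} 0<y (≤-trans y≤p (n≤1+n p)) 0<e) (m≤n*m _ e {{>-nonZero 0<e}}) ⟩
          e * U′ + e * (μ * D * a)                ≡⟨ *-distribˡ-+ e U′ _ ⟨
          e * (U′ + μ * D * a)                    ∎)
          (R-bound n (ℓ + e * g) (N<p y≤p) a (smooth-pow sm pp y≤p e) def (pow-log {ℓ = ℓ} g e (p<2^g p<) s≤) (≤-trans 64≤y (≤-trans y≤p (n≤1+n p))) room)
          where
          a = halvings y y j
          key : s′ * (j + p * y) ≤ 2 * V * (p * y)
          key = child-bound-near {s = s} {m = m} {t = sp p e} {X = p ^ e} y j 0<y (sp-geometric (y + j) e) cond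
          def : s′ < 2 * V
          def = deficient-from {c = j} {x = p * y} (*-pos (Smooth.pos sm) (pow-pos pp e)) 0<j key
          d₀ = 2 * V ∸ s′
          key′ : s′ * j ≤ d₀ * (p * y)
          key′ = +-cancelʳ-≤ (s′ * (p * y)) _ _ (≤-trans (≤-reflexive (sym (*-distribˡ-+ s′ j (p * y)))) (≤-trans key
            (≤-reflexive (trans (cong (_* (p * y)) (sym (m∸n+n≡m (<⇒≤ def)))) (*-distribʳ-+ (p * y) d₀ s′)))))
          -- `key′` bounds the threshold s′/d₀ by p y/j, and y/j ≤ 2^a by the choice of `a` as a
          -- number of halvings.
          room : s′ ≤ d₀ * (suc p * 2 ^ a)
          room = *-cancelʳ-≤ _ _ y {{>-nonZero 0<y}} (begin
            s′ * y                         ≤⟨ *-monoʳ-≤ s′ (halvings-suffice y y j (n≤1+n y) 0<j) ⟩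
            s′ * (j * 2 ^ a)               ≡⟨ *-assoc s′ j (2 ^ a) ⟨
            s′ * j * 2 ^ a                 ≤⟨ *-monoˡ-≤ (2 ^ a) key′ ⟩
            d₀ * (p * y) * 2 ^ a           ≡⟨ lem₄ d₀ p y (2 ^ a) ⟩
            d₀ * (p * 2 ^ a) * y           ≤⟨ *-monoˡ-≤ y (*-monoʳ-≤ d₀ (*-monoˡ-≤ (2 ^ a) (n≤1+n p))) ⟩
            d₀ * (suc p * 2 ^ a) * y       ∎)
            where
            abstract
              lem₄ : ∀ d p y t → d * (p * y) * t ≡ d * (p * t) * y
              lem₄ = solve-∀
      total : D * U (y + suc y) ℓ + Σw (λ p → 4 * U′ + 4 * (μ * D) * B p) y (suc y) ≤ 4 * D * U y ℓ
      total = *-cancelˡ-≤ (31 * κ) {{>-nonZero (*-pos {31} z<s 0<κ)}} (begin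
        31 * κ * (D * Uz + Σw (λ p → 4 * U′ + 4 * (μ * D) * B p) y (suc y))
          ≡⟨ cong (λ w → 31 * κ * (D * Uz + w)) (Σw-linear (4 * U′) (4 * (μ * D)) B y (suc y)) ⟩
        31 * κ * (D * Uz + (4 * U′ * V + 4 * (μ * D) * S))
          ≡⟨ lem₅ κ D Uz U′ V μ S ⟩
        31 * κ * D * Uz + (124 * U′ * (κ * V) + 4 * μ * κ * D * (31 * S))
          ≤⟨ +-monoʳ-≤ (31 * κ * D * Uz) (+-mono-≤ (*-monoʳ-≤ (124 * U′) (mass-bound y 64≤y)) (*-monoʳ-≤ (4 * μ * κ * D) (blocks-total (ℓ + g) 64≤y y≤N))) ⟩
        31 * κ * D * Uz + (124 * U′ * (μ * D) + 4 * μ * κ * D * (32 * ((ℓ + g) * u y) + 31 * D))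
          ≡⟨ lem₆ κ D Uz U′ μ (32 * ((ℓ + g) * u y) + 31 * D) ⟩
        D * (31 * κ * Uz + 124 * μ * U′ + 4 * μ * κ * (32 * ((ℓ + g) * u y) + 31 * D))
          ≤⟨ *-monoʳ-≤ D (≤-trans (≤-reflexive (cong (λ w → 31 * κ * Uz + 124 * μ * (α * D + 2 * β * w) + 4 * μ * κ * (32 * w + 31 * D)) (*-distribʳ-+ (u y) ℓ g)))
               (linear₀ κ α β μ {D} {X} {Y} {Z} cond₀ cond₀′ 2Y≤X 8Z≤D)) ⟩
        D * (124 * κ * U y ℓ)
          ≡⟨ lem₇ κ D (U y ℓ) ⟩
        31 * κ * (4 * D * U y ℓ) ∎)
        where
        Uz = U (y + suc y) ℓ
        V = mass y (suc y)
        S = Σw B y (suc y)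
        abstract
          lem₅ : ∀ κ D Uz U V μ S → 31 * κ * (D * Uz + (4 * U * V + 4 * (μ * D) * S)) ≡ 31 * κ * D * Uz + (124 * U * (κ * V) + 4 * μ * κ * D * (31 * S))
          lem₅ = solve-∀
          lem₆ : ∀ κ D Uz U μ W → 31 * κ * D * Uz + (124 * U * (μ * D) + 4 * μ * κ * D * W) ≡ D * (31 * κ * Uz + 124 * μ * U + 4 * μ * κ * W)
          lem₆ = solve-∀
          lem₇ : ∀ κ D U → D * (124 * κ * U) ≡ 31 * κ * (4 * D * U)
          lem₇ = solve-∀

-- @@Table

private variable
  B : ℕ

-- Trial division by d, d + 2, and so on up to the square root. Both answers are certified below,
-- because a complete table has neither a composite nor a gap.
noDiv : ℕ → ℕ → ℕ → Bool
noDiv′ : Bool → ℕ → ℕ → ℕ → Bool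
noDiv″ : ℕ → ℕ → ℕ → ℕ → Bool
noDiv zero n d = true
noDiv (suc f) n d = noDiv′ (n <ᵇ d * d) f n d
noDiv′ true f n d = true
noDiv′ false f n zero = true
noDiv′ false f n (suc d) = noDiv″ (n % suc d) f n (suc d)
noDiv″ zero f n d = false
noDiv″ (suc _) f n d = noDiv f n (2 + d)

rough-step : 1 < d → 2 ∣ suc d → ¬ 2 ∣ n → ¬ d ∣ n → d Rough n → (2 + d) Rough n
rough-step {d} 1<d 2∣d+1 2∤n d∤n rough = ∤⇒rough-suc (λ h → 2∤n (∣-trans 2∣d+1 h)) (∤⇒rough-suc d∤n rough)

noDiv-sound : ∀ f {n d} → 1 < n → 1 < d → 2 ∣ suc d → ¬ 2 ∣ n → n < d + f + f → d Rough n → noDiv f n d ≡ true → Prime n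
noDiv-sound zero {n} {d} 1<n 1<d _ _ n<d rough _ = rough∧square>⇒prime {{n>1⇒nonTrivial 1<n}} rough
  (<-≤-trans n<d (≤-trans (≤-reflexive (trans (+-identityʳ (d + 0)) (+-identityʳ d))) (m≤m*n d d {{>-nonZero (<-trans z<s 1<d)}})))
noDiv-sound (suc f) {n} {d@(suc d′)} 1<n 1<d even 2∤n n< rough eq with n <ᵇ d * d in small
... | true = rough∧square>⇒prime {{n>1⇒nonTrivial 1<n}} rough (<ᵇ⇒< n (d * d) (subst T (sym small) tt))
... | false with n % d in rem
...   | suc r = noDiv-sound f 1<n (<-trans 1<d (s≤s (n≤1+n d))) (∣m∣n⇒∣m+n (divides 1 refl) even) 2∤n
        (<-≤-trans n< (≤-reflexive (lem d f))) (rough-step 1<d even 2∤n (λ d∣n → 0≢1+n (trans (sym (n∣m⇒m%n≡0 n d d∣n)) rem)) rough) eq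
  where
  abstract
    lem : ∀ d f → d + suc f + suc f ≡ 2 + d + f + f
    lem = solve-∀

noDiv-complete : ∀ f {n d} → 1 < n → 1 < d → noDiv f n d ≡ false → ¬ Prime n
noDiv-complete (suc f) {n} {suc d} 1<n 1<d eq with n <ᵇ suc d * suc d in small
... | false with n % suc d in rem
...   | suc _ = noDiv-complete f 1<n (<-trans 1<d (s≤s (n≤1+n (suc d)))) eq
...   | zero = λ pr → [ (λ d≡1 → <⇒≢ 1<d (sym d≡1)) , (λ d≡n → <⇒≢ d<n d≡n) ]′ (prime⇒irreducible pr (m%n≡0⇒n∣m n (suc d) rem))
  where
  d<n : suc d < n
  d<n = <-≤-trans (m<m*n (suc d) (suc d) 1<d) (≮⇒≥ λ lt → subst T small (<⇒<ᵇ lt))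

-- The list contains precisely the primes from the first index up to (excluding) the last.
data Table : ℕ → List ℕ → ℕ → Set where
  done : Table y [] y
  skip : ¬ Prime y → Table (suc y) qs B → Table y qs B
  take : Prime y → Table (suc y) qs B → Table y (y ∷ qs) B

table-tail : Table y (q ∷ qs) B → Table (suc q) qs B
table-tail (skip _ table) = table-tail table
table-tail (take _ table) = table

table-head : Table y (q ∷ qs) B → Prime q × y ≤ q
table-head (skip _ table) = proj₁ (table-head table) , ≤-trans (n≤1+n _) (proj₂ (table-head table))
table-head (take pr _) = pr , ≤-refl

table-raise : Table y (q ∷ qs) B → Table q (q ∷ qs) B
table-raise (skip _ table) = table-raise table
table-raise (take pr table) = take pr table

primesFrom : ℕ → ℕ → List ℕ
primesFrom₁ : Bool → ℕ → ℕ → List ℕ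
primesFrom zero n = []
primesFrom (suc f) n = primesFrom₁ (noDiv n n 3) f n
primesFrom₁ true f n = n ∷ primesFrom f (2 + n)
primesFrom₁ false f n = primesFrom f (2 + n)

primeList : ℕ → List ℕ
primeList f = 2 ∷ primesFrom f 3

primesFrom-table : ∀ f n → 2 < n → 2 ∣ suc n → Table n (primesFrom f n) (f + f + n)
primesFrom-table zero n 2<n even = done
primesFrom-table (suc f) n 2<n even with noDiv n n 3 in eq
... | true = take (noDiv-sound n (<-trans (s≤s (s≤s z≤n)) 2<n) (s≤s (s≤s z≤n)) (divides 2 refl) 2∤n (s≤s (m≤n+m n (2 + n))) rough eq) (after f n 2<n even)
  where
  2∤n : ¬ 2 ∣ n
  2∤n 2∣n with ∣1⇒≡1 (∣m+n∣m⇒∣n {2} {n} {1} (subst (2 ∣_) (+-comm 1 n) even) 2∣n)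
  ... | ()
  rough : 3 Rough n
  rough = ∤⇒rough-suc 2∤n 2-rough
  after : ∀ f n → 2 < n → 2 ∣ suc n → Table (suc n) (primesFrom f (2 + n)) (suc f + suc f + n)
  after f n 2<n even = skip (even⇒¬prime (≤-trans 2<n (n≤1+n n)) even)
    (subst (Table (2 + n) (primesFrom f (2 + n))) (lem′ f n) (primesFrom-table f (2 + n) (≤-trans 2<n (≤-trans (n≤1+n n) (n≤1+n (suc n)))) (∣m∣n⇒∣m+n (divides 1 refl) even)))
    where
    abstract
      lem′ : ∀ f n → f + f + (2 + n) ≡ suc f + suc f + n
      lem′ = solve-∀
... | false = skip (noDiv-complete n (<-trans (s≤s (s≤s z≤n)) 2<n) (s≤s (s≤s z≤n)) eq)
    (skip (even⇒¬prime (≤-trans 2<n (n≤1+n n)) even)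
      (subst (Table (2 + n) (primesFrom f (2 + n))) (lem′ f n) (primesFrom-table f (2 + n) (≤-trans 2<n (≤-trans (n≤1+n n) (n≤1+n (suc n)))) (∣m∣n⇒∣m+n (divides 1 refl) even))))
  where
  abstract
    lem′ : ∀ f n → f + f + (2 + n) ≡ suc f + suc f + n
    lem′ = solve-∀

primeList-table : ∀ f → Table 2 (primeList f) (f + f + 3)
primeList-table f = take prime[2] (primesFrom-table f 3 (s≤s (s≤s (s≤s z≤n))) (divides 2 refl))

-- @@Mass

ceilDiv : ℕ → ℕ → ℕ
ceilDiv a b = suc (div a b)

≤ceilDiv : ∀ a → 0 < d → a ≤ ceilDiv a d * d
≤ceilDiv {d} a 0<d = <⇒≤ (div<⇒<* {a} {d} {suc (div a d)} 0<d ≤-refl)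

window : ℕ → ℕ → List ℕ → ℕ
window₁ : Bool → ℕ → ℕ → ℕ → List ℕ → ℕ
window W lim [] = 0
window W lim (q ∷ qs) = window₁ (lim <ᵇ q) W lim q qs
window₁ true W lim q qs = 0
window₁ false W lim q qs = ceilDiv W (q ∸ 2) + window W lim qs

-- Checking windows that start at primes is enough: if p is the first prime from y on, the primes of
-- [y, 2y] lie in [p, 2p]. The check includes the first prime after `last`, so every y from 64 to
-- `last` is covered.
windowsOK : ℕ → ℕ → ℕ → ℕ → List ℕ → Bool
windowsOK₁ : Bool → ℕ → ℕ → ℕ → ℕ → ℕ → List ℕ → Bool
windowsOK κ μ W last [] = false
windowsOK κ μ W last (p ∷ qs) = windowsOK₁ (p <ᵇ 64) κ μ W last p qs
windowsOK₁ true κ μ W last p qs = windowsOK κ μ W last qs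
windowsOK₁ false κ μ W last p qs = (κ * window W (p + p) (p ∷ qs) ≤ᵇ μ * W) ∧ (if last <ᵇ p then true else windowsOK κ μ W last qs)

-- Beyond the table, primes are replaced by residues prime to 2 · 3 · 5 · 7. Their density is
-- 48/210, and (48/210) ln 2 is about 0.158, below 0.165.
coprime210 : ℕ → ℕ
coprime210 r = if ((r % 2 ≡ᵇ 0) ∨ (r % 3 ≡ᵇ 0)) ∨ ((r % 5 ≡ᵇ 0) ∨ (r % 7 ≡ᵇ 0)) then 0 else 1

count210 : ℕ → ℕ → ℕ
count210 r zero = 0
count210 r (suc k) = coprime210 r + count210 (suc r) k

blockSum : ℕ → ℕ → ℕ → ℕ
blockSum D a zero = 0
blockSum D a (suc k) = div D (210 * a ∸ 1) + blockSum D (suc a) k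

blockCeil : ℕ → ℕ → ℕ → ℕ
blockCeil W a zero = 0
blockCeil W a (suc k) = ceilDiv W (210 * a ∸ 1) + blockCeil W (suc a) k

div*≤ceil : ∀ W D d → 0 < d → W * div D d ≤ ceilDiv W d * D
div*≤ceil W D d 0<d = begin
  W * div D d                     ≤⟨ *-monoˡ-≤ (div D d) (≤ceilDiv W 0<d) ⟩
  ceilDiv W d * d * div D d       ≡⟨ *-assoc (ceilDiv W d) d (div D d) ⟩
  ceilDiv W d * (d * div D d)     ≤⟨ *-monoʳ-≤ (ceilDiv W d) (≤-trans (≤-reflexive (*-comm d (div D d))) (div*≤ D d)) ⟩
  ceilDiv W d * D                 ∎
  where open ≤-Reasoning

2div≤ : ∀ D → 0 < z → 2 * z ≤ x → 2 * div D x ≤ div D z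
2div≤ {z} {x} D 0<z 2z≤x = *≤⇒≤div 0<z (begin
  2 * div D x * z      ≡⟨ trans (*-assoc 2 (div D x) z) (trans (cong (2 *_) (*-comm (div D x) z)) (trans (sym (*-assoc 2 z (div D x))) (*-comm (2 * z) (div D x)))) ⟩
  div D x * (2 * z)    ≤⟨ *-monoʳ-≤ (div D x) 2z≤x ⟩
  div D x * x          ≤⟨ div*≤ D x ⟩
  D                    ∎)
  where
  open ≤-Reasoning
  *≤⇒≤div : ∀ {c D z} → 0 < z → c * z ≤ D → c ≤ div D z
  *≤⇒≤div {c} {D} {suc z} _ h = s≤s⁻¹ (*-cancelʳ-< (suc z) c (suc (div D (suc z))) (≤-<-trans h (div<⇒<* {D} {suc z} z<s ≤-refl)))

module MassBound (N D : ℕ) (D-exact : ∀ k → 0 < k → k ≤ N → k * div D k ≡ D) (κ μ W : ℕ) (0<W : 0 < W) where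

  open Cell N D D-exact

  table-window : ∀ k lim → 2 < y → Table y qs B → y + k ≤ suc lim → y + k ≤ B → W * mass y k ≤ window W lim qs * D
  table-window zero lim 2<y tab y≤ y≤B = ≤-trans (≤-reflexive (*-zeroʳ W)) z≤n
  table-window {y} (suc k) lim 2<y done y≤ y≤B = ⊥-elim (<⇒≱ (m<m+n y z<s) y≤B)
  table-window {y} {qs} {B} (suc k) lim 2<y (skip ¬pr tab) y≤ y≤B = ≤-trans (≤-reflexive (cong (λ w → W * (1 * w + mass (suc y) k)) (weight-¬prime ¬pr)))
    (table-window k lim (≤-trans 2<y (n≤1+n y)) tab (subst (_≤ suc lim) (+-suc y k) y≤) (subst (_≤ B) (+-suc y k) y≤B))
  table-window {y} {B = B} (suc k) lim 2<y (take {qs = qs} pr tab) y≤ y≤B with lim <ᵇ y in eq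
  ... | true = ⊥-elim (<⇒≱ (m<m+n y (z<s {k})) (≤-trans y≤ (<ᵇ⇒< lim y (subst T (sym eq) tt))))
  ... | false = begin
    W * (1 * weight y + mass (suc y) k)                                   ≡⟨ cong (λ w → W * (w + mass (suc y) k)) (*-identityˡ (weight y)) ⟩
    W * (weight y + mass (suc y) k)                                       ≡⟨ *-distribˡ-+ W (weight y) _ ⟩
    W * weight y + W * mass (suc y) k                                     ≤⟨ +-mono-≤ (≤-trans (*-monoʳ-≤ W (weight≤ y)) (div*≤ceil W D (y ∸ 2) (m<n⇒0<n∸m 2<y)))
                                                                               (table-window k lim (≤-trans 2<y (n≤1+n y)) tab (subst (_≤ suc lim) (+-suc y k) y≤) (subst (_≤ B) (+-suc y k) y≤B)) ⟩
    ceilDiv W (y ∸ 2) * D + window W lim qs * D                           ≡⟨ *-distribʳ-+ D (ceilDiv W (y ∸ 2)) _ ⟨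
    (ceilDiv W (y ∸ 2) + window W lim qs) * D                             ∎
    where open ≤-Reasoning

  from-window : ∀ {w M} → W * M ≤ w * D → κ * w ≤ μ * W → κ * M ≤ μ * D
  from-window {w} {M} h h′ = *-cancelˡ-≤ W {{>-nonZero 0<W}} (begin
    W * (κ * M)    ≡⟨ lem₁ W κ M ⟩
    κ * (W * M)    ≤⟨ *-monoʳ-≤ κ h ⟩
    κ * (w * D)    ≡⟨ *-assoc κ w D ⟨
    κ * w * D      ≤⟨ *-monoˡ-≤ D h′ ⟩
    μ * W * D      ≡⟨ lem₂ W μ D ⟩
    W * (μ * D)    ∎)
    where
    open ≤-Reasoning
    abstract
      lem₁ : ∀ W κ M → W * (κ * M) ≡ κ * (W * M)
      lem₁ = solve-∀
      lem₂ : ∀ W μ D → μ * W * D ≡ W * (μ * D)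
      lem₂ = solve-∀

  head-≥ : Table y (p ∷ qs) B → y ≤ p
  head-≥ (skip _ tab) = ≤-trans (n≤1+n _) (head-≥ tab)
  head-≥ (take _ _) = ≤-refl

  small-mass : ∀ {x last} → Table x qs B → windowsOK κ μ W last qs ≡ true → x ≤ y → 64 ≤ y → y ≤ last → y + suc y ≤ B → κ * mass y (suc y) ≤ μ * D
  small-mass {x = x} tab ok x≤y 64≤y y≤last 2y≤B with m≤n⇒m<n∨m≡n x≤y
  small-mass {qs = []} tab () x≤y 64≤y y≤last 2y≤B | _
  small-mass {qs = p ∷ qs} {y = y} {last = last} tab ok x≤y 64≤y y≤last 2y≤B | inj₂ refl with p <ᵇ 64 in p<64
  ... | true = ⊥-elim (<⇒≱ (<ᵇ⇒< p 64 (subst T (sym p<64) tt)) (≤-trans 64≤y (head-≥ tab)))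
  ... | false with κ * window W (p + p) (p ∷ qs) ≤ᵇ μ * W in fits
  ...   | true = from-window (table-window (suc y) (p + p) (≤-trans (s≤s (s≤s (s≤s z≤n))) 64≤y) tab
            (≤-trans (≤-reflexive (+-suc y y)) (s≤s (+-mono-≤ (head-≥ tab) (head-≥ tab)))) 2y≤B) (≤ᵇ⇒≤ _ _ (subst T (sym fits) tt))
  small-mass {qs = p ∷ qs} (skip _ tab) ok x≤y 64≤y y≤last 2y≤B | inj₁ x<y = small-mass tab ok x<y 64≤y y≤last 2y≤B
  small-mass {qs = p ∷ qs} {last = last} (take _ tab) ok x≤y 64≤y y≤last 2y≤B | inj₁ x<y with p <ᵇ 64
  ... | true = small-mass tab ok x<y 64≤y y≤last 2y≤B
  ... | false with κ * window W (p + p) (p ∷ qs) ≤ᵇ μ * W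
  ...   | true with last <ᵇ p in far
  ...     | true = ⊥-elim (<⇒≱ (<-trans (<ᵇ⇒< last p (subst T (sym far) tt)) x<y) y≤last)
  ...     | false = small-mass tab ok x<y 64≤y y≤last 2y≤B

  -- A prime in the block has residue prime to 210, in particular r ≥ 1, so p - 2 ≥ 210 a - 1.
  residue-weight : ∀ a r → 0 < a → weight (210 * a + r) ≤ coprime210 r * div D (210 * a ∸ 1)
  residue-weight a r 0<a with ((r % 2 ≡ᵇ 0) ∨ (r % 3 ≡ᵇ 0)) ∨ ((r % 5 ≡ᵇ 0) ∨ (r % 7 ≡ᵇ 0)) in eq
  ... | true = ≤-trans (≤-reflexive (weight-¬prime {210 * a + r} λ pr → [ [ not-multiple 2 105 refl pr , not-multiple 3 70 refl pr ]′ , [ not-multiple 5 42 refl pr , not-multiple 7 30 refl pr ]′ ]′ cases)) z≤n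
    where
    or : ∀ {b c} → b ∨ c ≡ true → b ≡ true ⊎ c ≡ true
    or {true} _ = inj₁ refl
    or {false} h = inj₂ h
    cases : ((r % 2 ≡ᵇ 0) ≡ true ⊎ (r % 3 ≡ᵇ 0) ≡ true) ⊎ ((r % 5 ≡ᵇ 0) ≡ true ⊎ (r % 7 ≡ᵇ 0) ≡ true)
    cases = [ (λ h → inj₁ (or h)) , (λ h → inj₂ (or h)) ]′ (or {(r % 2 ≡ᵇ 0) ∨ (r % 3 ≡ᵇ 0)} eq)
    not-multiple : ∀ d c {{_ : NonZero d}} → c * d ≡ 210 → {{NonTrivial c}} → {{NonTrivial d}} → Prime (210 * a + r) → (r % d ≡ᵇ 0) ≡ true → ⊥
    not-multiple d c cd pr h with prime⇒irreducible pr (∣m∣n⇒∣m+n (∣m⇒∣m*n a (divides c (sym cd))) (m%n≡0⇒n∣m r d (≡ᵇ⇒≡ (r % d) 0 (subst T (sym h) tt))))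
    ... | inj₁ d≡1 = <⇒≢ (nonTrivial⇒n>1 d) (sym d≡1)
    ... | inj₂ d≡p = <⇒≢ (<-≤-trans (≤-trans (m<m*n d c (nonTrivial⇒n>1 c)) (≤-reflexive (trans (*-comm d c) cd))) (≤-trans (m≤m*n 210 a {{>-nonZero 0<a}}) (m≤m+n (210 * a) r))) d≡p
  residue-weight a zero 0<a | false with () ← eq
  residue-weight a (suc r) 0<a | false = ≤-trans (weight≤ (210 * a + suc r)) (≤-trans (div-anti D 0<v (≤-trans (≤-reflexive (cong (_∸ 2) (+-comm 1 (210 * a)))) (∸-monoˡ-≤ 2 (+-monoʳ-≤ (210 * a) (s≤s (z≤n {r})))))) (≤-reflexive (sym (+-identityʳ _))))
    where
    0<v : 0 < 210 * a ∸ 1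
    0<v = m<n⇒0<n∸m (<-≤-trans (s≤s (s≤s z≤n)) (m≤m*n 210 a {{>-nonZero 0<a}}))

  block-weights : ∀ a r k → 0 < a → mass (210 * a + r) k ≤ count210 r k * div D (210 * a ∸ 1)
  block-weights a r zero 0<a = z≤n
  block-weights a r (suc k) 0<a = begin
    1 * weight (210 * a + r) + mass (suc (210 * a + r)) k        ≡⟨ cong₂ (λ w y → w + mass y k) (*-identityˡ (weight (210 * a + r))) (sym (+-suc (210 * a) r)) ⟩
    weight (210 * a + r) + mass (210 * a + suc r) k              ≤⟨ +-mono-≤ (residue-weight a r 0<a) (block-weights a (suc r) k 0<a) ⟩
    coprime210 r * v + count210 (suc r) k * v                    ≡⟨ *-distribʳ-+ v (coprime210 r) (count210 (suc r) k) ⟨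
    (coprime210 r + count210 (suc r) k) * v                      ∎
    where
    open ≤-Reasoning
    v = div D (210 * a ∸ 1)

  count210≡48 : count210 0 210 ≡ 48
  count210≡48 = refl

  block-mass-≤ : ∀ a → 0 < a → mass (210 * a) 210 ≤ 48 * div D (210 * a ∸ 1)
  block-mass-≤ a 0<a = ≤-trans (≤-reflexive (cong (λ y → mass y 210) (sym (+-identityʳ (210 * a)))))
    (≤-trans (block-weights a 0 210 0<a) (≤-reflexive (cong (_* div D (210 * a ∸ 1)) count210≡48)))

  blocks-mass : ∀ a k → 0 < a → mass (210 * a) (k * 210) ≤ 48 * blockSum D a k
  blocks-mass a zero 0<a = z≤n
  blocks-mass a (suc k) 0<a = begin
    mass (210 * a) (210 + k * 210)                               ≡⟨ Σw-++ (λ _ → 1) (210 * a) 210 (k * 210) ⟩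
    mass (210 * a) 210 + mass (210 * a + 210) (k * 210)          ≡⟨ cong (λ y → mass (210 * a) 210 + mass y (k * 210)) (trans (+-comm (210 * a) 210) (sym (*-suc 210 a))) ⟩
    mass (210 * a) 210 + mass (210 * suc a) (k * 210)            ≤⟨ +-mono-≤ (block-mass-≤ a 0<a) (blocks-mass (suc a) k z<s) ⟩
    48 * div D (210 * a ∸ 1) + 48 * blockSum D (suc a) k         ≡⟨ *-distribˡ-+ 48 (div D (210 * a ∸ 1)) (blockSum D (suc a) k) ⟨
    48 * (div D (210 * a ∸ 1) + blockSum D (suc a) k)            ∎
    where open ≤-Reasoning

  blockSum-snoc : ∀ a k → blockSum D a (suc k) ≡ blockSum D a k + div D (210 * (a + k) ∸ 1)
  blockSum-snoc a zero = trans (+-comm (div D (210 * a ∸ 1)) 0) (cong (λ b → div D (210 * b ∸ 1)) (sym (+-identityʳ a)))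
  blockSum-snoc a (suc k) = trans (cong (div D (210 * a ∸ 1) +_) (blockSum-snoc (suc a) k))
    (trans (sym (+-assoc (div D (210 * a ∸ 1)) _ _)) (cong (λ b → blockSum D a (suc k) + div D (210 * b ∸ 1)) (sym (+-suc a k))))

  -- Two blocks near 2a weigh no more than the block at a.
  blockSum-decreasing : ∀ a → 0 < a → blockSum D (suc a) (suc (suc (suc a))) ≤ blockSum D a (suc (suc a))
  blockSum-decreasing a 0<a = begin
    blockSum D (suc a) (3 + a)                                      ≡⟨ blockSum-snoc (suc a) (2 + a) ⟩
    blockSum D (suc a) (2 + a) + v′                                 ≡⟨ cong (_+ v′) (blockSum-snoc (suc a) (suc a)) ⟩
    blockSum D (suc a) (suc a) + v″ + v′                            ≡⟨ +-assoc (blockSum D (suc a) (suc a)) v″ v′ ⟩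
    blockSum D (suc a) (suc a) + (v″ + v′)                          ≤⟨ +-monoʳ-≤ (blockSum D (suc a) (suc a)) (+-monoʳ-≤ v″ (≤-trans (div-anti D 0<x (∸-monoˡ-≤ 1 (*-monoʳ-≤ 210 (+-monoʳ-≤ (suc a) (n≤1+n (suc a)))))) (≤-reflexive (sym (+-identityʳ v″))))) ⟩
    blockSum D (suc a) (suc a) + 2 * v″                             ≤⟨ +-monoʳ-≤ (blockSum D (suc a) (suc a)) (2div≤ D 0<z 2z≤x) ⟩
    blockSum D (suc a) (suc a) + div D (210 * a ∸ 1)                ≡⟨ +-comm (blockSum D (suc a) (suc a)) _ ⟩
    div D (210 * a ∸ 1) + blockSum D (suc a) (suc a)                ∎
    where
    open ≤-Reasoning
    v″ = div D (210 * (suc a + suc a) ∸ 1)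
    v′ = div D (210 * (suc a + (2 + a)) ∸ 1)
    0<z : 0 < 210 * a ∸ 1
    0<z = m<n⇒0<n∸m (<-≤-trans (s≤s (s≤s z≤n)) (m≤m*n 210 a {{>-nonZero 0<a}}))
    abstract
      swap : ∀ b c d → b * (c * d) ≡ c * (b * d)
      swap = solve-∀
    2z≤x : 2 * (210 * a ∸ 1) ≤ 210 * (suc a + suc a) ∸ 1
    2z≤x = ≤-trans (≤-trans (*-monoʳ-≤ 2 (m∸n≤m (210 * a) 1)) (≤-reflexive (swap 2 210 a)))
      (≤-trans (m+n≤o⇒m≤o∸n (210 * (2 * a)) (≤-trans (+-monoʳ-≤ (210 * (2 * a)) (s≤s (z≤n {209}))) (≤-reflexive (trans (+-comm (210 * (2 * a)) 210) (sym (*-suc 210 (2 * a))))))) (∸-monoˡ-≤ 1 (*-monoʳ-≤ 210 (≤-trans (≤-reflexive (cong (λ z → suc (a + z)) (+-identityʳ a))) (s≤s (+-monoʳ-≤ a (n≤1+n a)))))))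
    0<x : 0 < 210 * (suc a + suc a) ∸ 1
    0<x = <-≤-trans (*-pos (z<s {1}) 0<z) 2z≤x

  blockSum-bound : ∀ a₀ k → 0 < a₀ → blockSum D (k + a₀) (2 + (k + a₀)) ≤ blockSum D a₀ (2 + a₀)
  blockSum-bound a₀ zero 0<a₀ = ≤-refl
  blockSum-bound a₀ (suc k) 0<a₀ = ≤-trans (blockSum-decreasing (k + a₀) (≤-trans 0<a₀ (m≤n+m a₀ k))) (blockSum-bound a₀ k 0<a₀)

  blockSum-ceil : ∀ a k → 0 < a → W * blockSum D a k ≤ blockCeil W a k * D
  blockSum-ceil a zero 0<a = ≤-reflexive (*-zeroʳ W)
  blockSum-ceil a (suc k) 0<a = begin
    W * (div D v + blockSum D (suc a) k)                   ≡⟨ *-distribˡ-+ W (div D v) _ ⟩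
    W * div D v + W * blockSum D (suc a) k                 ≤⟨ +-mono-≤ (div*≤ceil W D v (m<n⇒0<n∸m (<-≤-trans (s≤s (s≤s z≤n)) (m≤m*n 210 a {{>-nonZero 0<a}})))) (blockSum-ceil (suc a) k z<s) ⟩
    ceilDiv W v * D + blockCeil W (suc a) k * D            ≡⟨ *-distribʳ-+ D (ceilDiv W v) _ ⟨
    (ceilDiv W v + blockCeil W (suc a) k) * D              ∎
    where
    open ≤-Reasoning
    v = 210 * a ∸ 1

  mass-mono-≤ : ∀ y {k l} → k ≤ l → mass y k ≤ mass y l
  mass-mono-≤ y z≤n = z≤n
  mass-mono-≤ y (s≤s k≤l) = +-monoʳ-≤ (1 * weight y) (mass-mono-≤ (suc y) k≤l)

  -- With a = y/210 rounded down, [y, 2y] lies in the a + 2 blocks from 210 a on. The block sum does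
  -- not increase with a, so one check at a₀ settles all larger y.
  large-mass : ∀ a₀ → 0 < a₀ → κ * (48 * blockCeil W a₀ (2 + a₀)) ≤ μ * W → 210 * a₀ ≤ y → κ * mass y (suc y) ≤ μ * D
  large-mass {y} a₀ 0<a₀ ok y≥ = from-window {w = 48 * blockCeil W a₀ (2 + a₀)} (begin
    W * mass y (suc y)                          ≤⟨ *-monoʳ-≤ W (≤-trans inside (blocks-mass a (2 + a) 0<a)) ⟩
    W * (48 * blockSum D a (2 + a))             ≤⟨ *-monoʳ-≤ W (*-monoʳ-≤ 48 (subst (λ b → blockSum D b (2 + b) ≤ blockSum D a₀ (2 + a₀)) (m∸n+n≡m a₀≤a) (blockSum-bound a₀ (a ∸ a₀) 0<a₀))) ⟩
    W * (48 * blockSum D a₀ (2 + a₀))           ≡⟨ lem W (blockSum D a₀ (2 + a₀)) ⟩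
    48 * (W * blockSum D a₀ (2 + a₀))           ≤⟨ *-monoʳ-≤ 48 (blockSum-ceil a₀ (2 + a₀) 0<a₀) ⟩
    48 * (blockCeil W a₀ (2 + a₀) * D)          ≡⟨ *-assoc 48 (blockCeil W a₀ (2 + a₀)) D ⟨
    48 * blockCeil W a₀ (2 + a₀) * D            ∎) ok
    where
    open ≤-Reasoning
    a = y / 210
    a₀≤a : a₀ ≤ a
    a₀≤a = s≤s⁻¹ (*-cancelʳ-< 210 a₀ (suc a) (≤-<-trans (≤-trans (≤-reflexive (*-comm a₀ 210)) y≥) (div<⇒<* {y} {210} z<s ≤-refl)))
    0<a = ≤-trans 0<a₀ a₀≤a
    base≤y : 210 * a ≤ y
    base≤y = ≤-trans (≤-reflexive (*-comm 210 a)) (m/n*n≤m y 210)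
    o = y ∸ 210 * a
    o<210 : o < 210
    o<210 = +-cancelˡ-< (210 * a) _ _ (subst₂ _<_ (sym (m+[n∸m]≡n base≤y)) (trans (+-comm 210 (a * 210)) (cong (_+ 210) (*-comm a 210))) (div<⇒<* {y} {210} z<s ≤-refl))
    abstract
      lem : ∀ W S → W * (48 * S) ≡ 48 * (W * S)
      lem = solve-∀
    fits : o + suc y ≤ (2 + a) * 210
    fits = begin
      o + suc y                         ≡⟨ cong (λ z → o + suc z) (m+[n∸m]≡n base≤y) ⟨
      o + suc (210 * a + o)             ≤⟨ +-mono-≤ (<⇒≤ o<210) (≤-trans (≤-reflexive (sym (+-suc (210 * a) o))) (+-monoʳ-≤ (210 * a) o<210)) ⟩
      210 + (210 * a + 210)             ≡⟨ cong (210 +_) (trans (+-comm (210 * a) 210) (cong (210 +_) (*-comm 210 a))) ⟩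
      (2 + a) * 210                     ∎
    inside : mass y (suc y) ≤ mass (210 * a) ((2 + a) * 210)
    inside = begin
      mass y (suc y)                                       ≤⟨ m≤n+m _ (mass (210 * a) o) ⟩
      mass (210 * a) o + mass y (suc y)                    ≡⟨ cong (λ z → mass (210 * a) o + mass z (suc y)) (m+[n∸m]≡n base≤y) ⟨
      mass (210 * a) o + mass (210 * a + o) (suc y)        ≡⟨ Σw-++ (λ _ → 1) (210 * a) o (suc y) ⟨
      mass (210 * a) (o + suc y)                           ≤⟨ mass-mono-≤ (210 * a) {o + suc y} {(2 + a) * 210} fits ⟩
      mass (210 * a) ((2 + a) * 210)                       ∎

-- @@Sound

private variable
  k′ R v H : ℕ

≤ᵇ-true : ∀ {a b} → (a ≤ᵇ b) ≡ true → a ≤ b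
≤ᵇ-true {a} eq = ≤ᵇ⇒≤ a _ (subst T (sym eq) _)

<ᵇ-true : ∀ {a b} → (a <ᵇ b) ≡ true → a < b
<ᵇ-true {a} eq = <ᵇ⇒< a _ (subst T (sym eq) _)

<ᵇ-false : ∀ {a b} → (a <ᵇ b) ≡ false → b ≤ a
<ᵇ-false {a} {b} eq = ≮⇒≥ λ lt → subst T eq (<⇒<ᵇ lt)

∧-true : ∀ {b c} → b ∧ c ≡ true → b ≡ true × c ≡ true
∧-true {true} eq = refl , eq

∨-true : ∀ {b c} → b ∨ c ≡ true → b ≡ true ⊎ c ≡ true
∨-true {true} eq = inj₁ refl
∨-true {false} eq = inj₂ eq

max-≤ˡ : ∀ a b → a ≤ max a b
max-≤ˡ a b with a <ᵇ b in eq
... | true = <⇒≤ (<ᵇ-true eq)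
... | false = ≤-refl

max-≤ʳ : ∀ a b → b ≤ max a b
max-≤ʳ a b with a <ᵇ b in eq
... | true = ≤-refl
... | false = <ᵇ-false eq

module Soundness (K B : ℕ) (ps₀ : List ℕ) (table₀ : Table 2 ps₀ B) where
  open Lower K
  open Search K

  table-primes : Table y qs B → Primes≥ y qs
  table-primes done = []
  table-primes (skip _ table) = primes-weaken (n≤1+n _) (table-primes table)
  table-primes (take pr table) = (pr , ≤-refl) ∷ table-primes table

  -- Ties the running total `R` to the prefix of the prime list already consumed; differences of
  -- such totals become masses of segments.
  record At (y R : ℕ) (qs : List ℕ) : Set where
    constructor at
    field
      pre : List ℕ
      split : ps₀ ≡ pre ++ qs
      sum-pre : R ≡ mass pre
      table : Table y qs B

  at-step : At y R (q ∷ qs) → At (suc q) (R + div K q) qs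
  at-step {q = q} {qs} (at pre split sum-pre table) =
    at (pre ++ q ∷ []) (trans split (sym (++-assoc pre (q ∷ []) qs)))
       (trans (cong₂ _+_ sum-pre (sym (+-identityʳ (div K q)))) (sym (mass-++ pre (q ∷ [])))) (table-tail table)

  at-head : At y R (q ∷ qs) → Prime q × y ≤ q
  at-head (at _ _ _ table) = table-head table

  at-raise : At y R (q ∷ qs) → At q R (q ∷ qs)
  at-raise (at a b c table) = at a b c (table-raise table)

  data Valid : Leaf → Set where
    valid : ∀ {acc v t} (position : At (suc v) acc t) → All (_≤ v) (At.pre position) → Valid (leaf acc v t)

  data Valids : Tree → Set where
    tip : ∀ {l} → Valid l → Valids (tip l)
    node : ∀ {v l r} → Valids l → Valids r → Valids (node v l r)

  look-valid : ∀ {T} → Valids T → ∀ x → Valid (look T x)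
  look-valid (tip vl) x = vl
  look-valid (node {v} l r) x with x <ᵇ v
  ... | true = look-valid l x
  ... | false = look-valid r x

  advance-valid : ∀ {l} → Valid l → Valid (advance l)
  advance-valid {leaf a v []} vl = vl
  advance-valid {leaf a v (p ∷ t)} (valid h@(at pre _ _ _) below) =
    valid (at-step h) (All.++⁺ (All.map (λ z≤v → ≤-trans z≤v (<⇒≤ (proj₂ (at-head h)))) below) (≤-refl ∷ []))

  data ValidBuilt : Built → Set where
    vbuilt : ∀ {T l} → Valids T → Valid l → ValidBuilt (built T l)

  build-valid : ∀ n {l} → Valid l → ValidBuilt (build n l)
  build₂-valid : ∀ {T l B} → Valids T → ValidBuilt B → ValidBuilt (build₂ T l B)
  build₂-valid {l = leaf _ v _} vT (vbuilt vT′ vl) = vbuilt (node vT vT′) vl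
  build-valid zero vl = vbuilt (tip vl) (advance-valid vl)
  build-valid (suc n) {l} vl with build n l | build-valid n vl
  ... | built T l′ | vbuilt vT vl′ = build₂-valid vT (build-valid n vl′)

  -- Two cuts of one list are ordered by the masses of their prefixes, so comparing the stored
  -- totals recovers the segment of primes between the cuts.
  suffixes : ∀ pre pre′ {qs t} → pre ++ qs ≡ pre′ ++ t → mass pre < mass pre′ → ∃ λ seg → qs ≡ seg ++ t × pre′ ≡ pre ++ seg
  suffixes [] pre′ eq lt = pre′ , eq , refl
  suffixes (x ∷ pre) (x′ ∷ pre′) eq lt with ∷-injective eq
  ... | refl , eq′ with suffixes pre pre′ eq′ (+-cancelˡ-< (div K x) _ _ lt)
  ...   | seg , qs≡ , pre′≡ = seg , qs≡ , cong (x ∷_) pre′≡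

  lb-family-then : ∀ {seg t r} → 0 < m → Primes≥ y (seg ++ t) → y ≤ z → All (_< z) seg →
    All (λ p → Prime p → y ≤ p → PND (m * p)) seg → LB m z r → LB m y (mass seg + r)
  lb-family-then {seg = []} 0<m _ y≤z _ _ rest = lb-later y≤z rest
  lb-family-then {m} {y} {z} {seg = p ∷ seg} {r = r} 0<m ((pr , y≤p) ∷ primes) y≤z (p<z ∷ <z) (h ∷ hs) rest =
    lb-later y≤p (subst (LB m p) (sym (+-assoc (div K p) (mass seg) r))
      (lb-split pr 0<m (lb-self (h pr y≤p))
        (lb-family-then 0<m primes p<z <z (All.map (λ f pr′ le → f pr′ (≤-trans y≤p (≤-trans (n≤1+n p) le))) hs) rest)))

  -- Each prime of the segment contributes 1/p after normalisation by m, giving `acc ∸ R₀` in total.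
  -- Truncated subtraction gives 0 if the leaf does not lie beyond the current position.
  family : ∀ {y₀ R₀ qs₀ acc v t r} → 0 < m → y ≤ y₀ → At y₀ R₀ qs₀ → Valid (leaf acc v t) → y ≤ z → v < z →
    (∀ {p} → Prime p → y₀ ≤ p → p ≤ v → PND (m * p)) → LB m z r → LB m y ((acc ∸ R₀) + r)
  family {m} {y} {z} {y₀} {R₀} {qs₀} {acc} {v} {t} {r} 0<m y≤y₀ (at pre split refl table) (valid (at pre′ split′ refl _) below) y≤z v<z pnd rest
    with <-≤-connex (mass pre) (mass pre′)
  ... | inj₂ ≥ = subst (LB m y) (cong (_+ r) (sym (m≤n⇒m∸n≡0 ≥))) (lb-later y≤z rest)
  ... | inj₁ lt with suffixes pre pre′ (trans (sym split) split′) lt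
  ...   | [] , _ , refl = ⊥-elim (<-irrefl refl (subst (mass pre <_) (trans (mass-++ pre []) (+-identityʳ _)) lt))
  ...   | seg@(p₀ ∷ _) , refl , refl = lb-later y≤y₀ (subst (LB m y₀) (cong (_+ r) (sym seg≡))
            (lb-family-then 0<m (table-primes table) (≤-trans (proj₂ (at-head (at pre split refl table))) (≤-trans (All.head seg≤) (<⇒≤ v<z)))
               (All.map (λ p≤v → ≤-<-trans p≤v v<z) seg≤) (All.map (λ p≤v pr y₀≤p → pnd pr y₀≤p p≤v) seg≤) rest))
    where
    seg≤ : All (_≤ v) seg
    seg≤ = All.++⁻ʳ pre below
    seg≡ : mass (pre ++ seg) ∸ mass pre ≡ mass seg
    seg≡ = trans (cong (_∸ mass pre) (mass-++ pre seg)) (m+n∸m≡n (mass pre) (mass seg))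

  inv-prime : Inv m s M y → Prime q → y ≤ q → d + s ≡ 2 * m → s < q * d → M ≤ suc q → Inv (m * q) (s * suc q) (suc q) (suc q)
  inv-prime {m} {s} {M} {y} {q} {d} inv qp y≤q d+s s<qd M≤ =
    subst₂ (λ a b → Inv a b (suc q) (suc q)) m*q s*sp
      (inv-pow inv qp y≤q 1 M≤ (≤-reflexive sp1) (subst₂ _<_ (sym s*sp) (cong (2 *_) (sym m*q)) (begin-strict
        s * suc q        ≡⟨ *-suc s q ⟩
        s + s * q        <⟨ +-monoˡ-< (s * q) s<qd ⟩
        q * d + s * q    ≡⟨ lem q d s ⟩
        (d + s) * q      ≡⟨ cong (_* q) d+s ⟩
        2 * m * q        ≡⟨ *-assoc 2 m q ⟩
        2 * (m * q)      ∎)))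
    where
    open ≤-Reasoning
    sp1 : sp q 1 ≡ suc q
    sp1 = lem q where
      lem : ∀ p → 1 * p + 1 ≡ suc p
      lem = solve-∀
    m*q : m * q ^ 1 ≡ m * q
    m*q = cong (m *_) (*-identityʳ q)
    s*sp : s * sp q 1 ≡ s * suc q
    s*sp = cong (s *_) sp1
    lem : ∀ q d s → q * d + s * q ≡ (d + s) * q
    lem = solve-∀

  module _ {T : Tree} (vT : Valids T) where

    -- Here H lies between k and k′, where H = s / d is the largest p for which m p is nondeficient.
    Window : ℕ → ℕ → ℕ → Set
    Window k k′ g = ∀ {m s M y d} → Inv m s M y → d + s ≡ 2 * m → k * d ≤ s → s < k′ * d → y ≤ k′ → M ≤ suc k′ → LB m k′ g

    growFam-sound : k < k′ → k′ ≤ q → Prime q → At (suc q) R qs → ∀ {m s M y d} →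
      Inv m s M y → d + s ≡ 2 * m → k * d ≤ s → s < k′ * d → y ≤ k′ → M ≤ suc k′ →
      LB (m * q) q (growFam R (look T (div (k * suc q) (q ∸ k))) (div (k * suc q) (q ∸ k)))
    growFam-sound {k} {k′} {q} {R} {qs} k<k′ k′≤q qp atR {m} {s} {M} {y} {d} inv d+s kd≤s s<k′d y≤k′ M≤k′
      with look T (div (k * suc q) (q ∸ k)) | look-valid vT (div (k * suc q) (q ∸ k))
    ... | leaf acc v t | vl with v ≤ᵇ div (k * suc q) (q ∸ k) in eq
    ...   | false = lb-zero
    ...   | true = lb-later (n≤1+n q) (subst (LB (m * q) (suc q)) (+-identityʳ _) fam′)
      where
      open ≤-Reasoning
      y≤q = ≤-trans y≤k′ k′≤q
      inv′ : Inv (m * q) (s * suc q) (suc q) (suc q)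
      inv′ = inv-prime inv qp y≤q d+s (<-≤-trans s<k′d (*-monoˡ-≤ d k′≤q)) (≤-trans M≤k′ (s≤s k′≤q))
      d′ = 2 * (m * q) ∸ s * suc q
      d′+s′ : d′ + s * suc q ≡ 2 * (m * q)
      d′+s′ = m∸n+n≡m (<⇒≤ (Inv.def inv′))
      k≤q : k ≤ q
      k≤q = ≤-trans (<⇒≤ k<k′) k′≤q
      -- From p (q - k) ≤ k (q + 1) follows p q ≤ k (q + 1 + p). Multiplying by d and using k d ≤ s
      -- gives p d′ ≤ s (q + 1), where d′ = q d - s.
      bound : ∀ {p} → p ≤ v → p * d′ ≤ s * suc q
      bound {p} p≤v = +-cancelʳ-≤ (p * (s * suc q)) _ _ (begin
        p * d′ + p * (s * suc q)        ≡⟨ *-distribˡ-+ p d′ _ ⟨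
        p * (d′ + s * suc q)            ≡⟨ cong (p *_) d′+s′ ⟩
        p * (2 * (m * q))               ≡⟨ cong (p *_) (sym (*-assoc 2 m q)) ⟩
        p * (2 * m * q)                 ≡⟨ cong (λ w → p * (w * q)) d+s ⟨
        p * ((d + s) * q)               ≡⟨ lem₁ p d s q ⟩
        d * (p * q) + p * s * q         ≤⟨ +-monoˡ-≤ (p * s * q) (*-monoʳ-≤ d pq≤) ⟩
        d * (k * (suc q + p)) + p * s * q ≡⟨ lem₂ d k q p s ⟩
        k * d * (suc q + p) + p * s * q ≤⟨ +-monoˡ-≤ (p * s * q) (*-monoˡ-≤ (suc q + p) kd≤s) ⟩
        s * (suc q + p) + p * s * q     ≡⟨ lem₃ s q p ⟩
        s * suc q + p * (s * suc q)     ∎)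
        where
        pq≤ : p * q ≤ k * (suc q + p)
        pq≤ = begin
          p * q                        ≡⟨ cong (p *_) (m∸n+n≡m k≤q) ⟨
          p * (q ∸ k + k)              ≡⟨ *-distribˡ-+ p (q ∸ k) k ⟩
          p * (q ∸ k) + p * k          ≤⟨ +-monoˡ-≤ (p * k) (≤div⇒*≤ (≤-trans p≤v (≤ᵇ-true eq))) ⟩
          k * suc q + p * k            ≡⟨ cong (k * suc q +_) (*-comm p k) ⟩
          k * suc q + k * p            ≡⟨ *-distribˡ-+ k (suc q) p ⟨
          k * (suc q + p)              ∎
        lem₁ : ∀ p d s q → p * ((d + s) * q) ≡ d * (p * q) + p * s * q
        lem₁ = solve-∀
        lem₂ : ∀ d k q p s → d * (k * (suc q + p)) + p * s * q ≡ k * d * (suc q + p) + p * s * q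
        lem₂ = solve-∀
        lem₃ : ∀ s q p → s * (suc q + p) + p * s * q ≡ s * suc q + p * (s * suc q)
        lem₃ = solve-∀
      fam′ : LB (m * q) (suc q) ((acc ∸ R) + 0)
      fam′ = family (Inv.pos inv′) ≤-refl atR vl (m≤m+n (suc q) (suc v)) (m≤n+m (suc v) (suc q))
              (λ pp q<p p≤v → pnd-prime inv′ pp q<p d′+s′ (bound p≤v) (inj₁ (≤-trans q<p (n≤1+n _)))) lb-zero

    grow-sound : k < k′ → k′ ≤ z → At z R qs → ∀ {m s M y d} →
      Inv m s M y → d + s ≡ 2 * m → k * d ≤ s → s < k′ * d → y ≤ k′ → M ≤ suc k′ → LB m z (grow T R k qs)
    grow-sound {qs = []} k<k′ k′≤z atR inv d+s kd≤s s<k′d y≤k′ M≤k′ = lb-zero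
    grow-sound {k} {qs = q ∷ qs} k<k′ k′≤z atR inv d+s kd≤s s<k′d y≤k′ M≤k′ with 2 * k <ᵇ q
    ... | true = lb-zero
    ... | false = lb-later z≤q (lb-split (proj₁ (at-head atR)) (Inv.pos inv)
            (growFam-sound k<k′ k′≤q (proj₁ (at-head atR)) (at-step atR) inv d+s kd≤s s<k′d y≤k′ M≤k′)
            (grow-sound k<k′ (≤-trans k′≤q (n≤1+n q)) (at-step atR) inv d+s kd≤s s<k′d y≤k′ M≤k′))
      where
      z≤q = proj₂ (at-head atR)
      k′≤q = ≤-trans k′≤z z≤q

    growAt-sound : ∀ {l} → Valid l → Window k k′ (growAt T k k′ l)
    growAt-sound {l = leaf acc v []} vl inv d+s kd≤s s<k′d y≤k′ M≤k′ = lb-zero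
    growAt-sound {k} {k′} {l = leaf acc v (q ∷ t)} (valid h _) inv d+s kd≤s s<k′d y≤k′ M≤k′
      with (k <ᵇ k′) ∧ (k′ ≤ᵇ q) in eq
    ... | false = lb-zero
    ... | true = lb-later k′≤q (grow-sound (<ᵇ-true (proj₁ (∧-true eq))) k′≤q (at-raise h) inv d+s kd≤s s<k′d y≤k′ M≤k′)
      where
      k′≤q : k′ ≤ q
      k′≤q = ≤ᵇ-true (proj₂ (∧-true {k <ᵇ k′} eq))

    data Windows : GTree → Set where
      gtip : ∀ {k k′ g} → Window k k′ g → Windows (gtip k k′ g)
      gnode : ∀ {v l r} → Windows l → Windows r → Windows (gnode v l r)

    data WindowsBuilt : GBuilt → Set where
      gbuilt : ∀ {G k} → Windows G → WindowsBuilt (gbuilt G k)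

    gbuild-sound : ∀ n k → WindowsBuilt (gbuild n T k)
    gbuild-sound zero k = gbuilt (gtip (growAt-sound (look-valid vT (nextk k ∸ 1))))
    gbuild-sound (suc n) k with gbuild n T k | gbuild-sound n k
    ... | gbuilt G k₁ | gbuilt wG with gbuild n T k₁ | gbuild-sound n k₁
    ...   | gbuilt G′ k₂ | gbuilt wG′ = gbuilt (gnode wG wG′)

    glook-sound : ∀ {G} → Windows G → ∀ x → Windows (glook G x)
    glook-sound (gtip w) x = gtip w
    glook-sound (gnode {v} l r) x with x <ᵇ v
    ... | true = glook-sound l x
    ... | false = glook-sound r x

    module _ {G : GTree} (wG : Windows G) where

      go-sound : ∀ f → Inv m s M y → At y R qs → LB m y (go T G f m s M R qs)
      kids-sound : ∀ f {Q} → Inv m s M y → At z R qs → y ≤ z → LB m z (kids T G f m s M Q R qs)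
      rest-sound : ∀ b f → Inv m s M y → d + s ≡ 2 * m → H ≡ div s d → 0 < d → At z R qs → y ≤ z → z ≡ y ⊎ z ≤ suc H →
                   LB m z (rest T G b f m s M y d H R qs)
      pow-sound : ∀ f → Inv m s M y → At (suc q) R qs → Prime q → y ≤ q → ∀ e {mm ss M′ sp′} →
                  mm ≡ m * q ^ suc e → ss ≡ s * sp q (suc e) → sp′ ≡ sp q (suc e) → M ≤ M′ → sp′ ≤ M′ →
                  LB mm q (pow T G f s mm ss M′ sp′ R q qs)

      pow-sound zero inv atR qp y≤q e _ _ _ _ _ = lb-zero
      pow-sound {m} {s} {M} {y} {q} {R} {qs} (suc f) inv atR qp y≤q e {M′ = M′} refl refl refl M≤M′ sp≤M′
        with 2 * (m * q ^ suc e) ∸ s * sp q (suc e) in eq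
      ... | zero with s * sp q (suc e) * M′ <ᵇ 2 * (m * q ^ suc e) * M′ + s * sp q (suc e) in eq′
      ...   | false = lb-zero
      ...   | true = lb-self (pnd-pow inv qp y≤q (suc e) M≤M′ sp≤M′ (m∸n≡0⇒m≤n eq) (<ᵇ-true eq′))
      pow-sound {m} {s} {M} {y} {q} {R} {qs} (suc f) inv atR qp y≤q e {M′ = M′} refl refl refl M≤M′ sp≤M′ | suc d =
          combine (noSquare (mm * q))
        where
        mm = m * q ^ suc e
        ss = s * sp q (suc e)
        inv′ : Inv mm ss M′ (suc q)
        inv′ = inv-pow inv qp y≤q (suc e) M≤M′ sp≤M′ (m∸n≢0⇒n<m λ z → 0≢1+n (trans (sym z) eq))
        more : LB (mm * q) q (pow T G f s (mm * q) (ss * q + s) (max M′ (sp q (suc e) * q + 1)) (sp q (suc e) * q + 1) R q qs)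
        more = pow-sound f inv atR qp y≤q (suc e) (lem₁ m q (q ^ suc e)) (lem₂ s (sp q (suc e)) q) refl
                 (≤-trans M≤M′ (max-≤ˡ M′ (sp q (suc e) * q + 1))) (max-≤ʳ M′ (sp q (suc e) * q + 1))
          where
          lem₁ : ∀ m q t → m * t * q ≡ m * (q * t)
          lem₁ = solve-∀
          lem₂ : ∀ s t q → s * t * q + s ≡ s * (t * q + 1)
          lem₂ = solve-∀
        combine : ∀ b → LB mm q ((if b then 0 else div (pow T G f s (mm * q) (ss * q + s) (max M′ (sp q (suc e) * q + 1)) (sp q (suc e) * q + 1) R q qs) q) + go T G f mm ss M′ R qs)
        combine true = lb-later (n≤1+n q) (go-sound f inv′ atR)
        combine false = lb-split qp (Inv.pos inv′) more (go-sound f inv′ atR)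

      kids-sound {qs = []} f inv atR y≤z = lb-zero
      kids-sound {m} {s} {M} {y} {z} {R} {q ∷ qs} f {Q} inv atR y≤z with Q <ᵇ q
      kids-sound {m} {s} {M} {y} {z} {R} {q ∷ qs} f inv atR y≤z | true = lb-zero
      kids-sound {m} {s} {M} {y} {z} {R} {q ∷ qs} zero inv atR y≤z | false = lb-zero
      kids-sound {m} {s} {M} {y} {z} {R} {q ∷ qs} (suc f) inv atR y≤z | false =
        lb-later z≤q (lb-split qp (Inv.pos inv)
          (pow-sound f inv (at-step atR) qp y≤q 0 (cong (m *_) (sym (*-identityʳ q))) (cong (s *_) (lem q)) (lem q) (max-≤ˡ M (suc q)) (max-≤ʳ M (suc q)))
          (kids-sound f inv (at-step atR) (≤-trans y≤q (n≤1+n q))))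
        where
        qp = proj₁ (at-head atR)
        z≤q = proj₂ (at-head atR)
        y≤q = ≤-trans y≤z z≤q
        lem : ∀ q → suc q ≡ 1 * q + 1
        lem = solve-∀

      rest-sound false f inv _ _ _ atR y≤z _ = kids-sound f inv atR y≤z
      rest-sound {m} {s} {M} {y} {d} {H} {z} {R} {qs} true f inv d+s refl 0<d atR y≤z z≤ with glook G H | glook-sound wG H
      ... | gnode _ _ _ | _ = lb-zero
      ... | gtip k k′ g | gtip w with ((k ≤ᵇ H) ∧ (H <ᵇ k′)) ∧ ((y ≤ᵇ k′) ∧ (M ≤ᵇ suc k′)) in eq
      ...   | false = giveUp-sound (giveUp m)
        where
        giveUp-sound : ∀ b → LB m z (restG₂ T G b f m s M d R qs)
        giveUp-sound true = lb-zero
        giveUp-sound false = kids-sound f inv atR y≤z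
      ...   | true = lb-later z≤k′ (w inv d+s (≤div⇒*≤ {s} {d} k≤H) s<k′d y≤k′ M≤k′)
        where
        c₁ = ∧-true {k ≤ᵇ H} (proj₁ (∧-true eq))
        c₂ = ∧-true {y ≤ᵇ k′} (proj₂ (∧-true {(k ≤ᵇ H) ∧ (H <ᵇ k′)} eq))
        k≤H : k ≤ H
        k≤H = ≤ᵇ-true (proj₁ c₁)
        H<k′ : H < k′
        H<k′ = <ᵇ-true (proj₂ c₁)
        y≤k′ = ≤ᵇ-true (proj₁ c₂)
        M≤k′ : M ≤ suc k′
        M≤k′ = ≤ᵇ-true (proj₂ c₂)
        s<k′d : s < k′ * d
        s<k′d = div<⇒<* {s} 0<d H<k′
        z≤k′ : z ≤ k′
        z≤k′ = [ (λ z≡y → subst (_≤ k′) (sym z≡y) y≤k′) , (λ z≤H → ≤-trans z≤H H<k′) ]′ z≤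

      go-sound zero inv atR = lb-zero
      go-sound {qs = []} (suc f) inv atR = lb-zero
      go-sound {m} {s} {M} {y} {R} {y₁ ∷ qs} (suc f) inv atR with 2 * m ∸ s in eq
      ... | zero = lb-zero
      ... | suc d′ with look T (div s (suc d′)) | look-valid vT (div s (suc d′))
      ...   | leaf acc v t | vl@(valid atV _) = lb-later y≤y₁ (split ((y₁ ≤ᵇ v) ∧ (v ≤ᵇ div s (suc d′))) refl)
        where
        d₀ = suc d′
        H₀ = div s d₀
        y≤y₁ = proj₂ (at-head atR)
        inv₁ : Inv m s M y₁
        inv₁ = record { base = smooth-later y≤y₁ base ; def = def ; M>0 = M>0 ; top = top }
          where open Inv inv
        atR₁ = at-raise atR
        d+s : d₀ + s ≡ 2 * m
        d+s = trans (cong (_+ s) (sym eq)) (m∸n+n≡m (<⇒≤ (Inv.def inv)))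
        bnd : ∀ {p} → v ≤ H₀ → p ≤ v → p * d₀ ≤ s
        bnd v≤H p≤v = ≤div⇒*≤ (≤-trans p≤v v≤H)
        cond-mono : ∀ {p₀ p} → p₀ ≤ p → s * M < p₀ * (d₀ * M + s) + s → s * M < p * (d₀ * M + s) + s
        cond-mono p₀≤p lt = <-≤-trans lt (+-monoˡ-≤ s (*-monoˡ-≤ (d₀ * M + s) p₀≤p))
        fam₁-sound : ∀ {l r z} → v ≤ H₀ → y₁ ≤ z → v < z → Valid l → LB m z r → LB m y₁ (fam₁ T G l m s M y₁ d₀ acc + r)
        fam₁-sound {leaf a _ []} v≤H y≤z v<z vl′ lbr = lb-later y≤z lbr
        fam₁-sound {leaf a _ (p ∷ _)} {r} v≤H y≤z v<z (valid at′ _) lbr with (y₁ ≤ᵇ p) ∧ (s * M <ᵇ p * (d₀ * M + s) + s) in eqc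
        ... | false = lb-later y≤z lbr
        ... | true = family (Inv.pos inv) (≤ᵇ-true (proj₁ (∧-true eqc))) (at-raise at′) vl y≤z v<z
                (λ pp p₀≤ p≤v → pnd-prime inv₁ pp (≤-trans (≤ᵇ-true (proj₁ (∧-true eqc))) p₀≤) d+s (bnd v≤H p≤v)
                   (inj₂ (cond-mono p₀≤ (<ᵇ-true (proj₂ (∧-true {y₁ ≤ᵇ p} eqc)))))) lbr
        fam-sound : ∀ b {r z} → b ≡ ((M ≤ᵇ suc y₁) ∨ (s * M <ᵇ y₁ * (d₀ * M + s) + s)) → v ≤ H₀ → y₁ ≤ z → v < z → LB m z r →
                    LB m y₁ (fam T G b m s M R y₁ d₀ acc + r)
        fam-sound false _ v≤H y≤z v<z lbr = fam₁-sound v≤H y≤z v<z (look-valid vT _) lbr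
        fam-sound true eqb v≤H y≤z v<z lbr = family (Inv.pos inv) ≤-refl atR₁ vl y≤z v<z
                (λ pp y≤p p≤v → pnd-prime inv₁ pp y≤p d+s (bnd v≤H p≤v) (cond y≤p (∨-true {M ≤ᵇ suc y₁} (sym eqb)))) lbr
          where
          cond : ∀ {p} → y₁ ≤ p → (M ≤ᵇ suc y₁) ≡ true ⊎ (s * M <ᵇ y₁ * (d₀ * M + s) + s) ≡ true → M ≤ suc p ⊎ s * M < p * (d₀ * M + s) + s
          cond y≤p (inj₁ t) = inj₁ (≤-trans (≤ᵇ-true t) (s≤s y≤p))
          cond y≤p (inj₂ t) = inj₂ (cond-mono y≤p (<ᵇ-true t))
        split : ∀ b → b ≡ (y₁ ≤ᵇ v) ∧ (v ≤ᵇ H₀) → LB m y₁ (go₃ T G b f m s M R y₁ qs d₀ H₀ acc t)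
        split false _ = rest-sound ((29 <ᵇ H₀) ∧ tabulated m) f inv₁ d+s refl z<s atR₁ ≤-refl (inj₁ refl)
        split true eqb = fam-sound _ refl v≤H y₁≤1+v (n<1+n v) (rest-sound ((29 <ᵇ H₀) ∧ tabulated m) f inv₁ d+s refl z<s atV y₁≤1+v (inj₂ (s≤s v≤H)))
          where
          v≤H = ≤ᵇ-true (proj₂ (∧-true {y₁ ≤ᵇ v} (sym eqb)))
          y₁≤1+v = ≤-trans (≤ᵇ-true (proj₁ (∧-true (sym eqb)))) (n≤1+n v)

-- @@UProg

log : ℕ → ℕ
log s = if s <ᵇ 65536 then (if s <ᵇ 1024 then (if s <ᵇ 128 then 7 else 10) else if s <ᵇ 8192 then 13 else 16)
        else if s <ᵇ 4194304 then (if s <ᵇ 524288 then 19 else 22) else if s <ᵇ 134217728 then (if s <ᵇ 33554432 then 25 else 27)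
        else if s <ᵇ 1099511627776 then (if s <ᵇ 4294967296 then 32 else 40) else s

log-prime : ℕ → ℕ
log-prime p = if p <ᵇ 64 then (if p <ᵇ 8 then (if p <ᵇ 4 then 2 else 3) else if p <ᵇ 16 then 4 else if p <ᵇ 32 then 5 else 6)
              else if p <ᵇ 256 then 8 else if p <ᵇ 1024 then 10 else if p <ᵇ 4096 then 12 else p

-- Coefficients of an estimate for all y ≥ 2: κ m times the sum of 1/n is at most crude₀(y) +
-- crude₁(y) ℓ when σ(m) ≤ 2^ℓ. They are constant between primes and certified by the recursion in
-- `crudeOK`.
crude₀ crude₁ : ℕ → ℕ
crude₀ y = (if y <ᵇ 24 then (if y <ᵇ 8 then (if y <ᵇ 3 then 30601 else (if y <ᵇ 4 then 9059 else (if y <ᵇ 6 then 4757 else 3358))) else (if y <ᵇ 14 then (if y <ᵇ 12 then 2659 else 2284) else (if y <ᵇ 18 then 2010 else (if y <ᵇ 20 then 1810 else 1647)))) else (if y <ᵇ 42 then (if y <ᵇ 30 then 1523 else (if y <ᵇ 32 then 1431 else (if y <ᵇ 38 then 1350 else 1280))) else (if y <ᵇ 48 then (if y <ᵇ 44 then 1219 else 1163) else (if y <ᵇ 54 then 1114 else (if y <ᵇ 60 then 1072 else (if y <ᵇ 62 then 1035 else 1000))))))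
crude₁ y = (if y <ᵇ 24 then (if y <ᵇ 8 then (if y <ᵇ 3 then 2568 else (if y <ᵇ 4 then 856 else (if y <ᵇ 6 then 489 else 372))) else (if y <ᵇ 14 then (if y <ᵇ 12 then 311 else 280) else (if y <ᵇ 18 then 256 else (if y <ᵇ 20 then 240 else 226)))) else (if y <ᵇ 42 then (if y <ᵇ 30 then 215 else (if y <ᵇ 32 then 207 else (if y <ᵇ 38 then 200 else 194))) else (if y <ᵇ 48 then (if y <ᵇ 44 then 189 else 184) else (if y <ᵇ 54 then 180 else (if y <ᵇ 60 then 176 else (if y <ᵇ 62 then 172 else 169))))))

hasSmallFactor : ℕ → Bool
hasSmallFactor y = (multiple 2 ∨ multiple 3) ∨ (multiple 5 ∨ multiple 7)
  where
  multiple : (d : ℕ) {{_ : NonZero d}} → Bool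
  multiple d = (d <ᵇ y) ∧ (y % d ≡ᵇ 0)

-- With q = y - 1, the powers of a prime y have total weight y/q². The bound at y must absorb the
-- bound at y + 1 plus this weight times the bound with ℓ raised by the logarithm of the prime; the
-- two tests compare constant terms and coefficients of ℓ.
crudeStep : ℕ → ℕ → Bool
crudeStep y q = (q * q * crude₀ (suc y) + y * (crude₀ (suc y) + crude₁ (suc y) * log-prime y) ≤ᵇ q * q * crude₀ y)
              ∧ ((q * q + y) * crude₁ (suc y) ≤ᵇ q * q * crude₁ y)

crudeOK : ℕ → ℕ → Bool
crudeOK y zero = true
crudeOK y (suc k) = (((crude₀ (suc y) ≤ᵇ crude₀ y) ∧ (crude₁ (suc y) ≤ᵇ crude₁ y)) ∧ (hasSmallFactor y ∨ crudeStep y (y ∸ 1))) ∧ crudeOK (suc y) k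

-- The binary logarithm rounded down and capped at 11.
level : ℕ → ℕ
level v = if v <ᵇ 64 then (if v <ᵇ 8 then (if v <ᵇ 2 then 0 else if v <ᵇ 4 then 1 else 2) else if v <ᵇ 16 then 3 else if v <ᵇ 32 then 4 else 5)
          else if v <ᵇ 512 then (if v <ᵇ 128 then 6 else if v <ᵇ 256 then 7 else 8) else if v <ᵇ 1024 then 9 else if v <ᵇ 2048 then 10 else 11

module Bounding (K B κ : ℕ) (α 2β : ℕ) (ε₁ ε₂ ε₃ : ℕ) (T : Tree) where

  crude : ℕ → ℕ → ℕ → ℕ
  crude m s y = ceilDiv (K * (crude₀ y + crude₁ y * log s)) (κ * m)

  -- The value of `T-bound` with D cancelled, used only after the level condition is confirmed. The
  -- second test is the level 0 condition, which has y in place of y - 1.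
  fine : ℕ → ℕ → ℕ → ℕ → ℕ → ℕ
  fine m s d y i = if (s * 2 ^ i ≤ᵇ d * (y ∸ 1)) ∨ ((i ≡ᵇ 0) ∧ (s ≤ᵇ d * y)) then ceilDiv (K * (α * y + 2β * log s)) (y * (κ * 4 ^ i * m)) else crude m s y

  -- `m₁` is a proper divisor of m with divisor sum `s₁`. Primes up to the threshold of m₁
  -- contribute nothing, as m₁ p is a nondeficient proper divisor of m p. Primes from there to the
  -- threshold of m contribute at most 1/(m p) each (`cross`). Larger primes are branched on until
  -- an analytic bound falls below a cut-off (`loop`).
  up : ℕ → ℕ → ℕ → ℕ → ℕ → ℕ → List ℕ → ℕ
  up₁ : ℕ → ℕ → ℕ → ℕ → ℕ → ℕ → ℕ → List ℕ → ℕ → ℕ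
  up₂ : Bool → ℕ → ℕ → ℕ → ℕ → ℕ → ℕ → ℕ → List ℕ → ℕ → ℕ
  skipped : Leaf → ℕ → ℕ → ℕ → ℕ → ℕ → ℕ → ℕ → List ℕ → ℕ → ℕ
  cross : ℕ → ℕ → ℕ → ℕ → ℕ → ℕ → List ℕ → ℕ → ℕ
  cross₁ : Bool → ℕ → ℕ → ℕ → ℕ → ℕ → ℕ → ℕ → List ℕ → ℕ → ℕ → ℕ
  crossed : Leaf → ℕ → ℕ → ℕ → ℕ → ℕ → ℕ → ℕ → ℕ → ℕ → ℕ
  loop : ℕ → ℕ → ℕ → ℕ → ℕ → ℕ → ℕ → List ℕ → ℕ
  loop₁ : Bool → ℕ → ℕ → ℕ → ℕ → ℕ → ℕ → ℕ → ℕ → List ℕ → ℕ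
  loop₂ : Bool → ℕ → ℕ → ℕ → ℕ → ℕ → ℕ → ℕ → ℕ → List ℕ → ℕ → ℕ
  tail : ℕ → ℕ → ℕ → ℕ
  pow : ℕ → ℕ → ℕ → ℕ → ℕ → ℕ → ℕ → ℕ → ℕ → ℕ → ℕ → ℕ → List ℕ → ℕ
  pow₁ : Bool → ℕ → ℕ → ℕ → ℕ → ℕ → ℕ → ℕ → ℕ → ℕ → ℕ → ℕ → ℕ → List ℕ → ℕ → ℕ
  pow₂ : ℕ → ℕ → ℕ → ℕ → ℕ → ℕ → ℕ → ℕ → ℕ → ℕ → ℕ → ℕ → List ℕ → ℕ → ℕ
  -- The comparison divisor handed down is whichever of m p^(e-1) and m₁ p^e has the larger
  -- abundancy, as it excludes more primes.
  child : Bool → ℕ → ℕ → ℕ → ℕ → ℕ → ℕ → ℕ → ℕ → List ℕ → ℕ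

  up zero m s m₁ s₁ R [] = crude m s B
  up zero m s m₁ s₁ R (p ∷ qs) = crude m s p
  up (suc f) m s m₁ s₁ R [] = crude m s B
  up (suc f) m s m₁ s₁ R (p ∷ qs) = up₁ f m s m₁ s₁ R p qs (2 * m₁ ∸ s₁)
  up₁ f m s m₁ s₁ R p qs zero = 0
  up₁ f m s m₁ s₁ R p qs (suc d₁) = up₂ (div s₁ (suc d₁) <ᵇ p) f m s m₁ s₁ R p qs (suc d₁)
  up₂ true f m s m₁ s₁ R p qs d₁ = cross f m s m₁ s₁ R (p ∷ qs) (2 * m ∸ s)
  up₂ false f m s m₁ s₁ R p qs d₁ = skipped (look T (div s₁ d₁)) f m s m₁ s₁ R p qs (div s₁ d₁)
  skipped (leaf a v t) f m s m₁ s₁ R p qs L =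
    if (R <ᵇ a) ∧ (v ≤ᵇ L) then cross f m s m₁ s₁ a t (2 * m ∸ s) else crude m s p
  cross f m s m₁ s₁ R [] d = crude m s B
  cross f m s m₁ s₁ R (p ∷ qs) zero = crude m s p
  cross f m s m₁ s₁ R (p ∷ qs) (suc d) = cross₁ (div s (suc d) <ᵇ p) f m s m₁ s₁ R p qs (suc d) (div s (suc d))
  cross₁ true f m s m₁ s₁ R p qs d H = loop f m s d m₁ s₁ R (p ∷ qs)
  cross₁ false f m s m₁ s₁ R p qs d H = crossed (look T H) f m s d m₁ s₁ R p H
  crossed (leaf a v t) f m s d m₁ s₁ R p H =
    -- The summand `v` repairs rounding: each of the at most v primes in the segment lost less than
    -- 1 in the stored masses.
    if (R <ᵇ a) ∧ (v ≤ᵇ H) then ceilDiv ((a ∸ R) + v) m + loop f m s d m₁ s₁ a t else crude m s p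
  loop f m s d m₁ s₁ R [] = crude m s B
  loop f m s d m₁ s₁ R (p ∷ qs) = loop₁ (p <ᵇ 64) f m s d m₁ s₁ R p qs
  loop₁ true f m s d m₁ s₁ R p qs = loop₂ (crude m s p <ᵇ ε₂) f m s d m₁ s₁ R p qs (crude m s p)
  loop₁ false f m s d m₁ s₁ R p qs = loop₂ (fine m s d p (level (div (d * (p ∸ 1)) s)) <ᵇ ε₁) f m s d m₁ s₁ R p qs (fine m s d p (level (div (d * (p ∸ 1)) s)))
  loop₂ true f m s d m₁ s₁ R p qs b = b
  loop₂ false zero m s d m₁ s₁ R p qs b = b
  loop₂ false (suc f) m s d m₁ s₁ R p qs b =
    pow f s s₁ p (m * p) (s * suc p) (suc p) m s (m₁ * p) (s₁ * suc p) (R + div K p) qs + loop f m s d m₁ s₁ (R + div K p) qs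
  -- Here mm = m p^e has divisor sum ss = s t, and m′ = m p^(e-1), n₁ = m₁ p^e have divisor sums s′, t₁.
  tail p m′ s′ = ceilDiv (K * (p * (crude₀ (suc p) + crude₁ (suc p) * (log s′ + log-prime p)))) (κ * ((p ∸ 1) * (p ∸ 1)) * m′)
  pow zero s s₁ p mm ss t m′ s′ n₁ t₁ R qs = tail p m′ s′
  pow (suc f) s s₁ p mm ss t m′ s′ n₁ t₁ R qs = pow₁ (tail p m′ s′ <ᵇ ε₃) f s s₁ p mm ss t m′ s′ n₁ t₁ R qs (tail p m′ s′)
  pow₁ true f s s₁ p mm ss t m′ s′ n₁ t₁ R qs b = b
  pow₁ false f s s₁ p mm ss t m′ s′ n₁ t₁ R qs b = pow₂ f s s₁ p mm ss t m′ s′ n₁ t₁ R qs (2 * mm ∸ ss)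
  pow₂ f s s₁ p mm ss t m′ s′ n₁ t₁ R qs zero = if 2 * n₁ ≤ᵇ t₁ then 0 else ceilDiv K mm
  pow₂ f s s₁ p mm ss t m′ s′ n₁ t₁ R qs (suc _) =
    pow f s s₁ p (mm * p) (ss * p + s) (t * p + 1) mm ss (n₁ * p) (t₁ * p + s₁) R qs
    + child (t₁ * m′ <ᵇ s′ * n₁) f mm ss m′ s′ n₁ t₁ R qs
  child true f mm ss m′ s′ n₁ t₁ R qs = up f mm ss m′ s′ R qs
  child false f mm ss m′ s′ n₁ t₁ R qs = up f mm ss n₁ t₁ R qs

-- @@USound

private variable
  m₁ s₁ : ℕ

if-< : ∀ {a b} (P : ℕ → Set) x c → (x < c → P a) → P b → P (if x <ᵇ c then a else b)
if-< P x c pa pb with x <ᵇ c in eq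
... | true = pa (<ᵇ-true eq)
... | false = pb

n<2^n : ∀ n → n < 2 ^ n
n<2^n zero = z<s
n<2^n (suc n) = ≤-trans (+-mono-≤ (m^n>0 2 n) (n<2^n n)) (≤-reflexive (cong (2 ^ n +_) (sym (+-identityʳ (2 ^ n)))))

log-sound : ∀ s → s ≤ 2 ^ log s
log-sound s = if-< P s 65536
    (λ b → if-< P s 1024 (λ b → if-< P s 128 <⇒≤ (<⇒≤ b)) (if-< P s 8192 <⇒≤ (<⇒≤ b)))
    (if-< P s 4194304 (λ b → if-< P s 524288 <⇒≤ (<⇒≤ b))
      (if-< P s 134217728 (λ b → if-< P s 33554432 <⇒≤ (<⇒≤ b))
        (if-< P s 1099511627776 (λ b → if-< P s 4294967296 <⇒≤ (<⇒≤ b)) (<⇒≤ (n<2^n s)))))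
  where
  P : ℕ → Set
  P l = s ≤ 2 ^ l

log-prime-sound : ∀ p → p < 2 ^ log-prime p
log-prime-sound p = if-< P p 64
    (λ b → if-< P p 8 (λ b → if-< P p 4 (λ b → b) b) (if-< P p 16 (λ b → b) (if-< P p 32 (λ b → b) b)))
    (if-< P p 256 (λ b → b) (if-< P p 1024 (λ b → b) (if-< P p 4096 (λ b → b) (n<2^n p))))
  where
  P : ℕ → Set
  P l = p < 2 ^ l

hasSmallFactor-sound : ∀ y → hasSmallFactor y ≡ true → ¬ Prime y
hasSmallFactor-sound y eq pr = [ (λ h → [ refute 2 , refute 3 ]′ (∨-true h)) , (λ h → [ refute 5 , refute 7 ]′ (∨-true h)) ]′ (∨-true eq)
  where
  refute : ∀ d {{_ : NonZero d}} {{_ : NonTrivial d}} → (d <ᵇ y) ∧ (y % d ≡ᵇ 0) ≡ true → ⊥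
  refute d h with prime⇒irreducible pr (m%n≡0⇒n∣m y d (≡ᵇ⇒≡ (y % d) 0 (subst T (sym (proj₂ (∧-true {d <ᵇ y} h))) tt)))
  ... | inj₁ d≡1 = <⇒≢ (nonTrivial⇒n>1 d) (sym d≡1)
  ... | inj₂ d≡y = <⇒≢ (<ᵇ-true (proj₁ (∧-true {d <ᵇ y} h))) d≡y

sp-+ : ∀ p a b → sp p (a + b) ≤ sp p a * suc p ^ b
sp-+ p a zero = ≤-reflexive (trans (cong (sp p) (+-identityʳ a)) (sym (*-identityʳ (sp p a))))
sp-+ p a (suc b) = begin
  sp p (a + suc b)                       ≡⟨ cong (sp p) (+-suc a b) ⟩
  sp p (a + b) * p + 1                   ≤⟨ +-monoʳ-≤ (sp p (a + b) * p) (sp>0 (a + b)) ⟩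
  sp p (a + b) * p + sp p (a + b)        ≡⟨ lem (sp p (a + b)) p ⟩
  suc p * sp p (a + b)                   ≤⟨ *-monoʳ-≤ (suc p) (sp-+ p a b) ⟩
  suc p * (sp p a * suc p ^ b)           ≡⟨ lem′ (suc p) (sp p a) (suc p ^ b) ⟩
  sp p a * (suc p * suc p ^ b)           ∎
  where
  open ≤-Reasoning
  sp>0 : ∀ e → 1 ≤ sp p e
  sp>0 zero = ≤-refl
  sp>0 (suc e) = m≤n+m 1 (sp p e * p)
  abstract
    lem : ∀ a p → a * p + a ≡ suc p * a
    lem = solve-∀
    lem′ : ∀ a b c → a * (b * c) ≡ b * (a * c)
    lem′ = solve-∀

crudeOK-later : ∀ y j k → crudeOK y (j + k) ≡ true → crudeOK (j + y) k ≡ true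
crudeOK-later y zero k ok = ok
crudeOK-later y (suc j) k ok = subst (λ z → crudeOK z k ≡ true) (+-suc j y)
  (crudeOK-later (suc y) j k (proj₂ (∧-true {((crude₀ (suc y) ≤ᵇ crude₀ y) ∧ (crude₁ (suc y) ≤ᵇ crude₁ y)) ∧ (hasSmallFactor y ∨ crudeStep y (y ∸ 1))} ok)))

table-≤ : Table y qs z → y ≤ z
table-≤ done = ≤-refl
table-≤ (skip _ t) = ≤-trans (n≤1+n _) (table-≤ t)
table-≤ (take _ t) = ≤-trans (n≤1+n _) (table-≤ t)

module UpperSoundness (N D : ℕ) (D-exact : ∀ k → 0 < k → k ≤ N → k * div D k ≡ D) (0<D : 0 < D)
  (κ α β μ : ℕ) (0<κ : 0 < κ) (κ≤8μ : κ ≤ μ * 8)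
  (cond₁ : κ * α + 16 * μ * α + 4 * μ * β ≤ 4 * κ * α)
  (cond₁′ : κ * β + 32 * μ * β ≤ 8 * κ * β)
  (cond₀ : 31 * κ * α + 124 * μ * α + 124 * μ * κ + (31 * μ * β + 16 * μ * κ) ≤ 124 * κ * α)
  (cond₀′ : 31 * κ * β + (248 * μ * β + 128 * μ * κ) ≤ 248 * κ * β)
  (mass-bound : ∀ y → 64 ≤ y → κ * Cell.mass N D D-exact y (suc y) ≤ μ * D)
  (κ≤1000 : κ ≤ 1000) (α≤1000 : α ≤ 1000) (β≤128 : 2 * β ≤ 256) (μ≤165 : μ ≤ 165) (crude-ok : crudeOK 2 62 ≡ true) where

  open Upper N
  open Potential N D D-exact 0<D κ α β μ 0<κ κ≤8μ cond₁ cond₁′ cond₀ cond₀′ mass-bound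

  Crude : ℕ → Set
  Crude y = ∀ {m s} ℓ → Smooth m s y → s ≤ 2 ^ ℓ → Bd (κ * m) m y (crude₀ y + crude₁ y * ℓ)

  -- A deficient m has 2m - s ≥ 1, so its threshold is at most s ≤ 2^ℓ and `R-bound` applies with ℓ
  -- blocks. The coefficient 169 is 165 + 256/64.
  crude-large : ∀ y → 64 ≤ y → 1000 ≤ crude₀ y → 169 ≤ crude₁ y → Crude y
  crude-large y 64≤y c₀ c₁ {m} {s} ℓ sm s≤ with s <? 2 * m
  ... | no nd = bd-mono (≤-trans κ≤1000 (≤-trans c₀ (m≤m+n _ _))) (bd-nondeficient (≤-trans (≮⇒≥ nd) (≤-reflexive (sym (Smooth.sig sm)))))
  ... | yes def = bd-cancel D 0<D (bd-mono total (bd-cast (lem₁ κ D m) refl (R-bound (suc N) ℓ (m≤n+m (suc N) y) ℓ sm def s≤ 64≤y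
          (≤-trans s≤ (≤-trans (m≤n*m (2 ^ ℓ) y {{>-nonZero (≤-trans (s≤s z≤n) 64≤y)}}) (m≤n*m _ (2 * m ∸ s) {{>-nonZero (m<n⇒0<n∸m def)}}))))))
    where
    open ≤-Reasoning
    abstract
      lem₁ : ∀ κ D m → κ * D * m ≡ D * (κ * m)
      lem₁ = solve-∀
      lem₂ : ∀ α D l u μ b → α * D + b * (l * u) + μ * D * l ≡ D * α + l * (b * u) + l * (μ * D)
      lem₂ = solve-∀
      lem₃ : ∀ D l c a b → D * c + l * (a * D) + l * (b * D) ≡ D * (c + (a + b) * l)
      lem₃ = solve-∀
    total : U y ℓ + μ * D * ℓ ≤ D * (crude₀ y + crude₁ y * ℓ)
    total = begin
      α * D + 2 * β * (ℓ * u y) + μ * D * ℓ               ≡⟨ lem₂ α D ℓ (u y) μ (2 * β) ⟩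
      D * α + ℓ * (2 * β * u y) + ℓ * (μ * D)             ≤⟨ +-mono-≤ (+-mono-≤ (*-monoʳ-≤ D α≤1000) (*-monoʳ-≤ ℓ small)) (*-monoʳ-≤ ℓ (*-monoˡ-≤ D μ≤165)) ⟩
      D * 1000 + ℓ * (4 * D) + ℓ * (165 * D)              ≡⟨ lem₃ D ℓ 1000 4 165 ⟩
      D * (1000 + 169 * ℓ)                                ≤⟨ *-monoʳ-≤ D (+-mono-≤ c₀ (*-monoˡ-≤ ℓ c₁)) ⟩
      D * (crude₀ y + crude₁ y * ℓ)                       ∎
      where
      small : 2 * β * u y ≤ 4 * D
      small = begin
        2 * β * u y            ≤⟨ *-monoˡ-≤ (u y) β≤128 ⟩
        4 * 64 * u y           ≡⟨ *-assoc 4 64 (u y) ⟩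
        4 * (64 * u y)         ≤⟨ *-monoʳ-≤ 4 (≤-trans (*-monoˡ-≤ (u y) 64≤y) (≤-trans (≤-reflexive (*-comm y (u y))) (div*≤ D y))) ⟩
        4 * D                  ∎

  crude-prime : ∀ y → Prime y → crudeStep y (y ∸ 1) ≡ true → Crude (suc y) → Crude y
  crude-prime y pr step next {m} {s} ℓ sm s≤ = bd-cancel (q₀ * q₀) (*-pos 0<q 0<q) (bd-mono total
      (bd-split (Smooth.pos sm) (prime>0 pr)
        (bd-cast (lem₁ κ (q₀ * q₀) m) refl (bd-powers-exact {c = κ} pr (Smooth.pos sm) powers))
        (bd-scale (q₀ * q₀) (next ℓ (smooth-later (n≤1+n y) sm) s≤))))
    where
    open ≤-Reasoning
    q₀ = y ∸ 1
    l = log-prime y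
    c₀ = crude₀ (suc y)
    c₁ = crude₁ (suc y)
    0<q : 0 < q₀
    0<q = m<n⇒0<n∸m (prime>1 pr)
    abstract
      lem₁ : ∀ κ Q m → κ * Q * m ≡ Q * (κ * m)
      lem₁ = solve-∀
      lem₂ : ∀ y Q c₀ c₁ ℓ l → y * (c₀ + c₁ * (ℓ + l)) + Q * (c₀ + c₁ * ℓ) ≡ Q * c₀ + y * (c₀ + c₁ * l) + (Q + y) * c₁ * ℓ
      lem₂ = solve-∀
      lem₃ : ∀ Q a b ℓ → Q * a + Q * b * ℓ ≡ Q * (a + b * ℓ)
      lem₃ = solve-∀
      lem₄ : ∀ e c₀ c₁ ℓ l → e * c₀ + c₁ * (e * ℓ + e * l) ≡ e * (c₀ + c₁ * (ℓ + l))
      lem₄ = solve-∀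
    powers : ∀ e → 0 < e → Bd (κ * (m * y ^ e)) (m * y ^ e) (suc y) (e * (c₀ + c₁ * (ℓ + l)))
    powers e 0<e = bd-mono (begin
      c₀ + c₁ * (ℓ + e * l)          ≤⟨ +-mono-≤ (m≤n*m c₀ e {{>-nonZero 0<e}}) (*-monoʳ-≤ c₁ (+-monoˡ-≤ (e * l) (m≤n*m ℓ e {{>-nonZero 0<e}}))) ⟩
      e * c₀ + c₁ * (e * ℓ + e * l)  ≡⟨ lem₄ e c₀ c₁ ℓ l ⟩
      e * (c₀ + c₁ * (ℓ + l))        ∎) (next (ℓ + e * l) (smooth-pow sm pr ≤-refl e) (pow-log {ℓ = ℓ} l e (log-prime-sound y) s≤))
    steps = ∧-true {q₀ * q₀ * c₀ + y * (c₀ + c₁ * l) ≤ᵇ q₀ * q₀ * crude₀ y} step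
    step₀ : q₀ * q₀ * c₀ + y * (c₀ + c₁ * l) ≤ q₀ * q₀ * crude₀ y
    step₀ = ≤ᵇ-true (proj₁ steps)
    step₁ : (q₀ * q₀ + y) * c₁ ≤ q₀ * q₀ * crude₁ y
    step₁ = ≤ᵇ-true (proj₂ steps)
    total : y * (c₀ + c₁ * (ℓ + l)) + q₀ * q₀ * (c₀ + c₁ * ℓ) ≤ q₀ * q₀ * (crude₀ y + crude₁ y * ℓ)
    total = begin
      y * (c₀ + c₁ * (ℓ + l)) + q₀ * q₀ * (c₀ + c₁ * ℓ)                ≡⟨ lem₂ y (q₀ * q₀) c₀ c₁ ℓ l ⟩
      q₀ * q₀ * c₀ + y * (c₀ + c₁ * l) + (q₀ * q₀ + y) * c₁ * ℓ        ≤⟨ +-mono-≤ step₀ (*-monoˡ-≤ ℓ step₁) ⟩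
      q₀ * q₀ * crude₀ y + q₀ * q₀ * crude₁ y * ℓ                      ≡⟨ lem₃ (q₀ * q₀) (crude₀ y) (crude₁ y) ℓ ⟩
      q₀ * q₀ * (crude₀ y + crude₁ y * ℓ)                              ∎

  crude-step : ∀ y → (crude₀ (suc y) ≤ᵇ crude₀ y) ∧ (crude₁ (suc y) ≤ᵇ crude₁ y) ≡ true → ∀ ℓ → crude₀ (suc y) + crude₁ (suc y) * ℓ ≤ crude₀ y + crude₁ y * ℓ
  crude-step y h ℓ = +-mono-≤ c₀ (*-monoˡ-≤ ℓ c₁)
    where
    parts = ∧-true {crude₀ (suc y) ≤ᵇ crude₀ y} h
    c₀ : crude₀ (suc y) ≤ crude₀ y
    c₀ = ≤ᵇ-true (proj₁ parts)
    c₁ : crude₁ (suc y) ≤ crude₁ y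
    c₁ = ≤ᵇ-true (proj₂ parts)

  crude-from : ∀ y k → 1 < y → crudeOK y k ≡ true → Crude (y + k) → Crude y
  crude-from y zero 1<y ok base = subst Crude (+-identityʳ y) base
  crude-from y (suc k) 1<y ok base with ∧-true {((crude₀ (suc y) ≤ᵇ crude₀ y) ∧ (crude₁ (suc y) ≤ᵇ crude₁ y)) ∧ (hasSmallFactor y ∨ crudeStep y (y ∸ 1))} ok
  ... | now , rest with ∧-true {(crude₀ (suc y) ≤ᵇ crude₀ y) ∧ (crude₁ (suc y) ≤ᵇ crude₁ y)} now | prime? y
  ...   | mono , step | no ¬pr = λ ℓ sm s≤ → bd-skip ¬pr 1<y (bd-mono (crude-step y mono ℓ)
            (crude-from (suc y) k (<-trans 1<y (n<1+n y)) rest (subst Crude (+-suc y k) base) ℓ (smooth-later (n≤1+n y) sm) s≤))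
  ...   | mono , step | yes pr with ∨-true {hasSmallFactor y} step
  ...     | inj₁ comp = ⊥-elim (hasSmallFactor-sound y comp pr)
  ...     | inj₂ good = crude-prime y pr good (crude-from (suc y) k (<-trans 1<y (n<1+n y)) rest (subst Crude (+-suc y k) base))

  crude-sound : ∀ y → 1 < y → Crude y
  crude-sound y 1<y with 64 ≤? y
  ... | yes 64≤y = subst Crude (m+[n∸m]≡n 64≤y) (from-64 (y ∸ 64))
    where
    from-64 : ∀ k → Crude (64 + k)
    from-64 k = crude-large (64 + k) (m≤m+n 64 k) ≤-refl ≤-refl
  ... | no 64≰y = crude-from y (64 ∸ y) 1<y ok (subst Crude (sym (m+[n∸m]≡n (<⇒≤ (≰⇒> 64≰y)))) (crude-large 64 ≤-refl ≤-refl ≤-refl))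
    where
    ok : crudeOK y (64 ∸ y) ≡ true
    ok = subst (λ z → crudeOK z (64 ∸ y) ≡ true) (m∸n+n≡m 1<y)
      (crudeOK-later 2 (y ∸ 2) (64 ∸ y) (subst (λ k → crudeOK 2 k ≡ true) (split 1<y (<⇒≤ (≰⇒> 64≰y))) crude-ok))
      where
      split : ∀ {y} → 2 ≤ y → y ≤ 64 → 62 ≡ y ∸ 2 + (64 ∸ y)
      split {suc (suc y)} (s≤s (s≤s _)) (s≤s (s≤s y≤62)) = sym (m+[n∸m]≡n y≤62)

  module Run (K B : ℕ) (64≤B : 64 ≤ B) (ps₀ : List ℕ) (table₀ : Table 2 ps₀ B) (ε₁ ε₂ ε₃ : ℕ) where
    open Soundness K B ps₀ table₀ using (At; at; Valid; valid; Valids; look-valid; at-head; at-step; at-raise; suffixes)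

    sumOver : (ℕ → ℕ) → List ℕ → ℕ
    sumOver h [] = 0
    sumOver h (p ∷ ps) = h p + sumOver h ps

    to-head : 1 < y → Table y (p ∷ qs) B → Bd c m p f → Bd c m y f
    to-head 1<y (skip ¬pr table) b = bd-skip ¬pr 1<y (to-head (<-trans 1<y (n<1+n _)) table b)
    to-head 1<y (take _ _) b = b

    to-end : 1 < y → Table y [] B → Bd c m B f → Bd c m y f
    to-end 1<y (skip ¬pr table) b = bd-skip ¬pr 1<y (to-end (<-trans 1<y (n<1+n _)) table b)
    to-end 1<y done b = b

    over-segment : ∀ seg {t} (h : ℕ → ℕ) → 1 < y → 0 < m → Table y (seg ++ t) B →
      All (λ p → Prime p → y ≤ p → Bd c (m * p) p (h p)) seg →
      (∀ y′ → y ≤ y′ → Table y′ t B → Bd c m y′ g) → Bd c m y (sumOver h seg + g)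
    over-segment [] h 1<y 0<m table [] rest = rest _ ≤-refl table
    over-segment {y} {m} {c} {g} (p ∷ seg) h 1<y 0<m table (b ∷ bs) rest with table-head table
    ... | pr , y≤p = to-head 1<y table (bd-cast refl (sym (+-assoc (h p) (sumOver h seg) g))
        (bd-split 0<m (prime>0 pr) (b pr y≤p)
          (over-segment seg h (<-trans (prime>1 pr) (n<1+n p)) 0<m (table-tail table)
            (All.map (λ k pr′ le → k pr′ (≤-trans y≤p (≤-trans (n≤1+n p) le))) bs)
            (λ y′ le → rest y′ (≤-trans y≤p (≤-trans (n≤1+n p) le))))))

    segment : ∀ {a v t} → At y R qs → Valid (leaf a v t) → R < a →
      ∃ λ seg → qs ≡ seg ++ t × All (_≤ v) seg × a ≡ R + Lower.mass K seg × (∀ y′ → Table y′ t B → At y′ a t)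
    segment (at pre split refl _) (valid (at pre′ split′ refl _) below) R<a with suffixes pre pre′ (trans (sym split) split′) R<a
    ... | seg , qs≡ , refl = seg , qs≡ , All.++⁻ʳ pre below , Lower.mass-++ K pre seg , λ y′ table → at (pre ++ seg) split′ refl table

    length-bound : ∀ seg {t} → Table y (seg ++ t) B → All (_≤ v) seg → 0 < y → length seg ≤ v
    length-bound {y} {v} seg table le 0<y = +-cancelʳ-≤ 1 _ _ (go seg table le 0<y)
      where
      go : ∀ {y} seg {t} → Table y (seg ++ t) B → All (_≤ v) seg → 0 < y → length seg + 1 ≤ v + 1
      deeper : ∀ {y} seg {t} → Table y (seg ++ t) B → All (_≤ v) seg → y ≤ suc v → length seg + y ≤ suc v
      deeper [] table [] y≤ = y≤
      deeper (p ∷ seg) table (p≤v ∷ le) y≤ = ≤-trans (≤-trans (≤-reflexive (sym (+-suc (length seg) _))) (+-monoʳ-≤ (length seg) (s≤s (proj₂ (table-head table)))))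
        (deeper seg (table-tail table) le (s≤s p≤v))
      go [] table [] 0<y = m≤n+m 1 v
      go (p ∷ seg) table (p≤v ∷ le) 0<y = ≤-trans (+-monoʳ-≤ (suc (length seg)) 0<y)
        (≤-trans (deeper (p ∷ seg) table (p≤v ∷ le) (≤-trans (proj₂ (table-head table)) (≤-trans p≤v (n≤1+n v)))) (≤-reflexive (+-comm 1 v)))

    sumOver-suc : ∀ seg → sumOver (λ p → div K p + 1) seg ≡ Lower.mass K seg + length seg
    sumOver-suc [] = refl
    sumOver-suc (p ∷ seg) = trans (cong (div K p + 1 +_) (sumOver-suc seg)) (lem (div K p) (Lower.mass K seg) (length seg))
      where
      abstract
        lem : ∀ a b c → a + 1 + (b + c) ≡ a + b + suc c
        lem = solve-∀

    sumOver-0 : ∀ seg → sumOver (λ _ → 0) seg ≡ 0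
    sumOver-0 [] = refl
    sumOver-0 (p ∷ seg) = sumOver-0 seg

    -- The first alternative starts the search at m = 1, which has no proper divisor: s₁ = 0 gives
    -- threshold 0, so no prime is excluded.
    Proper : ℕ → ℕ → ℕ → Set
    Proper m m₁ s₁ = (s₁ ≡ 0 × 0 < m₁) ⊎ (m₁ ∣ m × m₁ < m × σ m₁ ≡ s₁)

    prime-nondeficient : Prime p → ¬ p ∣ m → 0 < m → σ m ≡ s → d + s ≡ 2 * m → p * d ≤ s → 2 * (m * p) ≤ σ (m * p)
    prime-nondeficient {p} {m} {s} {d} pr p∤m 0<m σm d+s pd≤s = begin
      2 * (m * p)              ≡⟨ *-assoc 2 m p ⟨
      2 * m * p                ≡⟨ cong (_* p) d+s ⟨
      (d + s) * p              ≡⟨ lem d s p ⟩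
      p * d + s * p            ≤⟨ +-monoˡ-≤ (s * p) pd≤s ⟩
      s + s * p                ≡⟨ lem′ s p ⟩
      s * sp p 1               ≡⟨ cong (_* sp p 1) σm ⟨
      σ m * sp p 1             ≡⟨ σ-mult pr p∤m 0<m 1 ⟨
      σ (m * p ^ 1)            ≡⟨ cong (λ w → σ (m * w)) (*-identityʳ p) ⟩
      σ (m * p)                ∎
      where
      open ≤-Reasoning
      abstract
        lem : ∀ d s p → (d + s) * p ≡ p * d + s * p
        lem = solve-∀
        lem′ : ∀ s p → s + s * p ≡ s * (1 * p + 1)
        lem′ = solve-∀

    module _ {Tr : Tree} (vT : Valids Tr) where
      open Bounding K B κ α (2 * β) ε₁ ε₂ ε₃ Tr

      crude-at : 1 < y → Smooth m s y → Bd K m y (crude m s y)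
      crude-at {y} {m} {s} 1<y sm = bd-ceil K (*-pos 0<κ (Smooth.pos sm)) (crude-sound y 1<y (log s) sm (log-sound s))

      crude-head : 1 < y → Smooth m s y → Table y (p ∷ qs) B → Bd K m y (crude m s p)
      crude-head 1<y sm table with table-head table
      ... | pr , y≤p = to-head 1<y table (crude-at (prime>1 pr) (smooth-later y≤p sm))

      crude-end : 1 < y → Smooth m s y → Table y [] B → Bd K m y (crude m s B)
      crude-end 1<y sm table = to-end 1<y table (crude-at (≤-trans (s≤s (s≤s z≤n)) 64≤B) (smooth-later (table-≤ table) sm))

      tight : ∀ i → 64 ≤ y → Smooth m s y → d + s ≡ 2 * m → 0 < d → Cond i m s y →
              Bd K m y (ceilDiv (K * (α * y + 2 * β * log s)) (y * (κ * 4 ^ i * m)))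
      tight {y} {m} {s} {d} i 64≤y sm d+s 0<d cond with N <? y
      ... | yes N<y = bd-deficient (subst (_< 2 * m) (sym (Smooth.sig sm)) (subst (s <_) d+s (m<n+m s 0<d))) N<y
      ... | no N≮y = bd-ceil K (*-pos 0<y (*-pos (*-pos 0<κ (m^n>0 4 i)) (Smooth.pos sm)))
              (bd-cancel D 0<D (bd-cast (lem₁ y κ D (4 ^ i) m) value (bd-scale y (T-bound (suc N) (log s) (m≤n+m (suc N) y) i sm (log-sound s) 64≤y cond))))
        where
        0<y = ≤-trans (s≤s z≤n) 64≤y
        abstract
          lem₁ : ∀ y κ D t m → y * (κ * D * t * m) ≡ D * (y * (κ * t * m))
          lem₁ = solve-∀
          lem₂ : ∀ y α D b l u → y * (α * D + b * (l * u)) ≡ α * y * D + b * l * (y * u)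
          lem₂ = solve-∀
          lem₃ : ∀ y α D b l → α * y * D + b * l * D ≡ D * (α * y + b * l)
          lem₃ = solve-∀
        value : y * (α * D + 2 * β * (log s * u y)) ≡ D * (α * y + 2 * β * log s)
        value = trans (lem₂ y α D (2 * β) (log s) (u y)) (trans (cong (λ w → α * y * D + 2 * β * log s * w) (D-exact y 0<y (≮⇒≥ N≮y))) (lem₃ y α D (2 * β) (log s)))

      level-cond : ∀ i → d + s ≡ 2 * m → s * 2 ^ i ≤ d * (y ∸ 1) → Cond i m s y
      level-cond {d} {s} {m} {y} zero d+s le = begin
        s * suc y          ≡⟨ *-suc s y ⟩
        s + s * y          ≤⟨ +-monoˡ-≤ (s * y) (≤-trans (≤-reflexive (sym (*-identityʳ s))) (≤-trans le (*-monoʳ-≤ d (m∸n≤m y 1)))) ⟩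
        d * y + s * y      ≡⟨ *-distribʳ-+ y d s ⟨
        (d + s) * y        ≡⟨ cong (_* y) d+s ⟩
        2 * m * y          ∎
        where open ≤-Reasoning
      level-cond {d} {s} {m} {y} (suc i) d+s le = begin
        s * (2 ^ suc i + (y ∸ 1))        ≡⟨ *-distribˡ-+ s (2 ^ suc i) (y ∸ 1) ⟩
        s * 2 ^ suc i + s * (y ∸ 1)      ≤⟨ +-monoˡ-≤ (s * (y ∸ 1)) le ⟩
        d * (y ∸ 1) + s * (y ∸ 1)        ≡⟨ *-distribʳ-+ (y ∸ 1) d s ⟨
        (d + s) * (y ∸ 1)                ≡⟨ cong (_* (y ∸ 1)) d+s ⟩
        2 * m * (y ∸ 1)                  ∎
        where open ≤-Reasoning

      fine-sound : ∀ i → 64 ≤ y → Smooth m s y → d + s ≡ 2 * m → 0 < d → Bd K m y (fine m s d y i)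
      fine-sound {y} {m} {s} {d} i 64≤y sm d+s 0<d with (s * 2 ^ i ≤ᵇ d * (y ∸ 1)) ∨ ((i ≡ᵇ 0) ∧ (s ≤ᵇ d * y)) in ok
      ... | false = crude-at (≤-trans (s≤s (s≤s z≤n)) 64≤y) sm
      ... | true with ∨-true {s * 2 ^ i ≤ᵇ d * (y ∸ 1)} ok
      ...   | inj₁ le = tight i 64≤y sm d+s 0<d (level-cond {d} {s} {m} {y} i d+s (≤ᵇ-true le))
      ...   | inj₂ both = at-zero i (≡ᵇ⇒≡ i 0 (subst T (sym (proj₁ (∧-true {i ≡ᵇ 0} both))) tt))
        where
        at-zero : ∀ i → i ≡ 0 → Bd K m y (ceilDiv (K * (α * y + 2 * β * log s)) (y * (κ * 4 ^ i * m)))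
        at-zero zero _ = tight 0 64≤y sm d+s 0<d (≤-trans (≤-reflexive (*-suc s y)) (≤-trans (+-monoˡ-≤ (s * y) (≤ᵇ-true (proj₂ (∧-true {i ≡ᵇ 0} both))))
                  (≤-reflexive (trans (sym (*-distribʳ-+ y d s)) (cong (_* y) d+s)))))

      tail-sound : ∀ e {m′ s′} → Smooth m s y → Prime p → y ≤ p → m′ ≡ m * p ^ e → s′ ≡ s * sp p e → Bd K (m′ * p) p (tail p m′ s′)
      tail-sound {m} {s} {y} {p} e sm pr y≤p refl refl =
        bd-ceil K (*-pos (*-pos 0<κ (*-pos 0<q 0<q)) 0<m′) (bd-powers-exact {c = κ} pr 0<m′ powers)
        where
        open ≤-Reasoning
        m′ = m * p ^ e
        s′ = s * sp p e
        c₀ = crude₀ (suc p)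
        c₁ = crude₁ (suc p)
        ℓ₀ = log s′
        l = log-prime p
        0<m′ : 0 < m′
        0<m′ = *-pos (Smooth.pos sm) (pow-pos pr e)
        0<q : 0 < p ∸ 1
        0<q = m<n⇒0<n∸m (prime>1 pr)
        abstract
          lem₄ : ∀ e c₀ c₁ ℓ l → e * c₀ + c₁ * (e * ℓ + e * l) ≡ e * (c₀ + c₁ * (ℓ + l))
          lem₄ = solve-∀
        size : ∀ i → s * sp p (e + i) ≤ 2 ^ (ℓ₀ + i * l)
        size i = begin
          s * sp p (e + i)               ≤⟨ *-monoʳ-≤ s (sp-+ p e i) ⟩
          s * (sp p e * suc p ^ i)       ≡⟨ *-assoc s (sp p e) (suc p ^ i) ⟨
          s′ * suc p ^ i                 ≤⟨ *-mono-≤ (log-sound s′) (^-monoˡ-≤ i (log-prime-sound p)) ⟩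
          2 ^ ℓ₀ * (2 ^ l) ^ i           ≡⟨ cong (2 ^ ℓ₀ *_) (trans (^-*-assoc 2 l i) (cong (2 ^_) (*-comm l i))) ⟩
          2 ^ ℓ₀ * 2 ^ (i * l)           ≡⟨ ^-distribˡ-+-* 2 ℓ₀ (i * l) ⟨
          2 ^ (ℓ₀ + i * l)               ∎
        powers : ∀ i → 0 < i → Bd (κ * (m′ * p ^ i)) (m′ * p ^ i) (suc p) (i * (c₀ + c₁ * (ℓ₀ + l)))
        powers i 0<i = bd-mono (begin
          c₀ + c₁ * (ℓ₀ + i * l)          ≤⟨ +-mono-≤ (m≤n*m c₀ i {{>-nonZero 0<i}}) (*-monoʳ-≤ c₁ (+-monoˡ-≤ (i * l) (m≤n*m ℓ₀ i {{>-nonZero 0<i}}))) ⟩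
          i * c₀ + c₁ * (i * ℓ₀ + i * l)  ≡⟨ lem₄ i c₀ c₁ ℓ₀ l ⟩
          i * (c₀ + c₁ * (ℓ₀ + l))        ∎)
          (subst (λ M → Bd (κ * M) M (suc p) (c₀ + c₁ * (ℓ₀ + i * l))) (sym m′p^i)
            (crude-sound (suc p) (<-trans (prime>1 pr) (n<1+n p)) (ℓ₀ + i * l) (smooth-pow sm pr y≤p (e + i)) (size i)))
          where
          m′p^i : m′ * p ^ i ≡ m * p ^ (e + i)
          m′p^i = trans (*-assoc m (p ^ e) (p ^ i)) (cong (m *_) (sym (^-distribˡ-+-* p e i)))

      m₁>0 : 0 < m → m₁ ∣ m → 0 < m₁
      m₁>0 {m} 0<m (divides k refl) = *-pos⁻ʳ k 0<m

      dead : Smooth m s y → Proper m m₁ s₁ → d + s₁ ≡ 2 * m₁ → 0 < d → ∀ {p} → p * d ≤ s₁ → Prime p → y ≤ p → Bd c (m * p) p 0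
      dead sm (inj₁ (refl , _)) d+s 0<d {p} pd≤ pr y≤p = ⊥-elim (<⇒≱ (*-pos (prime>0 pr) 0<d) pd≤)
      dead {m} sm (inj₂ (m₁∣m , m₁<m , σm₁)) d+s 0<d {p} pd≤ pr y≤p =
        bd-blocked (*-monoˡ-∣ p m₁∣m) (*-monoˡ-< p {{prime⇒nonZero pr}} m₁<m)
          (prime-nondeficient pr (λ p∣m₁ → smooth⇒∤ sm pr y≤p (∣-trans p∣m₁ m₁∣m)) (m₁>0 (Smooth.pos sm) m₁∣m) σm₁ d+s pd≤)

      ∸≡suc : ∀ {a b c} → a ∸ b ≡ suc c → suc c + b ≡ a
      ∸≡suc {a} {b} eq = trans (cong (_+ b) (sym eq)) (m∸n+n≡m (<⇒≤ (m∸n≢0⇒n<m {a} {b} λ z → 0≢1+n (trans (sym z) eq))))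

      up-sound : ∀ f → 1 < y → Smooth m s y → Proper m m₁ s₁ → At y R qs → Bd K m y (up f m s m₁ s₁ R qs)
      cross-sound : ∀ f → 1 < y → Smooth m s y → Proper m m₁ s₁ → At y R qs → Bd K m y (cross f m s m₁ s₁ R qs (2 * m ∸ s))
      loop-sound : ∀ f → 1 < y → Smooth m s y → d + s ≡ 2 * m → 0 < d → Proper m m₁ s₁ → At y R qs → Bd K m y (loop f m s d m₁ s₁ R qs)
      expand-sound : ∀ b f {v} → 1 < y → Smooth m s y → d + s ≡ 2 * m → 0 < d → Proper m m₁ s₁ → At y R (p ∷ qs) → Bd K m y v →
                     Bd K m y (loop₂ b f m s d m₁ s₁ R p qs v)
      pow-sound : ∀ f e {mm ss t m′ s′ n₁ t₁} → Smooth m s y → Proper m m₁ s₁ → Prime p → y ≤ p → At (suc p) R qs →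
                  mm ≡ m * p ^ suc e → ss ≡ s * sp p (suc e) → t ≡ sp p (suc e) → m′ ≡ m * p ^ e → s′ ≡ s * sp p e →
                  n₁ ≡ m₁ * p ^ suc e → t₁ ≡ s₁ * sp p (suc e) →
                  Bd K mm p (pow f s s₁ p mm ss t m′ s′ n₁ t₁ R qs)

      up-sound {qs = []} zero 1<y sm pm atR = crude-end 1<y sm (At.table atR)
      up-sound {qs = p ∷ qs} zero 1<y sm pm atR = crude-head 1<y sm (At.table atR)
      up-sound {qs = []} (suc f) 1<y sm pm atR = crude-end 1<y sm (At.table atR)
      up-sound {y} {m} {s} {m₁} {s₁} {R} {p ∷ qs} (suc f) 1<y sm pm atR with 2 * m₁ ∸ s₁ in eq
      ... | zero = blocked pm (m∸n≡0⇒m≤n eq)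
        where
        blocked : Proper m m₁ s₁ → 2 * m₁ ≤ s₁ → Bd K m y 0
        blocked (inj₁ (refl , 0<m₁)) le = ⊥-elim (<⇒≱ (*-pos (z<s {1}) 0<m₁) le)
        blocked (inj₂ (m₁∣m , m₁<m , σm₁)) le = bd-blocked m₁∣m m₁<m (≤-trans le (≤-reflexive (sym σm₁)))
      ... | suc d₁ with div s₁ (suc d₁) <ᵇ p
      ...   | true = cross-sound f 1<y sm pm atR
      ...   | false with look Tr (div s₁ (suc d₁)) | look-valid vT (div s₁ (suc d₁))
      ...     | leaf a v t | vl with (R <ᵇ a) ∧ (v ≤ᵇ div s₁ (suc d₁)) in ok
      ...       | false = crude-head 1<y sm (At.table atR)
      ...       | true with segment atR vl (<ᵇ-true (proj₁ (∧-true {R <ᵇ a} ok)))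
      ...         | seg , qs≡ , seg≤ , _ , atT = bd-cast refl (cong (_+ cross f m s m₁ s₁ a t (2 * m ∸ s)) (sumOver-0 seg))
                      (over-segment seg (λ _ → 0) 1<y (Smooth.pos sm) (subst (λ l → Table y l B) qs≡ (At.table atR))
                        (All.map (λ {q} q≤v pr y≤q → dead sm pm (∸≡suc {2 * m₁} {s₁} eq) z<s (≤div⇒*≤ {s₁} {suc d₁} {q} (≤-trans q≤v (≤ᵇ-true (proj₂ (∧-true {R <ᵇ a} ok))))) pr y≤q) seg≤)
                        (λ y′ y≤y′ table → cross-sound f (<-≤-trans 1<y y≤y′) (smooth-later y≤y′ sm) pm (atT y′ table)))

      cross-sound {qs = []} f 1<y sm pm atR = crude-end 1<y sm (At.table atR)
      cross-sound {y} {m} {s} {m₁} {s₁} {R} {p ∷ qs} f 1<y sm pm atR with 2 * m ∸ s in eq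
      ... | zero = crude-head 1<y sm (At.table atR)
      ... | suc d with div s (suc d) <ᵇ p
      ...   | true = loop-sound f 1<y sm (∸≡suc {2 * m} {s} eq) z<s pm atR
      ...   | false with look Tr (div s (suc d)) | look-valid vT (div s (suc d))
      ...     | leaf a v t | vl with (R <ᵇ a) ∧ (v ≤ᵇ div s (suc d)) in ok
      ...       | false = crude-head 1<y sm (At.table atR)
      ...       | true with segment atR vl (<ᵇ-true (proj₁ (∧-true {R <ᵇ a} ok)))
      ...         | seg , qs≡ , seg≤ , a≡ , atT = bd-cancel m (Smooth.pos sm) (bd-mono total (bd-cast (*-comm K m) refl
                      (over-segment {c = K * m} seg (λ q → div K q + 1) 1<y (Smooth.pos sm) tableS
                        (All.map crossing seg≤)
                        (λ y′ y≤y′ table → bd-cast (*-comm m K) refl (bd-scale m (loop-sound f (<-≤-trans 1<y y≤y′) (smooth-later y≤y′ sm) (∸≡suc {2 * m} {s} eq) z<s pm (atT y′ table)))))))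
        where
        open ≤-Reasoning
        b = loop f m s (suc d) m₁ s₁ a t
        tableS = subst (λ l → Table y l B) qs≡ (At.table atR)
        crossing : ∀ {q} → q ≤ v → Prime q → y ≤ q → Bd (K * m) (m * q) q (div K q + 1)
        crossing {q} q≤v pr y≤q = bd-coarsen (begin
            K * m                          ≤⟨ *-monoˡ-≤ m (<⇒≤ (div<⇒<* {K} {q} {div K q + 1} (prime>0 pr) (≤-reflexive (sym (+-comm (div K q) 1))))) ⟩
            (div K q + 1) * q * m          ≡⟨ trans (*-assoc (div K q + 1) q m) (cong ((div K q + 1) *_) (*-comm q m)) ⟩
            (div K q + 1) * (m * q)        ∎)
          (bd-nondeficient (prime-nondeficient pr (smooth⇒∤ sm pr y≤q) (Smooth.pos sm) (Smooth.sig sm) (∸≡suc {2 * m} {s} eq)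
            (≤div⇒*≤ {s} {suc d} {q} (≤-trans q≤v (≤ᵇ-true (proj₂ (∧-true {R <ᵇ a} ok)))))))
        total : sumOver (λ q → div K q + 1) seg + m * b ≤ m * (ceilDiv ((a ∸ R) + v) m + b)
        total = begin
          sumOver (λ q → div K q + 1) seg + m * b                ≡⟨ cong (_+ m * b) (sumOver-suc seg) ⟩
          Lower.mass K seg + length seg + m * b                  ≤⟨ +-monoˡ-≤ (m * b) (+-mono-≤ (≤-reflexive (sym (trans (cong (_∸ R) a≡) (m+n∸m≡n R (Lower.mass K seg))))) (length-bound seg tableS seg≤ (<⇒≤ 1<y))) ⟩
          (a ∸ R) + v + m * b                                    ≤⟨ +-monoˡ-≤ (m * b) (<⇒≤ (div<⇒<* {(a ∸ R) + v} {m} (Smooth.pos sm) ≤-refl)) ⟩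
          ceilDiv ((a ∸ R) + v) m * m + m * b                    ≡⟨ cong (_+ m * b) (*-comm (ceilDiv ((a ∸ R) + v) m) m) ⟩
          m * ceilDiv ((a ∸ R) + v) m + m * b                    ≡⟨ *-distribˡ-+ m (ceilDiv ((a ∸ R) + v) m) b ⟨
          m * (ceilDiv ((a ∸ R) + v) m + b)                      ∎

      loop-sound {qs = []} f 1<y sm d+s 0<d pm atR = crude-end 1<y sm (At.table atR)
      loop-sound {y} {m} {s} {d = d} {qs = p ∷ qs} f 1<y sm d+s 0<d pm atR with p <ᵇ 64 in p<64
      ... | true = expand-sound (crude m s p <ᵇ ε₂) f 1<y sm d+s 0<d pm atR (crude-head 1<y sm (At.table atR))
      ... | false = expand-sound (fine m s d p i <ᵇ ε₁) f 1<y sm d+s 0<d pm atR (to-head 1<y (At.table atR)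
                      (fine-sound i (<ᵇ-false p<64) (smooth-later (proj₂ (at-head atR)) sm) d+s 0<d))
        where i = level (div (d * (p ∸ 1)) s)

      expand-sound true f 1<y sm d+s 0<d pm atR b = b
      expand-sound false zero 1<y sm d+s 0<d pm atR b = b
      expand-sound {m = m} {s} {m₁ = m₁} {s₁} {p = p} false (suc f) 1<y sm d+s 0<d pm atR b with at-head atR
      ... | pr , y≤p = to-head 1<y (At.table atR) (bd-split (Smooth.pos sm) (prime>0 pr)
          (pow-sound f 0 sm pm pr y≤p (at-step atR) (cong (m *_) (sym (*-identityʳ p))) (cong (s *_) (suc-sp p)) (suc-sp p)
            (sym (*-identityʳ m)) (sym (*-identityʳ s)) (cong (m₁ *_) (sym (*-identityʳ p))) (cong (s₁ *_) (suc-sp p)))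
          (loop-sound f (<-trans (prime>1 pr) (n<1+n p)) (smooth-later (≤-trans y≤p (n≤1+n p)) sm) d+s 0<d pm (at-step atR)))
        where
        abstract
          suc-sp : ∀ p → suc p ≡ 1 * p + 1
          suc-sp = solve-∀

      pow-sound {m} {s} {p = p} zero e sm pm pr y≤p atR refl refl refl refl refl refl refl =
        subst (λ M → Bd K M p (tail p (m * p ^ e) (s * sp p e))) (lem m p (p ^ e)) (tail-sound e sm pr y≤p refl refl)
        where
        abstract
          lem : ∀ m p t → m * t * p ≡ m * (p * t)
          lem = solve-∀
      pow-sound {m} {s} {y} {m₁} {s₁} {p} {R} {qs} (suc f) e sm pm pr y≤p atR refl refl refl refl refl refl refl
        with tail p (m * p ^ e) (s * sp p e) <ᵇ ε₃
      ... | true = subst (λ M → Bd K M p (tail p (m * p ^ e) (s * sp p e))) (lem m p (p ^ e)) (tail-sound e sm pr y≤p refl refl)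
        where
        abstract
          lem : ∀ m p t → m * t * p ≡ m * (p * t)
          lem = solve-∀
      ... | false with 2 * (m * p ^ suc e) ∸ s * sp p (suc e) in eq
      ...   | zero with 2 * (m₁ * p ^ suc e) ≤ᵇ s₁ * sp p (suc e) in dead?
      ...     | false = bd-ceil′ (bd-nondeficient (≤-trans (m∸n≡0⇒m≤n eq) (≤-reflexive (sym (σ-pow sm pr y≤p (suc e))))))
        where
        0<M : 0 < m * p ^ suc e
        0<M = *-pos (Smooth.pos sm) (pow-pos pr (suc e))
        bd-ceil′ : Bd (1 * (m * p ^ suc e)) (m * p ^ suc e) p 1 → Bd K (m * p ^ suc e) p (ceilDiv K (m * p ^ suc e))
        bd-ceil′ h = bd-cast refl (cong (λ k → ceilDiv k (m * p ^ suc e)) (*-identityʳ K)) (bd-ceil K 0<M (bd-cast (*-identityˡ (m * p ^ suc e)) refl h))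
      ...     | true = blocked pm (≤ᵇ-true dead?)
        where
        blocked : Proper m m₁ s₁ → 2 * (m₁ * p ^ suc e) ≤ s₁ * sp p (suc e) → Bd K (m * p ^ suc e) p 0
        blocked (inj₁ (refl , 0<m₁)) le = ⊥-elim (<⇒≱ (*-pos (z<s {1}) (*-pos 0<m₁ (pow-pos pr (suc e)))) le)
        blocked (inj₂ (m₁∣m , m₁<m , σm₁)) le = bd-blocked (*-monoˡ-∣ (p ^ suc e) m₁∣m) (*-monoˡ-< (p ^ suc e) {{>-nonZero (pow-pos pr (suc e))}} m₁<m)
          (≤-trans le (≤-reflexive (trans (cong (_* sp p (suc e)) (sym σm₁)) (sym (σ-mult pr (λ h → smooth⇒∤ sm pr y≤p (∣-trans h m₁∣m)) (m₁>0 (Smooth.pos sm) m₁∣m) (suc e))))))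
      pow-sound {m} {s} {y} {m₁} {s₁} {p} {R} {qs} (suc f) e sm pm pr y≤p atR refl refl refl refl refl refl refl | false | suc dd =
          bd-split (Smooth.pos sm′) (prime>0 pr) more (children (s₁ * sp p (suc e) * (m * p ^ e) <ᵇ s * sp p e * (m₁ * p ^ suc e)))
        where
        sm′ : Smooth (m * p ^ suc e) (s * sp p (suc e)) (suc p)
        sm′ = smooth-pow sm pr y≤p (suc e)
        abstract
          lem₁ : ∀ m p t → m * t * p ≡ m * (p * t)
          lem₁ = solve-∀
          lem₂ : ∀ s t p → s * t * p + s ≡ s * (t * p + 1)
          lem₂ = solve-∀
        more = subst (λ M → Bd K M p (pow f s s₁ p (m * p ^ suc e * p) (s * sp p (suc e) * p + s) (sp p (suc e) * p + 1) (m * p ^ suc e) (s * sp p (suc e)) (m₁ * p ^ suc e * p) (s₁ * sp p (suc e) * p + s₁) R qs))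
          refl (pow-sound f (suc e) sm pm pr y≤p atR (lem₁ m p (p ^ suc e)) (lem₂ s (sp p (suc e)) p) refl refl refl (lem₁ m₁ p (p ^ suc e)) (lem₂ s₁ (sp p (suc e)) p))
        previous : Proper (m * p ^ suc e) (m * p ^ e) (s * sp p e)
        previous = inj₂ (*-monoʳ-∣ m (divides p refl) , *-monoʳ-< m {{>-nonZero (Smooth.pos sm)}} (m<n*m (p ^ e) p {{>-nonZero (pow-pos pr e)}} (prime>1 pr)) , σ-pow sm pr y≤p e)
          where
          m<n*m : ∀ a b {{_ : NonZero a}} → 1 < b → a < b * a
          m<n*m a b 1<b = <-≤-trans (m<m*n a b 1<b) (≤-reflexive (*-comm a b))
        lifted : Proper m m₁ s₁ → Proper (m * p ^ suc e) (m₁ * p ^ suc e) (s₁ * sp p (suc e))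
        lifted (inj₁ (refl , 0<m₁)) = inj₁ (refl , *-pos 0<m₁ (pow-pos pr (suc e)))
        lifted (inj₂ (m₁∣m , m₁<m , σm₁)) = inj₂ (*-monoˡ-∣ (p ^ suc e) m₁∣m , *-monoˡ-< (p ^ suc e) {{>-nonZero (pow-pos pr (suc e))}} m₁<m ,
          trans (σ-mult pr (λ h → smooth⇒∤ sm pr y≤p (∣-trans h m₁∣m)) (m₁>0 (Smooth.pos sm) m₁∣m) (suc e)) (cong (_* sp p (suc e)) σm₁))
        children : ∀ b → Bd K (m * p ^ suc e) (suc p) (child b f (m * p ^ suc e) (s * sp p (suc e)) (m * p ^ e) (s * sp p e) (m₁ * p ^ suc e) (s₁ * sp p (suc e)) R qs)
        children true = up-sound f (<-trans (prime>1 pr) (n<1+n p)) sm′ previous atR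
        children false = up-sound f (<-trans (prime>1 pr) (n<1+n p)) sm′ (lifted pm) atR

-- @@Final

open import Data.Integer using (+_; +≤+; +<+)

fraction : ℕ → ℕ → ℚᵘ
fraction a zero = mkℚᵘ (+ 0) 0
fraction a (suc b) = mkℚᵘ (+ a) b

toℚᵘ-/ : ∀ a b → ℚ.toℚᵘ (+ a ℚ./ suc b) ≃ fraction a (suc b)
toℚᵘ-/ a b = ℚ.toℚᵘ-fromℚᵘ (mkℚᵘ (+ a) b)

fraction-≃ : ∀ {a b c d} → 0 < b → 0 < d → a * d ≡ c * b → fraction a b ≃ fraction c d
fraction-≃ {a} {suc b} {c} {suc d} _ _ eq = *≡* (trans (sym (ℤ.pos-* a (suc d))) (trans (cong +_ eq) (ℤ.pos-* c (suc b))))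

fraction-+ : ∀ {a b c d} → 0 < b → 0 < d → fraction a b ℚᵘ.+ fraction c d ≃ fraction (a * d + c * b) (b * d)
fraction-+ {a} {suc b} {c} {suc d} _ _ = *≡* (cong (ℤ._* + (suc b * suc d)) (trans (cong₂ ℤ._+_ (sym (ℤ.pos-* a (suc d))) (sym (ℤ.pos-* c (suc b)))) (sym (ℤ.pos-+ (a * suc d) (c * suc b)))))

sumInv-recips : ∀ {P} xs → 0 < P → All (0 <_) xs → All (_∣ P) xs → ℚ.toℚᵘ (sumInv xs) ≃ fraction (recips P xs) P
sumInv-recips {P} [] 0<P [] [] = fraction-≃ {0} {1} {0} {P} z<s 0<P refl
sumInv-recips {P} (suc n ∷ xs) 0<P (_ ∷ pos) (n∣P ∷ ds) = begin
  ℚ.toℚᵘ (inv (suc n) ℚ.+ sumInv xs)                            ≈⟨ ℚ.toℚᵘ-homo-+ (inv (suc n)) (sumInv xs) ⟩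
  ℚ.toℚᵘ (inv (suc n)) ℚᵘ.+ ℚ.toℚᵘ (sumInv xs)                  ≈⟨ ℚᵘ.+-cong (toℚᵘ-/ 1 n) (sumInv-recips xs 0<P pos ds) ⟩
  fraction 1 (suc n) ℚᵘ.+ fraction (recips P xs) P              ≈⟨ fraction-+ {1} {suc n} {recips P xs} {P} z<s 0<P ⟩
  fraction (1 * P + recips P xs * suc n) (suc n * P)            ≈⟨ fraction-≃ {1 * P + recips P xs * suc n} {suc n * P} (*-pos (z<s {n}) 0<P) 0<P eq ⟩
  fraction (div P (suc n) + recips P xs) P                      ∎
  where
  open ℚᵘ.≃-Reasoning
  abstract
    lem : ∀ N w R P → (1 * (N * w) + R * N) * P ≡ (w + R) * (N * P)
    lem = solve-∀
  eq : (1 * P + recips P xs * suc n) * P ≡ (div P (suc n) + recips P xs) * (suc n * P)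
  eq = trans (cong (λ z → (1 * z + recips P xs * suc n) * P) (sym (div-∣ z<s n∣P))) (lem (suc n) (div P (suc n)) (recips P xs) P)

module _ {P : ℕ} {xs : List ℕ} (0<P : 0 < P) (pos : All (0 <_) xs) (divs : All (_∣ P) xs) where

  sumInv-≤ : ∀ a n .{{_ : NonZero n}} → recips P xs * n ≤ a * P → sumInv xs ℚ.≤ + a ℚ./ n
  sumInv-≤ a (suc b) le = ℚ.toℚᵘ-cancel-≤ (ℚᵘ.≤-respʳ-≃ (ℚᵘ.≃-sym (toℚᵘ-/ a b)) (ℚᵘ.≤-respˡ-≃ (ℚᵘ.≃-sym (sumInv-recips xs 0<P pos divs)) (cross P 0<P le)))
    where
    cross : ∀ P → 0 < P → recips P xs * suc b ≤ a * P → fraction (recips P xs) P ℚᵘ.≤ fraction a (suc b)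
    cross (suc P) _ le = *≤* (subst₂ ℤ._≤_ (ℤ.pos-* (recips (suc P) xs) (suc b)) (ℤ.pos-* a (suc P)) (+≤+ le))

  <-sumInv : ∀ a n .{{_ : NonZero n}} → a * P < recips P xs * n → + a ℚ./ n ℚ.< sumInv xs
  <-sumInv a (suc b) lt = ℚ.toℚᵘ-cancel-< (ℚᵘ.<-respˡ-≃ (ℚᵘ.≃-sym (toℚᵘ-/ a b)) (ℚᵘ.<-respʳ-≃ (ℚᵘ.≃-sym (sumInv-recips xs 0<P pos divs)) (cross P 0<P lt)))
    where
    cross : ∀ P → 0 < P → a * P < recips P xs * suc b → fraction a (suc b) ℚᵘ.< fraction (recips P xs) P
    cross (suc P) _ lt = *<* (subst₂ ℤ._<_ (ℤ.pos-* a (suc P)) (ℤ.pos-* (recips (suc P) xs) (suc b)) (+<+ lt))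

positive : ∀ {xs} → All PND xs → All (0 <_) xs
positive = All.map λ pnd → proj₁ (proj₁ pnd)

product>0 : ∀ {xs} → All (0 <_) xs → 0 < product xs
product>0 [] = z<s
product>0 (p ∷ ps) = *-pos p (product>0 ps)

all-∣product : ∀ xs → All (_∣ product xs) xs
all-∣product xs = All.tabulate λ {x} → ∈⇒∣product {x} {xs}

scale : ℕ
scale = 10000000000000000

-- The constants are κ = 1000, α = 350 and 2β = 250, followed by the three cut-offs below which a
-- branch is closed by its bound.
upperValue : ℕ → ℕ → List ℕ → Tree → ℕ
upperValue n f ps Tr = Bounding.up scale (f + f + 3) 1000 350 250 100000000000 2000000000 1500000000 Tr n 1 1 1 0 0 ps

lowerValue : ℕ → List ℕ → Tree → GBuilt → ℕ
lowerValue n ps Tr (gbuilt G _) = Search.go scale Tr G n 1 1 1 0 ps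

-- The two regimes meet at 10500 = 210 · 50. Windows for y ≤ 10500 involve primes up to 2y, hence a
-- table reaching 21001.
massOK : List ℕ → Bool
massOK ps = windowsOK 1000 165 1000000000 10500 ps ∧ (1000 * (48 * blockCeil 1000000000 50 52) ≤ᵇ 165 * 1000000000)

boundsOK : ℕ → ℕ → ℕ → List ℕ → Built → Bool
boundsOK n g f ps (built Tr _) = massOK ps
  ∧ ((upperValue n f ps Tr ≤ᵇ 3793 * 1000000000000) ∧ (34842 * 100000000000 <ᵇ lowerValue n ps Tr (Search.gbuild scale g Tr 30)))

listOK : ℕ → ℕ → ℕ → ℕ → List ℕ → Bool
listOK n g h f ps = boundsOK n g f ps (Search.build scale h (leaf 0 1 ps))

computation : ℕ → ℕ → ℕ → ℕ → Bool
computation n g h f = ((21001 ≤ᵇ f + f + 3) ∧ crudeOK 2 62) ∧ listOK n g h f (primeList f)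

smooth-1 : Smooth 1 1 2
smooth-1 = smooth-node z<s refl λ pr r∣1 → ⊥-elim (<⇒≢ (prime>1 pr) (sym (∣1⇒≡1 r∣1)))

-- N! serves as the common multiple D of all positive integers up to N.
!-exact : ∀ N k → 0 < k → k ≤ N → k * div (N !) k ≡ N !
!-exact N (suc k) _ k≤N = div-∣ z<s (∣-trans (m∣m*n (k !)) (m≤n⇒m!∣n! k≤N))

mass-ok : ∀ N B {ps} → Table 2 ps B → 21001 ≤ B → massOK ps ≡ true →
  ∀ y → 64 ≤ y → 1000 * Cell.mass N (N !) (!-exact N) y (suc y) ≤ 165 * N !
mass-ok N B {ps} table 21001≤B ok y 64≤y with y ≤? 10500
... | yes y≤ = MassBound.small-mass N (N !) (!-exact N) 1000 165 1000000000 (≤ᵇ⇒≤ 1 1000000000 tt) table (proj₁ (∧-true ok)) (≤-trans (s≤s (s≤s z≤n)) 64≤y) 64≤y y≤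
        (≤-trans (+-mono-≤ y≤ (s≤s y≤)) 21001≤B)
... | no y≰ = MassBound.large-mass N (N !) (!-exact N) 1000 165 1000000000 (≤ᵇ⇒≤ 1 1000000000 tt) 50 z<s
        (≤ᵇ-true (proj₂ (∧-true {windowsOK 1000 165 1000000000 10500 ps} ok))) (<⇒≤ (≰⇒> y≰))

module Root (f : ℕ) (21001≤end : 21001 ≤ f + f + 3) (crude-ok : crudeOK 2 62 ≡ true) where
  end = f + f + 3
  ps = primeList f
  open Soundness scale end ps (primeList-table f)

  root : At 2 0 ps
  root = at [] refl refl (primeList-table f)

  first-leaf : Valid (leaf 0 1 ps)
  first-leaf = valid root []

  upper : ∀ {Tr} → Valids Tr → massOK ps ≡ true → ∀ n N → Upper.Bd N scale 1 2 (upperValue n f ps Tr)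
  upper vT mok n N = UpperSoundness.Run.up-sound N (N !) (!-exact N) (>-nonZero⁻¹ (N !) {{>-nonZero (m^!>0 N)}}) 1000 350 125 165 z<s (≤ᵇ⇒≤ 1000 1320 tt)
      (≤ᵇ⇒≤ _ _ tt) (≤ᵇ⇒≤ _ _ tt) (≤ᵇ⇒≤ _ _ tt) (≤ᵇ⇒≤ _ _ tt)
      (mass-ok N end (primeList-table f) 21001≤end mok) ≤-refl (≤ᵇ⇒≤ 350 1000 tt) (≤ᵇ⇒≤ 250 256 tt) ≤-refl crude-ok
      scale end (≤-trans (≤ᵇ⇒≤ 64 21001 tt) 21001≤end) ps (primeList-table f) 100000000000 2000000000 1500000000 vT
      n (s≤s (s≤s z≤n)) smooth-1 (inj₁ (refl , z<s)) root
    where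
    m^!>0 : ∀ n → 0 < n !
    m^!>0 zero = z<s
    m^!>0 (suc n) = *-pos (z<s {n}) (m^!>0 n)

  lower : ∀ {Tr GB} (vT : Valids Tr) → WindowsBuilt vT GB → ∀ n → Lower.LB scale 1 2 (lowerValue n ps Tr GB)
  lower vT (gbuilt wG) n = go-sound vT wG n (record
    { base = smooth-1
    ; def = s≤s (s≤s z≤n)
    ; M>0 = z<s
    ; top = λ {r} {k} pr 1≡rk → ⊥-elim (<⇒≢ (prime>1 pr) (sym (∣1⇒≡1 (divides k (trans 1≡rk (*-comm r k))))))
    }) root

ext-root : ∀ {xs} → All PND xs → All (Ext 1 2) xs
ext-root = All.map λ {n} _ → ext n (sym (+-identityʳ n)) 2-rough

-- The product P of the list is used both as common multiple and as cutoff N, since entries dividing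
-- P are at most P; uniformity in N makes this choice legitimate.
upper-half : ∀ {b} → (∀ N → Upper.Bd N scale 1 2 b) → b ≤ 3793 * 1000000000000 →
  ∀ xs → All PND xs → Unique xs → sumInv xs ℚ.≤ + 3793 ℚ./ 10000
upper-half {b} bd b≤ xs pnds uniq = sumInv-≤ 0<P pos divs 3793 10000 (rescale (recips P xs) P 3793 10000 1000000000000 scale z<s refl
    (≤-trans (Upper.Bd.bound (bd P) pnds uniq (ext-root pnds) (All.map (∣⇒≤ {{>-nonZero 0<P}}) divs) divs) (*-monoˡ-≤ P b≤)))
  where
  pos = positive pnds
  P = product xs
  0<P = product>0 pos
  divs = all-∣product xs
  rescale : ∀ R P a b c K → 0 < c → K ≡ b * c → K * R ≤ a * c * P → R * b ≤ a * P
  rescale R P a b c K 0<c refl le = *-cancelˡ-≤ c {{>-nonZero 0<c}} (subst₂ _≤_ (lem₁ b c R) (lem₂ a c P) le)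
    where
    abstract
      lem₁ : ∀ b c R → b * c * R ≡ c * (R * b)
      lem₁ = solve-∀
      lem₂ : ∀ a c P → a * c * P ≡ c * (a * P)
      lem₂ = solve-∀

rescale-< : ∀ R P a b c K x → 0 < c → K ≡ b * c → 0 < P → a * c < x → x * P ≤ K * (1 * R) → a * P < R * b
rescale-< R P a b c K x 0<c refl 0<P ac<x le = *-cancelˡ-< c _ _ (begin-strict
  c * (a * P)        ≡⟨ lem₁ a c P ⟩
  a * c * P          <⟨ *-monoˡ-< P {{>-nonZero 0<P}} ac<x ⟩
  x * P              ≤⟨ le ⟩
  b * c * (1 * R)    ≡⟨ lem₂ b c R ⟩
  c * (R * b)        ∎)
  where
  open ≤-Reasoning
  abstract
    lem₁ : ∀ a c P → c * (a * P) ≡ a * c * P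
    lem₁ = solve-∀
    lem₂ : ∀ b c R → b * c * (1 * R) ≡ c * (R * b)
    lem₂ = solve-∀

lower-half : ∀ {x} → Lower.LB scale 1 2 x → 34842 * 100000000000 < x →
  Σ (List ℕ) (λ xs → All PND xs × Unique xs × (+ 34842 ℚ./ 100000) ℚ.< sumInv xs)
lower-half {x} (Lower.lb xs pnds uniq exts bound) x> = xs , pnds , uniq ,
  <-sumInv 0<P pos divs 34842 100000 (rescale-< (recips P xs) P 34842 100000 100000000000 scale x z<s refl 0<P x> (bound P divs))
  where
  pos = positive pnds
  P = product xs
  0<P = product>0 pos
  divs = all-∣product xs

Conclusion : Set
Conclusion = (∀ xs → All PND xs → Unique xs → sumInv xs ℚ.≤ + 3793 ℚ./ 10000)
  × Σ (List ℕ) (λ xs → All PND xs × Unique xs × (+ 34842 ℚ./ 100000) ℚ.< sumInv xs)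

conclusion : ∀ n g h f → computation n g h f ≡ true → Conclusion
conclusion n g h f ok = finish (build-valid h first-leaf) (proj₂ outer)
  where
  outer : ((21001 ≤ᵇ f + f + 3) ∧ crudeOK 2 62) ≡ true × listOK n g h f (primeList f) ≡ true
  outer = ∧-true ok
  inner : (21001 ≤ᵇ f + f + 3) ≡ true × crudeOK 2 62 ≡ true
  inner = ∧-true (proj₁ outer)
  open Root f (≤ᵇ-true (proj₁ inner)) (proj₂ inner)
  open Soundness scale end ps (primeList-table f) using (ValidBuilt; build-valid; vbuilt; gbuild-sound)
  finish : ∀ {Bt} → ValidBuilt Bt → boundsOK n g f ps Bt ≡ true → Conclusion
  finish (vbuilt {Tr} vT _) ok′ = upper-half (upper vT (proj₁ parts) n) (≤ᵇ-true (proj₁ values)) , lower-half (lower vT (gbuild-sound vT g 30) n) (<ᵇ-true (proj₂ values))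
    where
    parts : massOK ps ≡ true × ((upperValue n f ps Tr ≤ᵇ 3793 * 1000000000000) ∧ (34842 * 100000000000 <ᵇ lowerValue n ps Tr (Search.gbuild scale g Tr 30))) ≡ true
    parts = ∧-true ok′
    values : (upperValue n f ps Tr ≤ᵇ 3793 * 1000000000000) ≡ true × (34842 * 100000000000 <ᵇ lowerValue n ps Tr (Search.gbuild scale g Tr 30)) ≡ true
    values = ∧-true (proj₂ parts)

-- @@Top

abstract
  -- Recursion depth 100000, 2^9 windows, 2^14 leaves, and the primes below 2 · 65534 + 3 = 131071.
  verified : computation 100000 9 14 65534 ≡ true
  verified = refl

theorem1p1 : Σ ℚ (λ b → (b ℚ.< (+ 37937 ℚ./ 100000)) × ((xs : List ℕ) → All PND xs → Unique xs → sumInv xs ℚ.≤ b))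
    × Σ (List ℕ) (λ xs → All PND xs × Unique xs × ((+ 34842 ℚ./ 100000) ℚ.< sumInv xs))
theorem1p1 = (+ 3793 ℚ./ 10000 , toWitness {a? = (+ 3793 ℚ./ 10000) ℚ.<? (+ 37937 ℚ./ 100000)} _ , proj₁ (conclusion 100000 9 14 65534 verified)) , proj₂ (conclusion 100000 9 14 65534 verified)
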